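{- Let $n,k,t$ be positive integers such that either $t=1$, $n\ge 2k+5$ and $k\ge 30$, or $1<t\le \frac k4-2$ and $n\ge 2k+14t$. Then every non-trivial intersecting family $\mathcal F\subset\binom{[n]}{k}$ satisfies $$\delta_t(\mathcal F)\le \binom{n-t-1}{k-t-1}-\binom{n-t-k-1}{k-t-1}.$$
   Context: $[n]=\{1,\dots,n\}$ and $\binom{[n]}{k}$ is the set of $k$-element subsets of $[n]$. A family $\mathcal F$ is intersecting if any two of its sets intersect, and it is non-trivial if $\bigcap_{F\in\mathcal F}F=\emptyset$. For $S\subset[n]$, its degree is the number of sets of $\mathcal F$ containing $S$; $\delta_t(\mathcal F)$ is the minimum degree of a $t$-element subset of $[n]$. -}

module Defs where

open import Data.Nat using (ℕ; _≤_)
open import Data.Product using (Σ; ∃; _×_)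
open import Data.List using (List; length; filter)
open import Data.List.Membership.Propositional using () renaming (_∈_ to _∈ₗ_)
open import Data.List.Relation.Unary.Unique.Propositional using (Unique)
open import Data.Fin using (Fin)
open import Data.Fin.Subset using (Subset; _∈_; _∉_; _∩_; ∣_∣; Nonempty; _⊆_)
open import Data.Fin.Subset.Properties using (_⊆?_)
open import Relation.Binary.PropositionalEquality using (_≡_)

-- A family of subsets of [n] = Fin n, given as a duplicate-free list.
Family : ℕ → Set
Family n = List (Subset n)

IsKUniform : ∀ {n} → ℕ → Family n → Set
IsKUniform {n} k 𝓕 = Unique 𝓕 × (∀ F → F ∈ₗ 𝓕 → ∣ F ∣ ≡ k)

Intersecting : ∀ {n} → Family n → Set
Intersecting 𝓕 = ∀ F G → F ∈ₗ 𝓕 → G ∈ₗ 𝓕 → Nonempty (F ∩ G)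

NonTrivial : ∀ {n} → Family n → Set
NonTrivial {n} 𝓕 = ∀ (x : Fin n) → ∃ λ F → F ∈ₗ 𝓕 × x ∉ F

degree : ∀ {n} → Family n → Subset n → ℕ
degree 𝓕 S = length (filter (S ⊆?_) 𝓕)

-- δ_t(𝓕) ≤ B, i.e. the minimum degree over t-subsets of [n] is at most B,
-- i.e. some t-element subset has degree at most B.
MinDegreeAtMost : ∀ {n} → ℕ → Family n → ℕ → Set
MinDegreeAtMost {n} t 𝓕 B = ∃ λ (T : Subset n) → ∣ T ∣ ≡ t × degree 𝓕 T ≤ B

{-# OPTIONS --safe #-}

-- Let γ(x) be the number of members of 𝓕 that do not contain x.
--
-- If γ(x) ≥ C(n−4, k−3) for all x, then |𝓕| + C(n−3, k−1) ≤ C(n−1, k−1) + C(n−3, k−2) (Frankl), and averaging the degree over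
-- all t-sets is enough. To prove Frankl's bound, shift towards a fixed element x. As soon as γ(x) is in the window
-- [C(n−4, k−3), C(n−3, k−2)], the Kruskal–Katona bound, which is linear there, gives the claim. If γ(x) always stays above the
-- window, the final sets avoiding x are 2-intersecting and Katona's shadow theorem applies. If γ(x) jumps over
-- the window, the window argument applies to a pair of links on n − 2 points.
--
-- Otherwise fix x with 1 ≤ γ(x) < C(n−4, k−3). If γ(x) ≤ C(n−t−k−2, k−t−2), take a t-set T that avoids x and two members
-- A, B not containing x: the members that contain T and x meet both A and B, and the sets meeting A but not B make up
-- for the at most γ(x) members that contain T but not x. (If there is no B different from A, no member avoiding x contains T.)
-- If γ(x) is larger, then by Kruskal–Katona so many k-sets through x are missing from 𝓕 that averaging the degree over
-- the t-sets avoiding x is enough.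

module Submission where

open import Defs
open import Data.Bool as Bool using (Bool; true; false; _∧_; _∨_; not) renaming (T to True)
open import Data.Bool.Properties using (T-≡)
open import Data.Empty using (⊥; ⊥-elim)
open import Data.Fin using (Fin; zero; suc; punchIn; punchOut)
open import Data.Fin.Properties using (punchIn-punchOut) renaming (_≟_ to _≟ᶠ_)
open import Data.Fin.Subset using (_∩_; _∪_; ∁; ∣_∣; Nonempty; _⊆_)
open import Data.Fin.Subset.Properties using (_⊆?_; drop-∷-⊆; ∣p∣≤n; ∣p∣≤∣p∪q∣)
open import Data.List using (List; []; _∷_; length; filter)
open import Data.List.Membership.Propositional using () renaming (_∈_ to _∈ₗ_)
open import Data.List.Membership.Propositional.Properties using (∈-filter⁻)
import Data.List.Membership.DecPropositional as DecMembership
open import Data.List.Relation.Unary.All as All using ()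
open import Data.List.Relation.Unary.AllPairs using (_∷_)
open import Data.List.Relation.Unary.Any using (here; there)
open import Data.List.Relation.Unary.Unique.Propositional using (Unique)
import Data.List.Relation.Unary.Unique.Propositional.Properties as Unique
open import Data.Nat using (ℕ; zero; suc; _+_; _*_; _∸_; _≤_; _<_; _≡ᵇ_; _≤ᵇ_; z≤n; s≤s; >-nonZero; _≤?_)
open import Data.Nat.Combinatorics using (_C_; nCk+nC[k+1]≡[n+1]C[k+1])
open import Data.Nat.Properties
open import Data.Nat.Tactic.RingSolver using (solve-∀)
open import Data.Product using (∃; ∃₂; _×_; _,_; proj₁; proj₂)
open import Data.Sum using (_⊎_; inj₁; inj₂)
open import Data.Vec as Vec using (Vec; []; _∷_; lookup; insertAt; removeAt)
open import Data.Vec.Properties using (insertAt-lookup; insertAt-punchIn; removeAt-insertAt; insertAt-removeAt; map-insertAt; lookup⇒[]=; ≡-dec)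
open import Function using (_∘_; Equivalence)
open import Relation.Binary.PropositionalEquality using (_≡_; refl; sym; trans; cong; cong₂; subst; subst₂; module ≡-Reasoning)
open import Relation.Nullary.Decidable using (dec-true; dec-false)
open import Relation.Nullary using (¬_; Dec; yes; no; does; contradiction)

-- The bound is the degree, in a Hilton-Milner family (one k-set A, and all k-sets through x that
-- meet A), of a t-set disjoint from A and x. Frankl's bound is the size of the family of k-sets
-- with at least two elements in a fixed triple. The ends of the window are diversities in two
-- families of this size: C(n-3, k-2) occurs at the elements of that triple, and C(n-4, k-3) occurs
-- at x in the family of k-sets that contain x and meet a fixed 3-set S, or avoid x and contain S.
-- Between the ends, the Kruskal-Katona estimate removes one set through x for each additional set
-- avoiding x, so the bound stays constant. The obstacle is that shifting can make the family
-- trivial or push a diversity far below the window; hence diversities are watched at every single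
-- shift. Shadows are taken of complements: an intersection condition becomes a bound on unions, and
-- ordinary lower shadows do the counting. Binomials of real arguments are replaced by linear
-- interpolation with a fraction p / q, which keeps all estimates in ℕ.

-- Counting, shadows and the shift as Boolean computations

binom : ℕ → ℕ → ℕ
binom n       zero    = 1
binom zero    (suc k) = 0
binom (suc n) (suc k) = binom n k + binom n (suc k)

sumV : ∀ {n} → (Vec Bool n → ℕ) → ℕ
sumV {zero}  g = g []
sumV {suc n} g = sumV (λ s → g (true ∷ s)) + sumV (λ s → g (false ∷ s))

-- Subsets of [n] are characteristic vectors. Families are Boolean predicates on them, so that counting,
-- shadows and links can be computed by recursion on the ground set.
Fam : ℕ → Set
Fam n = Vec Bool n → Bool

𝟙 : Bool → ℕ
𝟙 true  = 1
𝟙 false = 0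

cnt : ∀ {n} → Fam n → ℕ
cnt f = sumV (λ s → 𝟙 (f s))

infix 4 _∋_

_∋_ : ∀ {n} → Fam n → Vec Bool n → Set
f ∋ s = f s ≡ true

Uniform : ∀ {n} → ℕ → Fam n → Set
Uniform a f = ∀ s → f ∋ s → ∣ s ∣ ≡ a

-- The complement form of an intersection condition: sets on n points pairwise share at least j
-- elements exactly when the unions of their complements have at most n - j points.
UnionsWithin : ∀ {n} → ℕ → Fam n → Set
UnionsWithin z f = ∀ s t → f ∋ s → f ∋ t → ∣ s ∪ t ∣ ≤ z

∨-elim : ∀ {A : Set} {a b} → (a ≡ true → A) → (b ≡ true → A) → a ∨ b ≡ true → A
∨-elim {a = true}  l r e = l refl
∨-elim {a = false} l r e = r e

∨-introˡ : ∀ {a b} → a ≡ true → a ∨ b ≡ true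
∨-introˡ refl = refl

∨-introʳ : ∀ {a b} → b ≡ true → a ∨ b ≡ true
∨-introʳ {true}  refl = refl
∨-introʳ {false} refl = refl

∧-intro : ∀ {a b} → a ≡ true → b ≡ true → a ∧ b ≡ true
∧-intro refl refl = refl

∧-projˡ : ∀ {a b} → a ∧ b ≡ true → a ≡ true
∧-projˡ {true} e = refl

∧-projʳ : ∀ {a b} → a ∧ b ≡ true → b ≡ true
∧-projʳ {true} e = e

sumV-mono : ∀ {n} {g h : Vec Bool n → ℕ} → (∀ s → g s ≤ h s) → sumV g ≤ sumV h
sumV-mono {zero}  p = p []
sumV-mono {suc n} p = +-mono-≤ (sumV-mono (λ s → p (true ∷ s))) (sumV-mono (λ s → p (false ∷ s)))

sumV-cong : ∀ {n} {g h : Vec Bool n → ℕ} → (∀ s → g s ≡ h s) → sumV g ≡ sumV h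
sumV-cong {zero}  p = p []
sumV-cong {suc n} p = cong₂ _+_ (sumV-cong (λ s → p (true ∷ s))) (sumV-cong (λ s → p (false ∷ s)))

+-interchange : ∀ a b c d → (a + b) + (c + d) ≡ (a + c) + (b + d)
+-interchange = solve-∀

sumV-+ : ∀ {n} (g h : Vec Bool n → ℕ) → sumV (λ s → g s + h s) ≡ sumV g + sumV h
sumV-+ {zero}  g h = refl
sumV-+ {suc n} g h = trans (cong₂ _+_ (sumV-+ (λ s → g (true ∷ s)) (λ s → h (true ∷ s))) (sumV-+ (λ s → g (false ∷ s)) (λ s → h (false ∷ s))))
  (+-interchange (sumV (λ s → g (true ∷ s))) _ _ _)

sumV-zero : ∀ n → sumV {n} (λ _ → 0) ≡ 0
sumV-zero zero    = refl
sumV-zero (suc n) = cong₂ _+_ (sumV-zero n) (sumV-zero n)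

sumV-*ˡ : ∀ {n} c (g : Vec Bool n → ℕ) → sumV (λ s → c * g s) ≡ c * sumV g
sumV-*ˡ {zero}  c g = refl
sumV-*ˡ {suc n} c g = trans (cong₂ _+_ (sumV-*ˡ c (λ s → g (true ∷ s))) (sumV-*ˡ c (λ s → g (false ∷ s)))) (sym (*-distribˡ-+ c (sumV (λ s → g (true ∷ s))) _))

sumV-swap : ∀ {m n} (g : Vec Bool m → Vec Bool n → ℕ) → sumV (λ s → sumV (g s)) ≡ sumV (λ t → sumV (λ s → g s t))
sumV-swap {zero}  g = refl
sumV-swap {suc m} g = trans (cong₂ _+_ (sumV-swap (λ s → g (true ∷ s))) (sumV-swap (λ s → g (false ∷ s)))) (sym (sumV-+ (λ t → sumV (λ s → g (true ∷ s) t)) (λ t → sumV (λ s → g (false ∷ s) t))))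

sumV-insertAt : ∀ {n} (j : Fin (suc n)) (g : Vec Bool (suc n) → ℕ) →
  sumV g ≡ sumV (λ s → g (insertAt s j true)) + sumV (λ s → g (insertAt s j false))
sumV-insertAt zero g = refl
sumV-insertAt {suc n} (suc j) g = trans (cong₂ _+_ (sumV-insertAt j (λ s → g (true ∷ s))) (sumV-insertAt j (λ s → g (false ∷ s))))
  (+-interchange (sumV (λ s → g (true ∷ insertAt s j true))) _ _ _)

𝟙-mono : ∀ {a b} → (a ≡ true → b ≡ true) → 𝟙 a ≤ 𝟙 b
𝟙-mono {true}  p rewrite p refl = ≤-refl
𝟙-mono {false} p = z≤n

cnt-mono : ∀ {n} {f g : Fam n} → (∀ s → f ∋ s → g ∋ s) → cnt f ≤ cnt g
cnt-mono p = sumV-mono (λ s → 𝟙-mono (p s))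

sumV-pos : ∀ {n} (g : Vec Bool n → ℕ) s → g s ≤ sumV g
sumV-pos g []          = ≤-refl
sumV-pos g (true ∷ s)  = ≤-trans (sumV-pos (λ s → g (true ∷ s)) s) (m≤m+n _ _)
sumV-pos g (false ∷ s) = ≤-trans (sumV-pos (λ s → g (false ∷ s)) s) (m≤n+m _ _)

cnt-pos : ∀ {n} (f : Fam n) s → f ∋ s → 1 ≤ cnt f
cnt-pos f s e = subst (_≤ cnt f) (cong 𝟙 e) (sumV-pos (λ s → 𝟙 (f s)) s)

cnt-∃ : ∀ {n} (f : Fam n) → 1 ≤ cnt f → ∃ λ s → f ∋ s
cnt-∃ {zero} f p with f [] in e
... | true = [] , e
cnt-∃ {zero} f () | false
cnt-∃ {suc n} f p with cnt (λ s → f (true ∷ s)) in e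
... | suc c with cnt-∃ (λ s → f (true ∷ s)) (subst (1 ≤_) (sym e) (s≤s z≤n))
...   | s , i = true ∷ s , i
cnt-∃ {suc n} f p | zero with cnt-∃ (λ s → f (false ∷ s)) p
...   | s , i = false ∷ s , i

sumV-mono-< : ∀ {n} {g h : Vec Bool n → ℕ} → (∀ s → g s ≤ h s) → ∀ s → g s < h s → sumV g < sumV h
sumV-mono-< p []          q = q
sumV-mono-< p (true ∷ s)  q = +-mono-<-≤ (sumV-mono-< (λ s → p (true ∷ s)) s q) (sumV-mono (λ s → p (false ∷ s)))
sumV-mono-< p (false ∷ s) q = +-mono-≤-< (sumV-mono (λ s → p (true ∷ s))) (sumV-mono-< (λ s → p (false ∷ s)) s q)

search : ∀ {n} (f : Fam n) → (∃ λ s → f ∋ s) ⊎ (∀ s → ¬ f ∋ s)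
search f with 1 ≤? cnt f
... | yes p = inj₁ (cnt-∃ f p)
... | no ¬p = inj₂ (λ s i → ¬p (cnt-pos f s i))

-- The lower shadow: s belongs to sh f if adding some element to s gives a member of f.
sh : ∀ {n} → Fam n → Fam n
sh {zero}  f []          = false
sh {suc n} f (true ∷ s)  = sh (λ s → f (true ∷ s)) s
sh {suc n} f (false ∷ s) = f (true ∷ s) ∨ sh (λ s → f (false ∷ s)) s

shs : ∀ {n} → ℕ → Fam n → Fam n
shs zero    f = f
shs (suc d) f = shs d (sh f)

sh-mono : ∀ {n} {f g : Fam n} → (∀ s → f ∋ s → g ∋ s) → ∀ s → sh f ∋ s → sh g ∋ s
sh-mono p (true ∷ s)  i = sh-mono (λ s → p (true ∷ s)) s i
sh-mono p (false ∷ s) i = ∨-elim (λ e → ∨-introˡ (p (true ∷ s) e)) (λ e → ∨-introʳ (sh-mono (λ s → p (false ∷ s)) s e)) i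

shs-mono : ∀ {n} d {f g : Fam n} → (∀ s → f ∋ s → g ∋ s) → ∀ s → shs d f ∋ s → shs d g ∋ s
shs-mono zero    p = p
shs-mono (suc d) p = shs-mono d (sh-mono p)

∨-shuffle : ∀ a b c d e → (e ≡ true → c ∨ d ≡ true) → (a ∨ b) ∨ e ≡ true → (a ∨ c) ∨ (b ∨ d) ≡ true
∨-shuffle true  b     c     d e h i = refl
∨-shuffle false true  true  d e h i = refl
∨-shuffle false true  false d e h i = refl
∨-shuffle false false c     d e h i = h i

sh-∨ : ∀ {n} (f g : Fam n) s → sh (λ s → f s ∨ g s) ∋ s → sh f s ∨ sh g s ≡ true
sh-∨ f g (true ∷ s)  i = sh-∨ (λ s → f (true ∷ s)) (λ s → g (true ∷ s)) s i
sh-∨ f g (false ∷ s) i = ∨-shuffle (f (true ∷ s)) (g (true ∷ s)) _ _ _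
  (sh-∨ (λ s → f (false ∷ s)) (λ s → g (false ∷ s)) s) i

-- `sh` recurses on coordinate 0. This equation and `sh-insertAt-false` give the same recursion at
-- any coordinate, so that a shadow can be read off at both coordinates of a shift.
sh-insertAt-true : ∀ {n} (j : Fin (suc n)) (f : Fam (suc n)) s → sh f (insertAt s j true) ≡ sh (λ s → f (insertAt s j true)) s
sh-insertAt-true zero f s = refl
sh-insertAt-true (suc j) f (true ∷ s)  = sh-insertAt-true j (λ s → f (true ∷ s)) s
sh-insertAt-true (suc j) f (false ∷ s) = cong (f (true ∷ insertAt s j true) ∨_) (sh-insertAt-true j (λ s → f (false ∷ s)) s)

∨-swap : ∀ a b c → a ∨ (b ∨ c) ≡ b ∨ (a ∨ c)
∨-swap true  true  c = refl
∨-swap true  false c = refl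
∨-swap false b     c = refl

sh-insertAt-false : ∀ {n} (j : Fin (suc n)) (f : Fam (suc n)) s →
  sh f (insertAt s j false) ≡ f (insertAt s j true) ∨ sh (λ s → f (insertAt s j false)) s
sh-insertAt-false zero f s = refl
sh-insertAt-false (suc j) f (true ∷ s)  = sh-insertAt-false j (λ s → f (true ∷ s)) s
sh-insertAt-false (suc j) f (false ∷ s) =
  trans (cong (f (true ∷ insertAt s j false) ∨_) (sh-insertAt-false j (λ s → f (false ∷ s)) s))
        (∨-swap (f (true ∷ insertAt s j false)) (f (false ∷ insertAt s j true)) _)

-- A shift touches only the coordinates 0 and 1 + j. In this notation its exchange of the two is the
-- exchange of x and y.
at : ∀ {n} → Fin (suc n) → Bool → Bool → Vec Bool n → Vec Bool (suc (suc n))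
at j x y s = x ∷ insertAt s j y

at-∃ : ∀ {n} (j : Fin (suc n)) v → ∃ λ x → ∃ λ y → ∃ λ s → v ≡ at {n} j x y s
at-∃ j (x ∷ v) = x , lookup v j , removeAt v j , cong (x ∷_) (sym (insertAt-removeAt v j))

cnt-at : ∀ {n} (j : Fin (suc n)) (f : Fam (suc (suc n))) → cnt f ≡
  (cnt (f ∘ at j true true) + cnt (f ∘ at j true false)) + (cnt (f ∘ at j false true) + cnt (f ∘ at j false false))
cnt-at j f = cong₂ _+_ (sumV-insertAt j (λ s → 𝟙 (f (true ∷ s)))) (sumV-insertAt j (λ s → 𝟙 (f (false ∷ s))))

-- Here p and q tell whether a set with indicators x, y and its swap are members. After the shift
-- the favoured set of a swapped pair is present if either was, the other one if both were. This
-- makes the shift a pointwise formula instead of a procedure that moves sets.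
mix : Bool → Bool → Bool → Bool → Bool → Bool
mix c     true  true  p q = p
mix c     false false p q = p
mix true  true  false p q = p ∨ q
mix true  false true  p q = p ∧ q
mix false true  false p q = p ∧ q
mix false false true  p q = p ∨ q

-- The shift between coordinate 0 and coordinate 1 + j, towards sets whose indicator at 0 is c:
-- c = true puts element 0 in, c = false takes it out.
shift : ∀ {n} → Bool → Fin (suc n) → Fam (suc (suc n)) → Fam (suc (suc n))
shift c j f (x ∷ v) = mix c x (lookup v j) (f (x ∷ v)) (f (at j (lookup v j) x (removeAt v j)))

shift-at : ∀ {n} c (j : Fin (suc n)) f x y s → shift c j f (at j x y s) ≡ mix c x y (f (at j x y s)) (f (at j y x s))
shift-at c j f x y s rewrite insertAt-lookup s j y | removeAt-insertAt s j y = refl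

𝟙-∨∧ : ∀ p q → 𝟙 (p ∨ q) + 𝟙 (q ∧ p) ≡ 𝟙 p + 𝟙 q
𝟙-∨∧ true  true  = refl
𝟙-∨∧ true  false = refl
𝟙-∨∧ false true  = refl
𝟙-∨∧ false false = refl

𝟙-∧∨ : ∀ p q → 𝟙 (p ∧ q) + 𝟙 (q ∨ p) ≡ 𝟙 p + 𝟙 q
𝟙-∧∨ true  true  = refl
𝟙-∧∨ true  false = refl
𝟙-∧∨ false true  = refl
𝟙-∧∨ false false = refl

cnt-cong : ∀ {n} {f g : Fam n} → (∀ s → f s ≡ g s) → cnt f ≡ cnt g
cnt-cong p = sumV-cong (λ s → cong 𝟙 (p s))

-- Sets with equal indicators at the two coordinates are untouched, and on a swapped pair p ∨ q and
-- p ∧ q have the same total as p and q.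
cnt-shift : ∀ {n} c (j : Fin (suc n)) f → cnt (shift c j f) ≡ cnt f
cnt-shift c j f = trans (cnt-at j (shift c j f)) (trans (cong₂ _+_
   (cong₂ _+_ (cnt-cong (shift-at c j f true true)) (cnt-cong (shift-at c j f true false)))
   (cong₂ _+_ (cnt-cong (shift-at c j f false true)) (cnt-cong (shift-at c j f false false))))
   (trans (reorder (cnt (f ∘ at j true true)) _ _ _)
     (trans (cong (λ m → cnt (f ∘ at j true true) + m + cnt (f ∘ at j false false)) (middle c))
       (trans (sym (reorder (cnt (f ∘ at j true true)) _ _ _)) (sym (cnt-at j f))))))
  where
  reorder : ∀ a b c d → (a + b) + (c + d) ≡ a + (b + c) + d
  reorder = solve-∀
  pq : Vec Bool _ → Bool
  pq = f ∘ at j true false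
  qp : Vec Bool _ → Bool
  qp = f ∘ at j false true
  middle : ∀ c → cnt (λ s → mix c true false (pq s) (qp s)) + cnt (λ s → mix c false true (qp s) (pq s))
                 ≡ cnt pq + cnt qp
  middle true  = trans (sym (sumV-+ (λ s → 𝟙 (pq s ∨ qp s)) _)) (trans (sumV-cong (λ s → 𝟙-∨∧ (pq s) (qp s))) (sumV-+ (λ s → 𝟙 (pq s)) _))
  middle false = trans (sym (sumV-+ (λ s → 𝟙 (pq s ∧ qp s)) _)) (trans (sumV-cong (λ s → 𝟙-∧∨ (pq s) (qp s))) (sumV-+ (λ s → 𝟙 (pq s)) _))


-- Shifting

∣∷∣ : ∀ {n} x (s : Vec Bool n) → ∣ x ∷ s ∣ ≡ 𝟙 x + ∣ s ∣
∣∷∣ true  s = refl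
∣∷∣ false s = refl

x+[y+z]≡y+[x+z] : ∀ x y z → x + (y + z) ≡ y + (x + z)
x+[y+z]≡y+[x+z] = solve-∀

∣insertAt∣ : ∀ {n} (s : Vec Bool n) j y → ∣ insertAt s j y ∣ ≡ 𝟙 y + ∣ s ∣
∣insertAt∣ s       zero    y = ∣∷∣ y s
∣insertAt∣ (x ∷ s) (suc j) y = trans (∣∷∣ x (insertAt s j y)) (trans (cong (𝟙 x +_) (∣insertAt∣ s j y))
  (trans (x+[y+z]≡y+[x+z] (𝟙 x) (𝟙 y) ∣ s ∣) (cong (𝟙 y +_) (sym (∣∷∣ x s)))))

∣at∣ : ∀ {n} (j : Fin (suc n)) x y s → ∣ at j x y s ∣ ≡ 𝟙 x + (𝟙 y + ∣ s ∣)
∣at∣ j x y s = trans (∣∷∣ x (insertAt s j y)) (cong (𝟙 x +_) (∣insertAt∣ s j y))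

∪-insertAt : ∀ {n} (s t : Vec Bool n) j x y → insertAt s j x ∪ insertAt t j y ≡ insertAt (s ∪ t) j (x ∨ y)
∪-insertAt s       t       zero    x y = refl
∪-insertAt (b ∷ s) (c ∷ t) (suc j) x y = cong ((b ∨ c) ∷_) (∪-insertAt s t j x y)

∣at∪at∣ : ∀ {n} (j : Fin (suc n)) x y s x′ y′ s′ → ∣ at j x y s ∪ at j x′ y′ s′ ∣ ≡ 𝟙 (x ∨ x′) + (𝟙 (y ∨ y′) + ∣ s ∪ s′ ∣)
∣at∪at∣ j x y s x′ y′ s′ = trans (cong (λ t → ∣ (x ∨ x′) ∷ t ∣) (∪-insertAt s s′ j y y′)) (∣at∣ j (x ∨ x′) (y ∨ y′) (s ∪ s′))

-- The middle case carries the freedom used for unions: an unfavoured set survives only together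
-- with its swap, so either of the two can be paired with another member.
mix-view : ∀ c x y p q → mix c x y p q ≡ true →
  (x ≡ y × p ≡ true) ⊎ (p ≡ true × q ≡ true) ⊎ (x ≡ c × y ≡ not c × (p ≡ true ⊎ q ≡ true))
mix-view c     true  true  p q e = inj₁ (refl , e)
mix-view c     false false p q e = inj₁ (refl , e)
mix-view true  true  false p q e = inj₂ (inj₂ (refl , refl , ∨-elim inj₁ inj₂ e))
mix-view true  false true  p q e = inj₂ (inj₁ (∧-projˡ e , ∧-projʳ {p} e))
mix-view false true  false p q e = inj₂ (inj₁ (∧-projˡ e , ∧-projʳ {p} e))
mix-view false false true  p q e = inj₂ (inj₂ (refl , refl , ∨-elim inj₁ inj₂ e))

mix-either : ∀ c x y p q → mix c x y p q ≡ true → p ≡ true ⊎ q ≡ true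
mix-either c x y p q e with mix-view c x y p q e
... | inj₁ (_ , i)             = inj₁ i
... | inj₂ (inj₁ (i , _))      = inj₁ i
... | inj₂ (inj₂ (_ , _ , i)) = i

shift-Uniform : ∀ {n} a c (j : Fin (suc n)) f → Uniform a f → Uniform a (shift c j f)
shift-Uniform a c j f u v i with at-∃ j v
... | x , y , s , refl with mix-either c x y _ _ (trans (sym (shift-at c j f x y s)) i)
...   | inj₁ m = u _ m
...   | inj₂ m = trans (∣at∣ j x y s) (trans (x+[y+z]≡y+[x+z] (𝟙 x) (𝟙 y) ∣ s ∣) (trans (sym (∣at∣ j y x s)) (u _ m)))

shift-UnionsWithin : ∀ {n} z c (j : Fin (suc n)) f → UnionsWithin z f → UnionsWithin z (shift c j f)
shift-UnionsWithin z c j f u v w i i′ with at-∃ j v | at-∃ j w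
... | x , y , s , refl | x′ , y′ , s′ , refl = subst (_≤ z) (sym (∣at∪at∣ j x y s x′ y′ s′))
    (bound (mix-view c x y _ _ (trans (sym (shift-at c j f x y s)) i)) (mix-view c x′ y′ _ _ (trans (sym (shift-at c j f x′ y′ s′)) i′)))
  where
  direct : ∀ {x y x′ y′} → f ∋ at j x y s → f ∋ at j x′ y′ s′ → 𝟙 (x ∨ x′) + (𝟙 (y ∨ y′) + ∣ s ∪ s′ ∣) ≤ z
  direct {x} {y} {x′} {y′} m m′ = subst (_≤ z) (∣at∪at∣ j x y s x′ y′ s′) (u _ _ m m′)
  swapped : ∀ {x y x′ y′} → f ∋ at j y x s → f ∋ at j y′ x′ s′ → 𝟙 (x ∨ x′) + (𝟙 (y ∨ y′) + ∣ s ∪ s′ ∣) ≤ z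
  swapped {x} {y} {x′} {y′} m m′ = subst (_≤ z) (x+[y+z]≡y+[x+z] (𝟙 (y ∨ y′)) (𝟙 (x ∨ x′)) ∣ s ∪ s′ ∣) (direct m m′)
  -- Both sets are now favoured, but only one of them was moved. Their preimages cover both
  -- coordinates while the shifted sets cover one, so the union has even shrunk by one.
  crossed : ∀ c → f ∋ at j c (not c) s × f ∋ at j (not c) c s′ ⊎ f ∋ at j (not c) c s × f ∋ at j c (not c) s′ →
    𝟙 (c ∨ c) + (𝟙 (not c ∨ not c) + ∣ s ∪ s′ ∣) ≤ z
  crossed true  (inj₁ (m , m′)) = <⇒≤ (direct m m′)
  crossed true  (inj₂ (m , m′)) = <⇒≤ (direct m m′)
  crossed false (inj₁ (m , m′)) = <⇒≤ (direct m m′)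
  crossed false (inj₂ (m , m′)) = <⇒≤ (direct m m′)
  View : Bool → Bool → Vec Bool _ → Set
  View x y s = (x ≡ y × f ∋ at j x y s) ⊎ (f ∋ at j x y s × f ∋ at j y x s)
               ⊎ (x ≡ c × y ≡ not c × (f ∋ at j x y s ⊎ f ∋ at j y x s))
  bound : ∀ {x y x′ y′} → View x y s → View x′ y′ s′ → 𝟙 (x ∨ x′) + (𝟙 (y ∨ y′) + ∣ s ∪ s′ ∣) ≤ z
  bound (inj₁ (refl , m)) (inj₁ (refl , m′))                  = direct m m′
  bound (inj₁ (refl , m)) (inj₂ (inj₁ (m′ , _)))             = direct m m′
  bound (inj₁ (refl , m)) (inj₂ (inj₂ (_ , _ , inj₁ m′)))   = direct m m′
  bound (inj₁ (refl , m)) (inj₂ (inj₂ (_ , _ , inj₂ m′)))   = swapped m m′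
  bound (inj₂ (inj₁ (m , m₂))) (inj₁ (refl , m′))             = direct m m′
  bound (inj₂ (inj₁ (m , m₂))) (inj₂ (inj₁ (m′ , _)))        = direct m m′
  bound (inj₂ (inj₁ (m , m₂))) (inj₂ (inj₂ (_ , _ , inj₁ m′))) = direct m m′
  bound (inj₂ (inj₁ (m , m₂))) (inj₂ (inj₂ (_ , _ , inj₂ m′))) = swapped m₂ m′
  bound (inj₂ (inj₂ (refl , refl , inj₁ m))) (inj₁ (refl , m′))   = direct m m′
  bound (inj₂ (inj₂ (refl , refl , inj₂ m))) (inj₁ (refl , m′))   = swapped m m′
  bound (inj₂ (inj₂ (refl , refl , inj₁ m))) (inj₂ (inj₁ (m′ , _))) = direct m m′
  bound (inj₂ (inj₂ (refl , refl , inj₂ m))) (inj₂ (inj₁ (_ , m′))) = swapped m m′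
  bound (inj₂ (inj₂ (refl , refl , inj₁ m))) (inj₂ (inj₂ (refl , refl , inj₁ m′))) = direct m m′
  bound (inj₂ (inj₂ (refl , refl , inj₁ m))) (inj₂ (inj₂ (refl , refl , inj₂ m′))) = crossed c (inj₁ (m , m′))
  bound (inj₂ (inj₂ (refl , refl , inj₂ m))) (inj₂ (inj₂ (refl , refl , inj₁ m′))) = crossed c (inj₂ (m , m′))
  bound (inj₂ (inj₂ (refl , refl , inj₂ m))) (inj₂ (inj₂ (refl , refl , inj₂ m′))) = swapped m m′

sh-at-both : ∀ {n} (j : Fin (suc n)) (g : Fam (suc (suc n))) s → sh g (at j true true s) ≡ sh (g ∘ at j true true) s
sh-at-both j g s = sh-insertAt-true j (λ v → g (true ∷ v)) s

sh-at-mixed : ∀ {n} (j : Fin (suc n)) (g : Fam (suc (suc n))) x s →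
  sh g (at j x (not x) s) ≡ g (at j true true s) ∨ sh (g ∘ at j x (not x)) s
sh-at-mixed j g true  s = sh-insertAt-false j (λ v → g (true ∷ v)) s
sh-at-mixed j g false s = cong (g (at j true true s) ∨_) (sh-insertAt-true j (λ v → g (false ∷ v)) s)

sh-at-none : ∀ {n} (j : Fin (suc n)) (g : Fam (suc (suc n))) s →
  sh g (at j false false s) ≡ g (at j true false s) ∨ (g (at j false true s) ∨ sh (g ∘ at j false false) s)
sh-at-none j g s = cong (g (at j true false s) ∨_) (sh-insertAt-false j (λ v → g (false ∷ v)) s)

-- Together with `cnt-shift`, this inclusion is what prevents shifting from enlarging a shadow. The
-- cases are the values of v at the two coordinates.
sh-shift : ∀ {n} c (j : Fin (suc n)) f v → sh (shift c j f) ∋ v → shift c j (sh f) ∋ v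
sh-shift c j f v i with at-∃ j v
... | x , y , s , refl = trans (shift-at c j (sh f) x y s) (main c x y i)
  where
  fact : ∀ c x y {s} → shift c j f ∋ at j x y s → mix c x y (f (at j x y s)) (f (at j y x s)) ≡ true
  fact c x y {s} e = trans (sym (shift-at c j f x y s)) e
  split : ∀ c x → sh (shift c j f) ∋ at j x (not x) s → f ∋ at j true true s ⊎ sh (shift c j f ∘ at j x (not x)) ∋ s
  split c x e = ∨-elim (λ e → inj₁ (fact c true true e)) inj₂ (trans (sym (sh-at-mixed j (shift c j f) x s)) e)
  viaTop : ∀ x → f ∋ at j true true s → sh f ∋ at j x (not x) s
  viaTop x e = trans (sh-at-mixed j f x s) (∨-introˡ e)
  viaSh : ∀ x → sh (f ∘ at j x (not x)) ∋ s → sh f ∋ at j x (not x) s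
  viaSh x e = trans (sh-at-mixed j f x s) (∨-introʳ {f (at j true true s)} e)
  main : ∀ c x y → sh (shift c j f) ∋ at j x y s → mix c x y (sh f (at j x y s)) (sh f (at j y x s)) ≡ true
  main c true true e = trans (sh-at-both j f s)
    (sh-mono (λ s → fact c true true) s (trans (sym (sh-at-both j (shift c j f) s)) e))
  main c false false e = trans (sh-at-none j f s)
    (∨-elim (λ e → one (mix-either c true false _ _ (fact c true false e)))
      (∨-elim (λ e → other (mix-either c false true _ _ (fact c false true e)))
        (λ e → ∨-introʳ {f (at j true false s)} (∨-introʳ {f (at j false true s)} (sh-mono (λ s → fact c false false) s e))))
      (trans (sym (sh-at-none j (shift c j f) s)) e))
    where
    G : Set
    G = f (at j true false s) ∨ (f (at j false true s) ∨ sh (f ∘ at j false false) s) ≡ true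
    one : f ∋ at j true false s ⊎ f ∋ at j false true s → G
    one (inj₁ e) = ∨-introˡ e
    one (inj₂ e) = ∨-introʳ {f (at j true false s)} (∨-introˡ e)
    other : f ∋ at j false true s ⊎ f ∋ at j true false s → G
    other (inj₁ e) = one (inj₂ e)
    other (inj₂ e) = one (inj₁ e)
  main true true false e with split true true e
  ... | inj₁ m = ∨-introˡ (viaTop true m)
  ... | inj₂ m = ∨-elim (λ e → ∨-introˡ (viaSh true e)) (λ e → ∨-introʳ {sh f (at j true false s)} (viaSh false e))
                   (sh-∨ (f ∘ at j true false) (f ∘ at j false true) s (sh-mono (λ s → fact true true false) s m))
  main false false true e with split false false e
  ... | inj₁ m = ∨-introˡ (viaTop false m)
  ... | inj₂ m = ∨-elim (λ e → ∨-introˡ (viaSh false e)) (λ e → ∨-introʳ {sh f (at j false true s)} (viaSh true e))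
                   (sh-∨ (f ∘ at j false true) (f ∘ at j true false) s (sh-mono (λ s → fact false false true) s m))
  -- On the unfavoured side, the superset found either contains both coordinates or is present
  -- together with its swap. In both cases v and its swap lie in the shadow of `f`.
  main true false true e with split true false e
  ... | inj₁ m = ∧-intro (viaTop false m) (viaTop true m)
  ... | inj₂ m = ∧-intro (viaSh false (sh-mono (λ s e → ∧-projˡ (fact true false true e)) s m))
                         (viaSh true (sh-mono (λ s e → ∧-projʳ {f (at j false true s)} (fact true false true e)) s m))
  main false true false e with split false true e
  ... | inj₁ m = ∧-intro (viaTop true m) (viaTop false m)
  ... | inj₂ m = ∧-intro (viaSh true (sh-mono (λ s e → ∧-projˡ (fact false true false e)) s m))
                         (viaSh false (sh-mono (λ s e → ∧-projʳ {f (at j true false s)} (fact false true false e)) s m))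

-- The subfamily `g` makes the induction on `d` possible: after one step, the shadow of the shift is
-- only contained in the shift of the shadow.
cnt-shs-shift : ∀ {n} d c (j : Fin (suc n)) f g → (∀ v → g ∋ v → shift c j f ∋ v) → cnt (shs d g) ≤ cnt (shs d f)
cnt-shs-shift zero    c j f g p = ≤-trans (cnt-mono p) (≤-reflexive (cnt-shift c j f))
cnt-shs-shift (suc d) c j f g p = cnt-shs-shift d c j (sh f) (sh g) (λ v i → sh-shift c j f v (sh-mono p v i))

-- Only exchanges with element 0 are demanded, not those between all pairs; this fits inductions
-- that split the family at 0.
Stable : ∀ {n} → Bool → Fam (suc (suc n)) → Set
Stable c f = ∀ j s → f ∋ at j (not c) c s → f ∋ at j c (not c) s

Unstable : ∀ {n} → Bool → Fin (suc n) → Fam (suc (suc n)) → Set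
Unstable c j f = ∃ λ s → f ∋ at j (not c) c s × f (at j c (not c) s) ≡ false

Fin-search : ∀ {n} {A B : Fin n → Set} → (∀ j → A j ⊎ B j) → (∃ λ j → A j) ⊎ (∀ j → B j)
Fin-search {zero} p = inj₂ (λ ())
Fin-search {suc n} {A} {B} p with p zero | Fin-search (λ j → p (suc j))
... | inj₁ a | _            = inj₁ (zero , a)
... | inj₂ b | inj₁ (j , a) = inj₁ (suc j , a)
... | inj₂ b | inj₂ q       = inj₂ (λ { zero → b ; (suc j) → q j })

not-true : ∀ {b} → not b ≡ true → b ≡ false
not-true {false} e = refl

stable? : ∀ {n} c (f : Fam (suc (suc n))) → (∃ λ j → Unstable c j f) ⊎ Stable c f
stable? c f = Fin-search decide
  where
  decide : ∀ j → Unstable c j f ⊎ (∀ s → f ∋ at j (not c) c s → f ∋ at j c (not c) s)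
  decide j with search (λ s → f (at j (not c) c s) ∧ not (f (at j c (not c) s)))
  ... | inj₁ (s , i) = inj₁ (s , ∧-projˡ i , not-true (∧-projʳ {f (at j (not c) c s)} i))
  ... | inj₂ p = inj₂ holds
    where
    holds : ∀ s → f ∋ at j (not c) c s → f ∋ at j c (not c) s
    holds s i with f (at j c (not c) s) in e
    ... | true  = refl
    ... | false = ⊥-elim (p s (∧-intro i (cong not e)))

mix-not : ∀ c y p q → mix c (not c) y p q ≡ true → p ≡ true
mix-not true  true  p q e = ∧-projˡ e
mix-not true  false p q e = e
mix-not false true  p q e = e
mix-not false false p q e = ∧-projˡ e

mix-not-not : ∀ c p q → mix c (not c) c p q ≡ p ∧ q
mix-not-not true  p q = refl
mix-not-not false p q = refl

-- This is the termination measure of the shifting: no set enters the unfavoured side at 0, and the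
-- witness of instability leaves it.
shift-decreases : ∀ {n} c (j : Fin (suc n)) f → Unstable c j f →
  cnt (λ v → shift c j f (not c ∷ v)) < cnt (λ v → f (not c ∷ v))
shift-decreases c j f (s , i , e) = sumV-mono-< (λ v → 𝟙-mono (sub v)) (insertAt s j c)
  (subst₂ _<_ (sym (cong 𝟙 out)) (sym (cong 𝟙 i)) (s≤s z≤n))
  where
  sub : ∀ v → shift c j f (not c ∷ v) ≡ true → f (not c ∷ v) ≡ true
  sub v m with at-∃ j (not c ∷ v)
  ... | x , y , s , refl = mix-not c y _ _ (trans (sym (shift-at c j f (not c) y s)) m)
  out : shift c j f (at j (not c) c s) ≡ false
  out rewrite shift-at c j f (not c) c s | mix-not-not c (f (at j (not c) c s)) (f (at j c (not c) s)) | i | e = refl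

-- R is an alternative outcome at which the shifting may stop early.
stabilize : ∀ {n} {R : Set} c (P : Fam (suc (suc n)) → Set) →
  (∀ f j → P f → Unstable c j f → P (shift c j f) ⊎ R) →
  ∀ f → P f → (∃ λ g → P g × Stable c g) ⊎ R
stabilize {R = R} c P step f p = loop _ f p ≤-refl
  where
  loop : ∀ m f → P f → cnt (λ v → f (not c ∷ v)) ≤ m → (∃ λ g → P g × Stable c g) ⊎ R
  loop m f p le with stable? c f
  ... | inj₂ st = inj₁ (f , p , st)
  loop zero f p le | inj₁ (j , u) = contradiction (≤-trans (shift-decreases c j f u) le) (λ ())
  loop (suc m) f p le | inj₁ (j , u) with step f j p u
  ... | inj₂ r  = inj₂ r
  ... | inj₁ p′ = loop m _ p′ (≤-pred (≤-trans (shift-decreases c j f u) le))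


-- The Kruskal–Katona theorem, linearly interpolated

binom-pos : ∀ n k → k ≤ n → 1 ≤ binom n k
binom-pos n       zero    le       = ≤-refl
binom-pos (suc n) (suc k) (s≤s le) = ≤-trans (binom-pos n k le) (m≤m+n _ _)

binom-zero : ∀ n k → n < k → binom n k ≡ 0
binom-zero zero    (suc k) lt       = refl
binom-zero (suc n) (suc k) (s≤s lt) = cong₂ _+_ (binom-zero n k lt) (binom-zero n (suc k) (m<n⇒m<1+n lt))

binom-self : ∀ n → binom n n ≡ 1
binom-self zero    = refl
binom-self (suc n) = cong₂ _+_ (binom-self n) (binom-zero n (suc n) ≤-refl)

binom-pred : ∀ n → binom (suc n) n ≡ suc n
binom-pred zero    = refl
binom-pred (suc n) = trans (cong₂ _+_ (binom-pred n) (binom-self (suc n))) (+-comm (suc n) 1)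

-- Keeping k C(n, k) on the left avoids the difference n - k, so the identity holds for all k and
-- follows from Pascal's rule alone.
binom-ratio : ∀ n k → suc k * binom n (suc k) + k * binom n k ≡ n * binom n k
binom-ratio zero    zero    = refl
binom-ratio zero    (suc k) = cong₂ _+_ (*-zeroʳ (suc (suc k))) (*-zeroʳ (suc k))
binom-ratio (suc n) zero    = trans (lemma (binom n 1)) (trans (cong suc (binom-ratio n 0)) refl)
  where
  lemma : ∀ b → 1 * (1 + b) + 0 * 1 ≡ suc (1 * b + 0 * 1)
  lemma = solve-∀
binom-ratio (suc n) (suc k) = trans (lemma₁ k (binom n k) (binom n (suc k)) (binom n (suc (suc k))))
  (trans (cong₂ (λ x y → x + y + binom n (suc k) + binom n k) (binom-ratio n (suc k)) (binom-ratio n k)) (lemma₂ n (binom n k) (binom n (suc k))))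
  where
  lemma₁ : ∀ k a b c → suc (suc k) * (b + c) + suc k * (a + b) ≡ (suc (suc k) * c + suc k * b) + (suc k * b + k * a) + b + a
  lemma₁ = solve-∀
  lemma₂ : ∀ n a b → n * b + n * a + b + a ≡ suc n * (a + b)
  lemma₂ = solve-∀

binom-absorb : ∀ n k → suc k * binom (suc n) (suc k) ≡ suc n * binom n k
binom-absorb n k = trans (lemma k (binom n k) (binom n (suc k))) (cong (binom n k +_) (binom-ratio n k))
  where
  lemma : ∀ k a b → suc k * (a + b) ≡ a + (suc k * b + k * a)
  lemma = solve-∀

binom-step : ∀ e k → suc k * binom (e + k) (suc k) ≡ e * binom (e + k) k
binom-step e k = +-cancelʳ-≡ (k * binom (e + k) k) _ _ (trans (binom-ratio (e + k) k) (*-distribʳ-+ (binom (e + k) k) e k))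

-- The ratio C(z, b + 1) / C(z, b) = (z - b) / (b + 1) decreases in b; it is compared at d + a and
-- at a.
binom-logConcave : ∀ z a d → binom z (suc (d + a)) * binom z a ≤ binom z (d + a) * binom z (suc a)
binom-logConcave z a d with d + a ≤? z
... | no ¬p = subst (λ x → x * binom z a ≤ binom z (d + a) * binom z (suc a)) (sym (binom-zero z (suc (d + a)) (m<n⇒m<1+n (≰⇒> ¬p)))) z≤n
... | yes p = *-cancelˡ-≤ (suc (d + a)) (begin
    suc b * (binom z (suc b) * V)   ≡⟨ *-assoc (suc b) (binom z (suc b)) V ⟨
    suc b * binom z (suc b) * V     ≡⟨ cong (_* V) (subst (λ z → suc b * binom z (suc b) ≡ e * binom z b) e+b (binom-step e b)) ⟩
    e * Y * V                       ≤⟨ *-monoˡ-≤ V (*-monoˡ-≤ Y (m≤m+n e d)) ⟩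
    (e + d) * Y * V                 ≡⟨ lemma (e + d) Y V ⟩
    Y * ((e + d) * V)               ≡⟨ cong (Y *_) (subst (λ z → suc a * binom z (suc a) ≡ (e + d) * binom z a) (trans (+-assoc e d a) e+b) (binom-step (e + d) a)) ⟨
    Y * (suc a * U)                 ≤⟨ *-monoʳ-≤ Y (*-monoˡ-≤ U (s≤s (m≤n+m a d))) ⟩
    Y * (suc b * U)                 ≡⟨ lemma (suc b) Y U ⟨
    suc b * Y * U                   ≡⟨ *-assoc (suc b) Y U ⟩
    suc b * (Y * U)                 ∎)
  where
  open ≤-Reasoning
  b : ℕ
  b = d + a
  V U Y e : ℕ
  V = binom z a
  U = binom z (suc a)
  Y = binom z b
  e = z ∸ b
  e+b : e + b ≡ z
  e+b = m∸n+n≡m p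
  lemma : ∀ e Y V → e * Y * V ≡ Y * (e * V)
  lemma = solve-∀

-- Expanding the coefficients of z + 1 by Pascal's rule leaves one product common to both sides; the
-- other two are compared by log-concavity.
binom-ratio-mono : ∀ z d a → binom (suc z) a * binom z (d + a) ≤ binom z a * binom (suc z) (d + a)
binom-ratio-mono z zero    zero    = ≤-refl
binom-ratio-mono z (suc d) zero    = *-monoʳ-≤ 1 (m≤n+m (binom z (suc (d + 0))) (binom z (d + 0)))
binom-ratio-mono z d       (suc a) rewrite +-suc d a = begin
    (binom z a + binom z (suc a)) * binom z (suc (d + a)) ≡⟨ r₁ (binom z a) (binom z (suc a)) (binom z (suc (d + a))) ⟩
    binom z (suc (d + a)) * binom z a + binom z (suc (d + a)) * binom z (suc a)
      ≤⟨ +-monoˡ-≤ _ (binom-logConcave z a d) ⟩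
    binom z (d + a) * binom z (suc a) + binom z (suc (d + a)) * binom z (suc a) ≡⟨ r₂ (binom z (suc a)) (binom z (d + a)) _ ⟩
    binom z (suc a) * (binom z (d + a) + binom z (suc (d + a))) ∎
    where
    open ≤-Reasoning
    r₁ : ∀ v u x → (v + u) * x ≡ x * v + x * u
    r₁ = solve-∀
    r₂ : ∀ u y x → y * u + x * u ≡ u * (y + x)
    r₂ = solve-∀

-- The linear interpolation, at the point p / q between 0 and 1, of the values z and z + 1 of x ↦ C(x, a),
-- multiplied by q.
interp : ℕ → ℕ → ℕ → ℕ → ℕ
interp p q z zero    = q
interp p q z (suc a) = q * binom z (suc a) + p * binom z a

interp-suc : ∀ p q z a → interp p q (suc z) (suc a) ≡ interp p q z (suc a) + interp p q z a
interp-suc p q z zero    = lemma p q (binom z 1)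
  where
  lemma : ∀ p q b → q * (1 + b) + p * 1 ≡ (q * b + p * 1) + q
  lemma = solve-∀
interp-suc p q z (suc a) = lemma p q (binom z a) (binom z (suc a)) (binom z (suc (suc a)))
  where
  lemma : ∀ p q x y w → q * (y + w) + p * (x + y) ≡ (q * w + p * y) + (q * y + p * x)
  lemma = solve-∀

-- Removing each element of a single member gives distinct sets of the shadow. This settles the
-- boundary cases a = 0 and a = z of Kruskal-Katona.
∣∣≤cnt-sh : ∀ {n} (f : Fam n) s → f ∋ s → ∣ s ∣ ≤ cnt (sh f)
∣∣≤cnt-sh f []          i = z≤n
∣∣≤cnt-sh f (true ∷ s)  i = ≤-trans (≤-reflexive (+-comm 1 ∣ s ∣))
  (+-mono-≤ (∣∣≤cnt-sh (λ s → f (true ∷ s)) s i) (cnt-pos (λ s → sh f (false ∷ s)) s (∨-introˡ i)))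
∣∣≤cnt-sh f (false ∷ s) i = ≤-trans (∣∣≤cnt-sh (λ s → f (false ∷ s)) s i)
  (≤-trans (cnt-mono (λ s → ∨-introʳ {f (true ∷ s)})) (m≤n+m _ _))

sh-∃ : ∀ {n} (f : Fam (suc n)) s → sh f ∋ s → ∃₂ λ j t → s ≡ insertAt t j false × f ∋ insertAt t j true
sh-∃ {zero} f (true ∷ []) ()
sh-∃ f (false ∷ s) i with f (true ∷ s) in e
... | true = zero , s , refl , e
sh-∃ {zero} f (false ∷ []) () | false
sh-∃ {suc n} f (false ∷ s) i | false with sh-∃ (λ s → f (false ∷ s)) s i
... | j , t , refl , m = suc j , false ∷ t , refl , m
sh-∃ {suc n} f (true ∷ s) i with sh-∃ (λ s → f (true ∷ s)) s i
... | j , t , refl , m = suc j , true ∷ t , refl , m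

sh-Uniform : ∀ {n} a (f : Fam n) → Uniform (suc a) f → Uniform a (sh f)
sh-Uniform {suc n} a f u s i with sh-∃ f s i
... | j , t , refl , m = trans (∣insertAt∣ t j false) (suc-injective (trans (sym (∣insertAt∣ t j true)) (u _ m)))
sh-Uniform {zero} a f u [] ()

tail-Uniform : ∀ {n} a (f : Fam (suc n)) → Uniform (suc a) f → Uniform a (λ s → f (true ∷ s))
tail-Uniform a f u s i = suc-injective (u (true ∷ s) i)

Stable-sh : ∀ {n} (f : Fam (suc (suc n))) → Stable true f → ∀ s → sh (λ s → f (false ∷ s)) ∋ s → f ∋ true ∷ s
Stable-sh f st s i with sh-∃ (λ s → f (false ∷ s)) s i
... | j , t , refl , m = st j t m

interp-self : ∀ p q a → p ≤ q → interp p q a a ≤ q * suc a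
interp-self p q zero    le = ≤-reflexive (sym (*-identityʳ q))
interp-self p q (suc a) le rewrite binom-self (suc a) | binom-pred a =
  ≤-trans (+-monoʳ-≤ (q * 1) (*-monoˡ-≤ (suc a) le)) (≤-reflexive (sym (*-distribˡ-+ q 1 (suc a))))

-- For f shifted towards 0, the shadow of f₀ (the members avoiding 0) is contained in f₁ (the link of 0). So if f₁ is
-- too small for the induction to apply to it, then f₀ is so large that its shadow does not fit into f₁.
kruskalKatona : ∀ {n} p q z a (f : Fam n) → p ≤ q → 1 ≤ q → Uniform (suc a) f → ∃ (λ s → f ∋ s) → a ≤ z →
  interp p q z (suc a) ≤ q * cnt f → interp p q z a ≤ q * cnt (sh f)
kruskalKatona p q z zero f pq q≥1 u (s , i) le h =
  ≤-trans (≤-reflexive (sym (*-identityʳ q))) (*-monoʳ-≤ q (≤-trans (≤-reflexive (sym (u s i))) (∣∣≤cnt-sh f s i)))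
kruskalKatona p q z (suc a) f pq q≥1 u (s , i) le h with m≤n⇒m<n∨m≡n le
... | inj₂ refl = ≤-trans (interp-self p q (suc a) pq) (*-monoʳ-≤ q (≤-trans (≤-reflexive (sym (u s i))) (∣∣≤cnt-sh f s i)))
kruskalKatona p q z (suc a) f pq q≥1 u ([] , i) le h | inj₁ lt with u [] i
... | ()
kruskalKatona p q z (suc a) f pq q≥1 u (x ∷ [] , i) le h | inj₁ lt with ≤-trans (≤-reflexive (sym (u (x ∷ []) i))) (∣p∣≤n (x ∷ []))
... | s≤s ()
kruskalKatona {suc (suc n)} p q (suc z) (suc a) f pq q≥1 u (x ∷ y ∷ s , i) le h | inj₁ (s≤s a<z) with
  stabilize {R = ⊥} true (λ g → Uniform (suc (suc a)) g × cnt g ≡ cnt f × cnt (sh g) ≤ cnt (sh f))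
    (λ { g j (gu , gc , gs) _ → inj₁ (shift-Uniform _ true j g gu , trans (cnt-shift true j g) gc ,
           ≤-trans (cnt-shs-shift 1 true j g _ (λ _ m → m)) gs) }) f (u , refl , ≤-refl)
... | inj₁ (g , (gu , gc , gs) , st) = ≤-trans main (*-monoʳ-≤ q gs)
  where
  open ≤-Reasoning
  g₁ g₀ : Fam (suc n)
  g₁ s = g (true ∷ s)
  g₀ s = g (false ∷ s)
  split : interp p q z (suc (suc a)) + interp p q z (suc a) ≤ q * cnt g₁ + q * cnt g₀
  split = begin
    interp p q z (suc (suc a)) + interp p q z (suc a) ≡⟨ interp-suc p q z (suc a) ⟨
    interp p q (suc z) (suc (suc a))                  ≤⟨ h ⟩
    q * cnt f                                         ≡⟨ cong (q *_) gc ⟨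
    q * cnt g                                         ≡⟨ *-distribˡ-+ q (cnt g₁) (cnt g₀) ⟩
    q * cnt g₁ + q * cnt g₀                           ∎
  positive : ∀ {n} (f : Fam n) → 1 ≤ q * cnt f → ∃ λ s → f ∋ s
  positive f le = cnt-∃ f (n≢0⇒n>0 (λ e → contradiction (≤-trans le (≤-reflexive (trans (cong (q *_) e) (*-zeroʳ q)))) λ ()))
  main : interp p q (suc z) (suc a) ≤ q * cnt (sh g)
  main with interp p q z (suc a) ≤? q * cnt g₁
  ... | yes big = begin
    interp p q (suc z) (suc a)            ≡⟨ interp-suc p q z a ⟩
    interp p q z (suc a) + interp p q z a ≤⟨ +-mono-≤ big (kruskalKatona p q z a g₁ pq q≥1 (tail-Uniform _ g gu)
                                               (positive g₁ (≤-trans (*-mono-≤ q≥1 (binom-pos z (suc a) a<z)) (≤-trans (m≤m+n _ _) big)))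
                                               (<⇒≤ a<z) big) ⟩
    -- Removing 0 from the members that contain it puts a copy of `g₁` into the part of the shadow
    -- that avoids 0.
    q * cnt g₁ + q * cnt (sh g₁)          ≤⟨ +-monoˡ-≤ (q * cnt (sh g₁)) (*-monoʳ-≤ q (cnt-mono {f = g₁} (λ s → ∨-introˡ {b = sh g₀ s}))) ⟩
    q * cnt (λ s → g₁ s ∨ sh g₀ s) + q * cnt (sh g₁) ≡⟨ +-comm (q * cnt (λ s → g₁ s ∨ sh g₀ s)) _ ⟩
    q * cnt (sh g₁) + q * cnt (λ s → g₁ s ∨ sh g₀ s) ≡⟨ *-distribˡ-+ q (cnt (sh g₁)) _ ⟨
    q * cnt (sh g)                        ∎
  ... | no ¬big = contradiction (begin
    interp p q z (suc a) ≤⟨ kruskalKatona p q z (suc a) g₀ pq q≥1 (λ s m → gu (false ∷ s) m)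
                              (positive g₀ (≤-trans (s≤s z≤n) rest)) a<z (<⇒≤ rest) ⟩
    q * cnt (sh g₀)      ≤⟨ *-monoʳ-≤ q (cnt-mono (Stable-sh g st)) ⟩
    q * cnt g₁           ∎) ¬big
    where
    rest : interp p q z (suc (suc a)) < q * cnt g₀
    rest = +-cancelˡ-< (interp p q z (suc a)) _ _ (begin-strict
      interp p q z (suc a) + interp p q z (suc (suc a)) ≡⟨ +-comm (interp p q z (suc a)) _ ⟩
      interp p q z (suc (suc a)) + interp p q z (suc a) ≤⟨ split ⟩
      q * cnt g₁ + q * cnt g₀ <⟨ +-monoˡ-< (q * cnt g₀) (≰⇒> ¬big) ⟩
      interp p q z (suc a) + q * cnt g₀ ∎)

kruskalKatona-iterated : ∀ {n} p q z d a (f : Fam n) → p ≤ q → 1 ≤ q → Uniform (d + a) f → ∃ (λ s → f ∋ s) → d + a ≤ suc z →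
  interp p q z (d + a) ≤ q * cnt f → interp p q z a ≤ q * cnt (shs d f)
kruskalKatona-iterated p q z zero    a f pq q≥1 u ne le h = h
kruskalKatona-iterated p q z (suc d) a f pq q≥1 u (s , i) (s≤s le) h =
  kruskalKatona-iterated p q z d a (sh f) pq q≥1 (sh-Uniform (d + a) f u)
    (cnt-∃ (sh f) (≤-trans (≤-trans (s≤s z≤n) (≤-reflexive (sym (u s i)))) (∣∣≤cnt-sh f s i)))
    (m≤n⇒m≤1+n le) (kruskalKatona p q z (d + a) f pq q≥1 u (s , i) le h)

kruskalKatona-binom : ∀ {n} z d a (f : Fam n) → Uniform (d + a) f → d + a ≤ suc z → 1 ≤ cnt f → binom z (d + a) ≤ cnt f → binom z a ≤ cnt (shs d f)
kruskalKatona-binom z d a f u le pos h = begin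
  binom z a           ≡⟨ interp-0-1 a ⟨
  interp 0 1 z a      ≤⟨ kruskalKatona-iterated 0 1 z d a f z≤n ≤-refl u (cnt-∃ f pos) le
                           (≤-trans (≤-reflexive (interp-0-1 (d + a))) (≤-trans h (≤-reflexive (sym (*-identityˡ (cnt f)))))) ⟩
  1 * cnt (shs d f)   ≡⟨ *-identityˡ _ ⟩
  cnt (shs d f)       ∎
  where
  open ≤-Reasoning
  interp-0-1 : ∀ a → interp 0 1 z a ≡ binom z a
  interp-0-1 zero    = refl
  interp-0-1 (suc a) = trans (+-identityʳ _) (*-identityˡ (binom z (suc a)))

-- The piecewise linear lower bound for the shadow lies above the line from the origin to the point
-- (C(z, d + a), C(z, a)), since C(z, a) / C(z, d + a) decreases in z.
kruskalKatona-linear : ∀ {n} z d a (f : Fam n) → Uniform (d + a) f → cnt f ≤ binom z (d + a) →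
  cnt f * binom z a ≤ cnt (shs d f) * binom z (d + a)
kruskalKatona-linear z d a f u h with 1 ≤? cnt f
... | no ¬p = subst (λ m → m * binom z a ≤ cnt (shs d f) * binom z (d + a)) (sym (n<1⇒n≡0 (≰⇒> ¬p))) z≤n
kruskalKatona-linear zero zero    zero    f u h | yes p = ≤-refl
kruskalKatona-linear zero zero    (suc a) f u h | yes p = contradiction (≤-trans p h) λ ()
kruskalKatona-linear zero (suc d) a       f u h | yes p = contradiction (≤-trans p h) λ ()
kruskalKatona-linear (suc z) d a f u h | yes p with cnt f ≤? binom z (d + a)
... | yes small = *-cancelʳ-≤ _ _ (binom z (d + a)) {{>-nonZero (≤-trans p small)}} (begin
    cnt f * binom (suc z) a * X       ≡⟨ *-assoc (cnt f) _ X ⟩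
    cnt f * (binom (suc z) a * X)     ≤⟨ *-monoʳ-≤ (cnt f) (binom-ratio-mono z d a) ⟩
    cnt f * (binom z a * W)           ≡⟨ *-assoc (cnt f) _ W ⟨
    cnt f * binom z a * W             ≤⟨ *-monoˡ-≤ W (kruskalKatona-linear z d a f u small) ⟩
    cnt (shs d f) * X * W             ≡⟨ lemma (cnt (shs d f)) X W ⟩
    cnt (shs d f) * W * X             ∎)
  where
  open ≤-Reasoning
  X W : ℕ
  X = binom z (d + a)
  W = binom (suc z) (d + a)
  lemma : ∀ s x w → s * x * w ≡ s * w * x
  lemma = solve-∀
... | no ¬small with d + a in eb
...   | zero  = contradiction h ¬small
-- The size now lies between C(z, b + 1) and C(z + 1, b + 1), which differ by q = C(z, b); hence it
-- is interpolated exactly by r / q.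
...   | suc b = *-cancelˡ-≤ q {{>-nonZero q≥1}} (final a eb (kruskalKatona-iterated r q z d a f r≤q q≥1
          (subst (λ m → Uniform m f) (sym eb) u) (cnt-∃ f p) (subst (_≤ suc z) (sym eb) b<z)
          (subst (λ m → interp r q z m ≤ q * cnt f) (sym eb) (≤-reflexive window))))
  where
  open ≤-Reasoning
  X q r : ℕ
  X = binom z (suc b)
  q = binom z b
  r = cnt f ∸ X
  X+r : X + r ≡ cnt f
  X+r = m+[n∸m]≡n (<⇒≤ (≰⇒> ¬small))
  r≤q : r ≤ q
  r≤q = +-cancelˡ-≤ X _ _ (≤-trans (≤-reflexive X+r) (≤-trans h (≤-reflexive (+-comm q X))))
  q≥1 : 1 ≤ q
  q≥1 = ≤-trans (+-cancelˡ-≤ X 1 r (≤-trans (≤-reflexive (+-comm X 1)) (≤-trans (≰⇒> ¬small) (≤-reflexive (sym X+r))))) r≤q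
  b<z : suc b ≤ suc z
  b<z with b ≤? z
  ... | yes le = s≤s le
  ... | no ¬le = contradiction (≤-trans q≥1 (≤-reflexive (binom-zero z b (≰⇒> ¬le)))) λ ()
  window : q * X + r * q ≡ q * cnt f
  window = trans (cong (q * X +_) (*-comm r q)) (trans (sym (*-distribˡ-+ q X r)) (cong (q *_) X+r))
  final : ∀ a → d + a ≡ suc b → interp r q z a ≤ q * cnt (shs d f) → q * (cnt f * binom (suc z) a) ≤ q * (cnt (shs d f) * (q + X))
  final zero    e k = begin
    q * (cnt f * 1)               ≡⟨ cong (q *_) (*-identityʳ (cnt f)) ⟩
    q * cnt f                     ≤⟨ *-mono-≤ k h ⟩
    q * cnt (shs d f) * (q + X)   ≡⟨ *-assoc q _ _ ⟩
    q * (cnt (shs d f) * (q + X)) ∎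
  -- With c = q - r, the product (q U + r V) (q + X) exceeds q (X + r) (V + U) by c (q U - X V),
  -- which is nonnegative by log-concavity.
  final (suc a) e k = begin
    q * (cnt f * (V + U))             ≡⟨ cong (λ m → q * (m * (V + U))) X+r ⟨
    q * ((X + r) * (V + U))           ≡⟨ cong (λ q → q * ((X + r) * (V + U))) (sym rc) ⟩
    (r + c) * ((X + r) * (V + U))     ≡⟨ l₁ r c X V U ⟩
    c * (X * V) + M₁                  ≤⟨ +-monoˡ-≤ _ (*-monoʳ-≤ c lc) ⟩
    c * ((r + c) * U) + M₁            ≡⟨ l₂ r c X V U ⟩
    ((r + c) * U + r * V) * ((r + c) + X) ≡⟨ cong (λ q → (q * U + r * V) * (q + X)) rc ⟩
    (q * U + r * V) * (q + X)         ≤⟨ *-monoˡ-≤ (q + X) k ⟩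
    q * cnt (shs d f) * (q + X)       ≡⟨ *-assoc q _ _ ⟩
    q * (cnt (shs d f) * (q + X))     ∎
    where
    V U c M₁ : ℕ
    V = binom z a
    U = binom z (suc a)
    c = q ∸ r
    rc : r + c ≡ q
    rc = m+[n∸m]≡n r≤q
    M₁ = r * (X * V) + (r + c) * (X * U) + (r + c) * r * (V + U)
    lc : X * V ≤ (r + c) * U
    lc = subst (λ m → X * V ≤ m * U) (sym rc)
           (subst (λ m → binom z (suc m) * V ≤ binom z m * U) (suc-injective (trans (sym (+-suc d a)) e)) (binom-logConcave z a d))
    l₁ : ∀ r c X V U → (r + c) * ((X + r) * (V + U)) ≡ c * (X * V) + (r * (X * V) + (r + c) * (X * U) + (r + c) * r * (V + U))
    l₁ = solve-∀
    l₂ : ∀ r c X V U → c * ((r + c) * U) + (r * (X * V) + (r + c) * (X * U) + (r + c) * r * (V + U)) ≡ ((r + c) * U + r * V) * ((r + c) + X)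
    l₂ = solve-∀


-- Katona's shadow theorem

cnt-Uniform : ∀ {n} a (f : Fam n) → Uniform a f → cnt f ≤ binom n a
cnt-Uniform {zero}  a f u with f [] in e
... | false = z≤n
... | true with a | u [] e
...   | .0 | refl = ≤-refl
cnt-Uniform {suc n} zero f u = subst (_≤ 1) (cong (_+ cnt (λ s → f (false ∷ s))) (sym none)) (cnt-Uniform 0 (λ s → f (false ∷ s)) (λ s → u (false ∷ s)))
  where
  none : cnt (λ s → f (true ∷ s)) ≡ 0
  none = n<1⇒n≡0 (≰⇒> λ p → contradiction (u _ (proj₂ (cnt-∃ (λ s → f (true ∷ s)) p))) λ ())
cnt-Uniform {suc n} (suc a) f u = +-mono-≤ (cnt-Uniform a _ (tail-Uniform a f u)) (cnt-Uniform (suc a) _ (λ s → u (false ∷ s)))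

binom-mono : ∀ {m n} k → m ≤ n → binom m k ≤ binom n k
binom-mono zero    le       = ≤-refl
binom-mono (suc k) z≤n      = z≤n
binom-mono (suc k) (s≤s le) = +-mono-≤ (binom-mono k le) (binom-mono (suc k) le)

binom-sucˡ : ∀ e k → suc e * binom (suc (e + k)) k ≡ suc (e + k) * binom (e + k) k
binom-sucˡ e k = trans (sym (binom-step (suc e) k)) (binom-absorb (e + k) k)

binom-two : ∀ M k e → e + k ≡ M → suc (suc M) * suc M * binom M k ≡ suc k * suc e * binom (suc (suc M)) (suc k)
binom-two _ k e refl = begin
  suc (suc n) * suc n * binom n k         ≡⟨ *-assoc (suc (suc n)) (suc n) _ ⟩
  suc (suc n) * (suc n * binom n k)       ≡⟨ cong (suc (suc n) *_) (binom-sucˡ e k) ⟨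
  suc (suc n) * (suc e * binom (suc n) k) ≡⟨ swap (suc (suc n)) (suc e) (binom (suc n) k) ⟩
  suc e * (suc (suc n) * binom (suc n) k) ≡⟨ cong (suc e *_) (binom-absorb (suc n) k) ⟨
  suc e * (suc k * binom (suc (suc n)) (suc k)) ≡⟨ swap₂ (suc e) (suc k) (binom (suc (suc n)) (suc k)) ⟩
  suc k * suc e * binom (suc (suc n)) (suc k) ∎
  where
  open ≡-Reasoning
  n : ℕ
  n = e + k
  swap : ∀ x y z → x * (y * z) ≡ y * (x * z)
  swap = solve-∀
  swap₂ : ∀ x y z → x * (y * z) ≡ y * x * z
  swap₂ = solve-∀

common-gap : ∀ {n} (A B : Vec Bool (suc n)) → ∣ A ∪ B ∣ ≤ n →
  ∃ λ j → ∃₂ λ A′ B′ → A ≡ insertAt A′ j false × B ≡ insertAt B′ j false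
common-gap (false ∷ A) (false ∷ B) le = zero , A , B , refl , refl
common-gap {suc n} (true ∷ A) (y ∷ B) (s≤s le) with common-gap A B le
... | j , A′ , B′ , refl , refl = suc j , true ∷ A′ , y ∷ B′ , refl , refl
common-gap {suc n} (false ∷ A) (true ∷ B) (s≤s le) with common-gap A B le
... | j , A′ , B′ , refl , refl = suc j , false ∷ A′ , true ∷ B′ , refl , refl

shs-true : ∀ {n} d (f : Fam (suc n)) s → shs d f (true ∷ s) ≡ shs d (λ s → f (true ∷ s)) s
shs-true zero    f s = refl
shs-true (suc d) f s = shs-true d (sh f) s

shs-false : ∀ {n} d (f : Fam (suc n)) s → shs d (λ s → f (false ∷ s)) ∋ s → shs d f ∋ false ∷ s
shs-false zero    f s i = i
shs-false (suc d) f s i = shs-false d (sh f) s (shs-mono d (λ s → ∨-introʳ {f (true ∷ s)}) s i)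

cnt-shs-split : ∀ {n} d (f : Fam (suc n)) → cnt (shs d (λ s → f (true ∷ s))) + cnt (shs d (λ s → f (false ∷ s))) ≤ cnt (shs d f)
cnt-shs-split d f = +-mono-≤ (≤-reflexive (cnt-cong (λ s → sym (shs-true d f s)))) (cnt-mono (shs-false d f))

-- Passing from (C(M, l), C(M, d + l)) to (C(M + 2, l + 1), C(M + 2, d + l + 1)), where M = d + l + p,
-- decreases the ratio of the first to the second, because p ≤ l.
katona-numeric : ∀ c S d l p → p ≤ l → c * binom (d + l + p) l ≤ S * binom (d + l + p) (d + l) →
  c * binom (suc (suc (d + l + p))) (suc l) ≤ S * binom (suc (suc (d + l + p))) (suc (d + l))
katona-numeric c S d l p le h = *-cancelʳ-≤ _ _ (suc (d + l) * suc p) (begin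
    c * X * (suc (d + l) * suc p)      ≤⟨ *-monoʳ-≤ (c * X) weights ⟩
    c * X * (suc l * suc (d + p))      ≡⟨ l₁ c X (suc l * suc (d + p)) ⟩
    c * (suc l * suc (d + p) * X)      ≡⟨ cong (c *_) (binom-two M l (d + p) (eq d l p)) ⟨
    c * (suc (suc M) * suc M * binom M l) ≡⟨ l₂ c (suc (suc M) * suc M) (binom M l) ⟩
    suc (suc M) * suc M * (c * binom M l) ≤⟨ *-monoʳ-≤ (suc (suc M) * suc M) h ⟩
    suc (suc M) * suc M * (S * binom M (d + l)) ≡⟨ l₂ S (suc (suc M) * suc M) (binom M (d + l)) ⟨
    S * (suc (suc M) * suc M * binom M (d + l)) ≡⟨ cong (S *_) (binom-two M (d + l) p (+-comm p (d + l))) ⟩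
    S * (suc (d + l) * suc p * Y)      ≡⟨ l₁ S Y (suc (d + l) * suc p) ⟨
    S * Y * (suc (d + l) * suc p)      ∎)
  where
  open ≤-Reasoning
  M X Y : ℕ
  M = d + l + p
  X = binom (suc (suc M)) (suc l)
  Y = binom (suc (suc M)) (suc (d + l))
  eq : ∀ d l p → d + p + l ≡ d + l + p
  eq = solve-∀
  l₁ : ∀ c x w → c * x * w ≡ c * (w * x)
  l₁ = solve-∀
  l₂ : ∀ c w b → c * (w * b) ≡ w * (c * b)
  l₂ = solve-∀
  w₁ : ∀ d l p → suc (d + l) * suc p ≡ suc l * suc p + d * suc p
  w₁ = solve-∀
  w₂ : ∀ d l p → suc l * suc p + d * suc l ≡ suc l * suc (d + p)
  w₂ = solve-∀
  weights : suc (d + l) * suc p ≤ suc l * suc (d + p)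
  weights = subst₂ _≤_ (sym (w₁ d l p)) (w₂ d l p) (+-monoʳ-≤ (suc l * suc p) (*-monoʳ-≤ d (s≤s le)))

-- For sets of size a = d + l, unions of at most a + p points mean pairwise intersections of at
-- least a - p points, and p ≤ l is the usual restriction on the level of the shadow. The ratio is
-- that of the family of all a-sets on a + p points.
Katona : ℕ → Set
Katona n = ∀ p d l (f : Fam n) → Uniform (d + l) f → UnionsWithin (d + l + p) f → p ≤ l →
  cnt f * binom (d + l + p) l ≤ cnt (shs d f) * binom (d + l + p) (d + l)

-- So few points leave room for at most C(d + l + p, d + l) sets, which is the range of the linear
-- Kruskal-Katona bound.
katona-small : ∀ {n} p d l (f : Fam n) → Uniform (d + l) f → n ≤ d + l + p →
  cnt f * binom (d + l + p) l ≤ cnt (shs d f) * binom (d + l + p) (d + l)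
katona-small p d l f u le = kruskalKatona-linear (d + l + p) d l f u (≤-trans (cnt-Uniform _ f u) (binom-mono (d + l) le))

Stable-unions : ∀ {n} N (g : Fam (suc (suc n))) → Stable false g → UnionsWithin N g → N < suc (suc n) →
  ∀ A B → g ∋ true ∷ A → g ∋ true ∷ B → 2 + ∣ A ∪ B ∣ ≤ N
Stable-unions N g st gn lt A B iA iB with common-gap A B (≤-pred (≤-trans (gn _ _ iA iB) (≤-pred lt)))
... | j , A′ , B′ , refl , refl = subst (_≤ N) (trans (∣at∪at∣ j true false A′ false true B′) (cong (2 +_) (sym small)))
      (gn _ _ iA (st j B′ iB))
  where
  small : ∣ insertAt A′ j false ∪ insertAt B′ j false ∣ ≡ ∣ A′ ∪ B′ ∣
  small = trans (cong ∣_∣ (∪-insertAt A′ B′ j false false)) (∣insertAt∣ (A′ ∪ B′) j false)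

-- After shifting away from 0, two members of the link of 0 have a union smaller by two than the bound: exchanging 0 for a
-- common non-element in one of the two sets enlarges the union by one.
katona-step : ∀ n → Katona (suc n) → Katona (suc (suc n))
katona-step n ih p zero    l f u un le = ≤-refl
katona-step n ih p (suc d) l f u un le with suc (suc n) ≤? suc d + l + p
... | yes n≤N = katona-small p (suc d) l f u n≤N
... | no n≰N with
  stabilize {R = ⊥} false (λ g → Uniform (suc d + l) g × UnionsWithin (suc d + l + p) g × cnt g ≡ cnt f × cnt (shs (suc d) g) ≤ cnt (shs (suc d) f))
    (λ { g j (gu , gn , gc , gs) _ → inj₁ (shift-Uniform _ false j g gu , shift-UnionsWithin _ false j g gn , trans (cnt-shift false j g) gc ,
           ≤-trans (cnt-shs-shift (suc d) false j g _ (λ _ m → m)) gs) }) f (u , un , refl , ≤-refl)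
... | inj₁ (g , (gu , gn , gc , gs) , st) = begin
    cnt f * X                                 ≡⟨ cong (_* X) gc ⟨
    (cnt g₁ + cnt g₀) * X                     ≡⟨ *-distribʳ-+ X (cnt g₁) (cnt g₀) ⟩
    cnt g₁ * X + cnt g₀ * X                   ≤⟨ +-mono-≤ (top p l gu gn le (≰⇒> n≰N))
                                                   (ih p (suc d) l g₀ (λ s → gu (false ∷ s)) (λ s t → gn (false ∷ s) (false ∷ t)) le) ⟩
    cnt (shs (suc d) g₁) * Y + cnt (shs (suc d) g₀) * Y ≡⟨ *-distribʳ-+ Y (cnt (shs (suc d) g₁)) _ ⟨
    (cnt (shs (suc d) g₁) + cnt (shs (suc d) g₀)) * Y   ≤⟨ *-monoˡ-≤ Y (≤-trans (cnt-shs-split (suc d) g) gs) ⟩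
    cnt (shs (suc d) f) * Y                   ∎
  where
  open ≤-Reasoning
  g₁ g₀ : Fam (suc n)
  g₁ s = g (true ∷ s)
  g₀ s = g (false ∷ s)
  X Y : ℕ
  X = binom (suc d + l + p) l
  Y = binom (suc d + l + p) (suc d + l)
  top : ∀ p l → Uniform (suc d + l) g → UnionsWithin (suc d + l + p) g → p ≤ l → suc d + l + p < suc (suc n) →
    cnt g₁ * binom (suc d + l + p) l ≤ cnt (shs (suc d) g₁) * binom (suc d + l + p) (suc d + l)
  -- With p = 0 the union bound equals the size of a member, and a member through 0, paired with
  -- itself in `Stable-unions`, would exceed it.
  top zero l gu gn le lt = subst (λ c → c * binom (suc d + l + 0) l ≤ cnt (shs (suc d) g₁) * binom (suc d + l + 0) (suc d + l)) (sym none) z≤n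
    where
    none : cnt g₁ ≡ 0
    none = n<1⇒n≡0 (≰⇒> λ pos → let A , i = cnt-∃ g₁ pos in 1+n≰n (begin
      suc (suc d + l)    ≡⟨ cong suc (gu (true ∷ A) i) ⟨
      2 + ∣ A ∣          ≤⟨ +-monoʳ-≤ 2 (∣p∣≤∣p∪q∣ A A) ⟩
      2 + ∣ A ∪ A ∣      ≤⟨ Stable-unions (suc d + l + 0) g st gn lt A A i i ⟩
      suc d + l + 0      ≡⟨ +-identityʳ (suc d + l) ⟩
      suc d + l          ∎))
  -- In the link of 0 sets lose one element and the union bound drops by two, so l and p both
  -- decrease by one and p ≤ l persists.
  top (suc p) (suc l) gu gn (s≤s le) lt = subst₂ (λ N a → cnt g₁ * binom N (suc l) ≤ cnt (shs (suc d) g₁) * binom N a) (sym eN) (sym ea)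
    (katona-numeric (cnt g₁) (cnt (shs (suc d) g₁)) (suc d) l p le
      (ih p (suc d) l g₁ (tail-Uniform (suc d + l) g (subst (λ a → Uniform a g) ea gu))
        (λ A B iA iB → ≤-pred (≤-pred (≤-trans (Stable-unions _ g st gn lt A B iA iB) (≤-reflexive eN)))) le))
    where
    ea : suc d + suc l ≡ suc (suc d + l)
    ea = +-suc (suc d) l
    eN : suc d + suc l + suc p ≡ suc (suc (suc d + l + p))
    eN = trans (+-suc (suc d + suc l) p) (cong (λ a → suc (a + p)) ea)

katona : ∀ n → Katona n
katona zero          p d       l f u un le = katona-small p d l f u z≤n
katona (suc zero)    p zero    l f u un le = ≤-refl
katona (suc zero)    p (suc d) l f u un le = katona-small p (suc d) l f u (s≤s z≤n)
katona (suc (suc n))                       = katona-step n (katona (suc n))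

sub : ∀ {n} → Vec Bool n → Vec Bool n → Bool
sub []      []      = true
sub (x ∷ s) (y ∷ t) = (not x ∨ y) ∧ sub s t

sub-refl : ∀ {n} (s : Vec Bool n) → sub s s ≡ true
sub-refl []          = refl
sub-refl (true ∷ s)  = sub-refl s
sub-refl (false ∷ s) = sub-refl s

sub-trans : ∀ {n} (s t u : Vec Bool n) → sub s t ≡ true → sub t u ≡ true → sub s u ≡ true
sub-trans []          []          []          p q = refl
sub-trans (true ∷ s)  (true ∷ t)  (true ∷ u)  p q = sub-trans s t u p q
sub-trans (false ∷ s) (true ∷ t)  (true ∷ u)  p q = sub-trans s t u p q
sub-trans (false ∷ s) (false ∷ t) (y ∷ u)     p q = sub-trans s t u p q

sub-∁∪ : ∀ {n} (s t : Vec Bool n) → sub s t ≡ true → ∣ ∁ s ∪ t ∣ ≡ n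
sub-∁∪ []          []         p = refl
sub-∁∪ (true ∷ s)  (true ∷ t) p = cong suc (sub-∁∪ s t p)
sub-∁∪ (false ∷ s) (y ∷ t)    p = cong suc (sub-∁∪ s t p)

sh-sub : ∀ {n} (f : Fam n) s → sh f ∋ s → ∃ λ t → f ∋ t × sub s t ≡ true
sh-sub f (true ∷ s) i with sh-sub (λ s → f (true ∷ s)) s i
... | t , m , b = true ∷ t , m , b
sh-sub f (false ∷ s) i with f (true ∷ s) in e
... | true = true ∷ s , e , sub-refl s
... | false with sh-sub (λ s → f (false ∷ s)) s i
...   | t , m , b = false ∷ t , m , b

shs-sub : ∀ {n} d (f : Fam n) s → shs d f ∋ s → ∃ λ t → f ∋ t × sub s t ≡ true
shs-sub zero    f s i = s , i , sub-refl s
shs-sub (suc d) f s i with shs-sub d (sh f) s i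
... | t , m , b with sh-sub f t m
...   | u , m′ , b′ = u , m′ , sub-trans s t u b b′

shs-Uniform : ∀ {n} d a (f : Fam n) → Uniform (d + a) f → Uniform a (shs d f)
shs-Uniform zero    a f u = u
shs-Uniform (suc d) a f u = shs-Uniform d a (sh f) (sh-Uniform (d + a) f u)

cnt-∁ : ∀ {n} (f : Fam n) → cnt (λ s → f (∁ s)) ≡ cnt f
cnt-∁ {zero}  f = refl
cnt-∁ {suc n} f = trans (cong₂ _+_ (cnt-∁ (λ s → f (false ∷ s))) (cnt-∁ (λ s → f (true ∷ s)))) (+-comm (cnt (λ s → f (false ∷ s))) _)

∣∁∣ : ∀ {n} (s : Vec Bool n) → ∣ ∁ s ∣ + ∣ s ∣ ≡ n
∣∁∣ []          = refl
∣∁∣ (true ∷ s)  = trans (+-suc ∣ ∁ s ∣ ∣ s ∣) (cong suc (∣∁∣ s))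
∣∁∣ (false ∷ s) = cong suc (∣∁∣ s)

cnt-∨ : ∀ {n} (f g : Fam n) → (∀ s → f ∋ s → g ∋ s → ⊥) → cnt f + cnt g ≤ cnt (λ s → f s ∨ g s)
cnt-∨ f g dis = ≤-trans (≤-reflexive (sym (sumV-+ (λ s → 𝟙 (f s)) (λ s → 𝟙 (g s))))) (sumV-mono λ s → pt (f s) (g s) (dis s))
  where
  pt : ∀ a b → (a ≡ true → b ≡ true → ⊥) → 𝟙 a + 𝟙 b ≤ 𝟙 (a ∨ b)
  pt true  true  d = ⊥-elim (d refl refl)
  pt true  false d = ≤-refl
  pt false b     d = ≤-refl

-- The complements of the members of g are not in the shadow of h.
cross-bound : ∀ {m} d l a (g h : Fam m) → a + l ≡ m → Uniform a g → Uniform (d + l) h →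
  (∀ A B → g ∋ A → h ∋ B → ∣ A ∪ B ∣ < m) → cnt g + cnt (shs d h) ≤ binom m l
cross-bound {m} d l a g h e gu hu cross = begin
  cnt g + cnt (shs d h)                 ≡⟨ cong (_+ cnt (shs d h)) (cnt-∁ g) ⟨
  cnt (λ s → g (∁ s)) + cnt (shs d h)   ≤⟨ cnt-∨ _ (shs d h) disjoint ⟩
  cnt (λ s → g (∁ s) ∨ shs d h s)       ≤⟨ cnt-Uniform l _ (λ s → ∨-elim (small s) (shs-Uniform d l h hu s)) ⟩
  binom m l                             ∎
  where
  open ≤-Reasoning
  small : ∀ s → g (∁ s) ≡ true → ∣ s ∣ ≡ l
  small s i = +-cancelˡ-≡ a _ _ (trans (cong (_+ ∣ s ∣) (sym (gu _ i))) (trans (∣∁∣ s) (sym e)))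
  disjoint : ∀ s → g (∁ s) ≡ true → shs d h ∋ s → ⊥
  disjoint s i k with shs-sub d h s k
  ... | t , m , b = <⇒≢ (cross (∁ s) t i m) (sub-∁∪ s t b)


-- Frankl's theorem

binom-sym : ∀ n a b → a + b ≡ n → binom n a ≡ binom n b
binom-sym n zero b e = sym (trans (cong (λ m → binom m b) (sym e)) (binom-self b))
binom-sym n (suc a) zero e = trans (cong (binom n) (trans (sym (+-identityʳ (suc a))) e)) (binom-self n)
binom-sym (suc n) (suc a) (suc b) e = trans (+-comm (binom n a) (binom n (suc a)))
  (cong₂ _+_ (binom-sym n (suc a) b (trans (sym (+-suc a b)) (suc-injective e))) (binom-sym n a (suc b) (suc-injective e)))

-- Relabelling element j as 0 lets arguments about an arbitrary element be carried out at the head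
-- of the vectors.
front : ∀ {n} → Fin (suc n) → Fam (suc n) → Fam (suc n)
front j g (b ∷ s) = g (insertAt s j b)

front-Uniform : ∀ {n} a (j : Fin (suc n)) g → Uniform a g → Uniform a (front j g)
front-Uniform a j g u (b ∷ s) i = trans (trans (∣∷∣ b s) (sym (∣insertAt∣ s j b))) (u _ i)

front-UnionsWithin : ∀ {n} z (j : Fin (suc n)) g → UnionsWithin z g → UnionsWithin z (front j g)
front-UnionsWithin z j g u (b ∷ s) (c ∷ t) i k = subst (_≤ z)
  (trans (cong ∣_∣ (∪-insertAt s t j b c)) (trans (∣insertAt∣ (s ∪ t) j (b ∨ c)) (sym (∣∷∣ (b ∨ c) (s ∪ t))))) (u _ _ i k)

cnt-front : ∀ {n} (j : Fin (suc n)) g → cnt (front j g) ≡ cnt g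
cnt-front j g = sym (sumV-insertAt j (λ s → 𝟙 (g s)))

mult : ∀ {n} → Fin n → Fam n → ℕ
mult i g = cnt (λ v → g v ∧ lookup v i)

𝟙-∧-true : ∀ a → 𝟙 (a ∧ true) ≡ 𝟙 a
𝟙-∧-true true  = refl
𝟙-∧-true false = refl

𝟙-∧-false : ∀ a → 𝟙 (a ∧ false) ≡ 0
𝟙-∧-false true  = refl
𝟙-∧-false false = refl

mult-insertAt : ∀ {n} (i : Fin (suc n)) (g : Fam (suc n)) → mult i g ≡ cnt (λ s → g (insertAt s i true))
mult-insertAt {n} i g = trans (sumV-insertAt i (λ v → 𝟙 (g v ∧ lookup v i))) (trans (cong₂ _+_
  (sumV-cong (λ s → trans (cong (λ b → 𝟙 (g (insertAt s i true) ∧ b)) (insertAt-lookup s i true)) (𝟙-∧-true (g (insertAt s i true)))))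
  (trans (sumV-cong (λ s → trans (cong (λ b → 𝟙 (g (insertAt s i false) ∧ b)) (insertAt-lookup s i false)) (𝟙-∧-false (g (insertAt s i false))))) (sumV-zero n)))
  (+-identityʳ _))

mix-∧ : ∀ c x y p q r → mix c x y (p ∧ r) (q ∧ r) ≡ true → mix c x y p q ∧ r ≡ true
mix-∧ c     true  true  true  q     r e = e
mix-∧ c     false false true  q     r e = e
mix-∧ true  true  false true  q     true e = refl
mix-∧ true  true  false false true  true e = refl
mix-∧ true  true  false true  true  false ()
mix-∧ true  true  false true  false false ()
mix-∧ true  false true  true  true  r e = ∧-projˡ e
mix-∧ true  false true  true  false true ()
mix-∧ true  false true  true  false false ()
mix-∧ false true  false true  true  r e = ∧-projˡ e
mix-∧ false true  false true  false true ()
mix-∧ false true  false true  false false ()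
mix-∧ false false true  true  q     true e = refl
mix-∧ false false true  false true  true e = refl
mix-∧ false false true  true  true  false ()
mix-∧ false false true  true  false false ()

mix-false-∧ : ∀ x y p q → mix false x y (p ∧ y) (q ∧ x) ≡ true → mix false x y p q ∧ y ≡ true
mix-false-∧ true  true  p     q e = e
mix-false-∧ false false p     q e = e
mix-false-∧ true  false true  q ()
mix-false-∧ true  false false q ()
mix-false-∧ false true  true  q e = refl
mix-false-∧ false true  false true ()
mix-false-∧ false true  false false ()

-- A shift that takes out 0 can only put in 1 + j, so among complements no nonzero element loses
-- members. Lower bounds on diversity are endangered at 0 only.
mult-shift : ∀ {n} (j i : Fin (suc n)) (g : Fam (suc (suc n))) → mult (suc i) g ≤ mult (suc i) (shift false j g)
mult-shift j i g = ≤-trans (≤-reflexive (sym (cnt-shift false j g∧))) (cnt-mono incl)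
  where
  g∧ : Fam _
  g∧ v = g v ∧ lookup v (suc i)
  incl : ∀ v → shift false j g∧ ∋ v → shift false j g v ∧ lookup v (suc i) ≡ true
  incl v m with at-∃ j v
  ... | x , y , s , refl = trans (cong (_∧ lookup (insertAt s j y) i) (shift-at false j g x y s)) (step (j ≟ᶠ i) (trans (sym (shift-at false j g∧ x y s)) m))
    where
    step : Dec (j ≡ i) → mix false x y (g (at j x y s) ∧ lookup (insertAt s j y) i) (g (at j y x s) ∧ lookup (insertAt s j x) i) ≡ true →
      mix false x y (g (at j x y s)) (g (at j y x s)) ∧ lookup (insertAt s j y) i ≡ true
    step (yes refl) e rewrite insertAt-lookup s j y | insertAt-lookup s j x = mix-false-∧ x y _ _ e
    step (no j≢i) e rewrite sym (punchIn-punchOut j≢i) | insertAt-punchIn s j y (punchOut j≢i) | insertAt-punchIn s j x (punchOut j≢i) =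
      mix-∧ false x y (g (at j x y s)) (g (at j y x s)) _ e

-- A family of k-sets on n points, k = κ + 3 and n = 2 k + d = z + 4, is represented by the family g of the
-- complements: intersecting means that unions in g have at most n − 1 points, and the diversity at i, i.e. the
-- number of k-sets avoiding i, is mult i g.
module Frankl (κ d z : ℕ) (z-def : d + (2 + κ) + κ ≡ z) where

  open ≤-Reasoning

  l N X Y : ℕ
  l = 2 + κ
  N = suc (suc (suc (suc z)))
  X = binom (suc z) (2 + κ)
  Y = binom (suc z) (1 + κ)

  -- Here X = C(n-3, k-1), Y = C(n-3, k-2) and `binom (3 + z) l` is C(n-1, k-1). X stands on the
  -- left to avoid a truncated difference.
  Bounded : Fam N → Set
  Bounded g = cnt g + X ≤ binom (3 + z) l + Y

  sym₀ : binom z (d + l) ≡ binom z κ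
  sym₀ = binom-sym z (d + l) κ z-def

  sym₁ : binom z (d + (1 + κ)) ≡ binom z (1 + κ)
  sym₁ = binom-sym z (d + (1 + κ)) (1 + κ) (trans (lemma d κ) z-def)
    where
    lemma : ∀ d κ → d + (1 + κ) + (1 + κ) ≡ d + (2 + κ) + κ
    lemma = solve-∀

  sym₂ : binom (suc z) (d + l) ≡ Y
  sym₂ = binom-sym (suc z) (d + l) (1 + κ) (trans (+-suc (d + l) κ) (cong suc z-def))

  increasing₀ : binom z κ ≤ binom z (1 + κ)
  increasing₀ = *-cancelˡ-≤ (suc κ) (begin
    suc κ * binom z κ       ≤⟨ *-monoˡ-≤ (binom z κ) (≤-trans (n≤1+n (suc κ)) (m≤n+m l d)) ⟩
    (d + l) * binom z κ     ≡⟨ subst (λ z → suc κ * binom z (suc κ) ≡ (d + l) * binom z κ) z-def (binom-step (d + l) κ) ⟨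
    suc κ * binom z (suc κ) ∎)

  increasing₁ : Y ≤ X
  increasing₁ = *-cancelˡ-≤ l (begin
    l * Y       ≤⟨ *-monoˡ-≤ Y (m≤n+m l d) ⟩
    (d + l) * Y ≡⟨ subst (λ z → l * binom z l ≡ (d + l) * binom z (1 + κ)) (trans (+-suc (d + l) κ) (cong suc z-def)) (binom-step (d + l) (1 + κ)) ⟨
    l * X       ∎)

  κ≤z : κ ≤ z
  κ≤z = ≤-trans (m≤n+m κ (d + l)) (≤-reflexive z-def)

  Y≥1 : 1 ≤ Y
  Y≥1 = binom-pos (suc z) (1 + κ) (s≤s κ≤z)

  dl≤z : d + l ≤ z
  dl≤z = ≤-trans (m≤m+n (d + l) κ) (≤-reflexive z-def)

  -- For z ≤ x ≤ z + 1, the interpolations of C(x, d + l) and of C(x, l) both have slope C(z, κ + 1).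
  window : ∀ {n} (h : Fam n) → Uniform (d + l) h → binom z κ ≤ cnt h → cnt h ≤ Y → cnt h + X ≤ cnt (shs d h) + Y
  window h u lo hi = ≤-trans (≤-reflexive (sym lhs)) (≤-trans (+-monoˡ-≤ Y S-bound) ≤-refl)
    where
    q r : ℕ
    q = binom z (1 + κ)
    r = cnt h ∸ binom z κ
    r-def : binom z κ + r ≡ cnt h
    r-def = m+[n∸m]≡n lo
    r≤q : r ≤ q
    r≤q = +-cancelˡ-≤ (binom z κ) _ _ (≤-trans (≤-reflexive r-def) hi)
    q≥1 : 1 ≤ q
    q≥1 = ≤-trans (binom-pos z κ κ≤z) increasing₀
    interp-eq : interp r q z (d + l) ≡ q * cnt h
    interp-eq = begin-equality
      interp r q z (d + (2 + κ))                          ≡⟨ cong (interp r q z) (+-suc d (1 + κ)) ⟩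
      q * binom z (suc (d + (1 + κ))) + r * binom z (d + (1 + κ)) ≡⟨ cong₂ (λ x y → q * x + r * y) (trans (cong (binom z) (sym (+-suc d (1 + κ)))) sym₀) sym₁ ⟩
      q * binom z κ + r * q                               ≡⟨ cong (q * binom z κ +_) (*-comm r q) ⟩
      q * binom z κ + q * r                               ≡⟨ *-distribˡ-+ q (binom z κ) r ⟨
      q * (binom z κ + r)                                 ≡⟨ cong (q *_) r-def ⟩
      q * cnt h                                           ∎
    S-bound : binom z l + r ≤ cnt (shs d h)
    S-bound = *-cancelˡ-≤ q {{>-nonZero q≥1}} (begin
      q * (binom z l + r)   ≡⟨ *-distribˡ-+ q (binom z l) r ⟩
      q * binom z l + q * r ≡⟨ cong (q * binom z l +_) (*-comm q r) ⟩
      interp r q z l        ≤⟨ kruskalKatona-iterated r q z d l h r≤q q≥1 u (cnt-∃ h (≤-trans (binom-pos z κ κ≤z) lo)) (m≤n⇒m≤1+n dl≤z) (≤-reflexive interp-eq) ⟩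
      q * cnt (shs d h)     ∎)
    lhs : binom z l + r + Y ≡ cnt h + X
    lhs = trans (lemma (binom z l) r (binom z κ) (binom z (1 + κ))) (cong (_+ X) r-def)
      where
      lemma : ∀ w r a b → w + r + (a + b) ≡ a + r + (b + w)
      lemma = solve-∀

  -- More than Y sets in `h` have a shadow of at least X sets, and X + Y = C(n-2, k-1) then leaves
  -- at most Y for `g`.
  cross-small : ∀ (g h : Fam (suc (suc z))) → Uniform (d + l) g → Uniform (d + l) h →
    (∀ A B → g ∋ A → h ∋ B → ∣ A ∪ B ∣ < suc (suc z)) → Y < cnt h → cnt g ≤ Y
  cross-small g h gu hu cross big = +-cancelʳ-≤ X _ _ (begin
    cnt g + X              ≤⟨ +-monoʳ-≤ (cnt g) shadow ⟩
    cnt g + cnt (shs d h)  ≤⟨ cross-bound d l (d + l) g h (trans (lemma d κ) (cong (2 +_) z-def)) gu hu cross ⟩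
    Y + X                  ∎)
    where
    lemma : ∀ d κ → d + (2 + κ) + (2 + κ) ≡ 2 + (d + (2 + κ) + κ)
    lemma = solve-∀
    shadow : X ≤ cnt (shs d h)
    shadow = kruskalKatona-binom (suc z) d l h hu (m≤n⇒m≤1+n (m≤n⇒m≤1+n dl≤z)) (≤-trans (s≤s z≤n) big) (≤-trans (≤-reflexive sym₂) (<⇒≤ big))

  N-split : 1 + (d + l) + l ≡ 3 + z
  N-split = trans (lemma d κ) (cong (3 +_) z-def)
    where
    lemma : ∀ d κ → 1 + (d + (2 + κ)) + (2 + κ) ≡ 3 + (d + (2 + κ) + κ)
    lemma = solve-∀

  -- The link of 0 stands for the k-sets avoiding 0. Each set of its shadow excludes one k-set
  -- through 0, so it suffices that the shadow exceeds the link by X - Y.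
  head-bound : ∀ (g : Fam N) → Uniform (1 + (d + l)) g → UnionsWithin (3 + z) g →
    cnt (λ s → g (true ∷ s)) + X ≤ cnt (shs d (λ s → g (true ∷ s))) + Y → Bounded g
  head-bound g u un h = begin
    cnt g₁ + cnt g₀ + X               ≡⟨ lemma (cnt g₁) (cnt g₀) X ⟩
    cnt g₀ + (cnt g₁ + X)             ≤⟨ +-monoʳ-≤ (cnt g₀) h ⟩
    cnt g₀ + (cnt (shs d g₁) + Y)     ≡⟨ +-assoc (cnt g₀) _ Y ⟨
    cnt g₀ + cnt (shs d g₁) + Y       ≤⟨ +-monoˡ-≤ Y (cross-bound d l (1 + (d + l)) g₀ g₁ N-split (λ s → u (false ∷ s)) (tail-Uniform (d + l) g u)
                                           (λ A B iA iB → un (false ∷ A) (true ∷ B) iA iB)) ⟩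
    binom (3 + z) l + Y               ∎
    where
    g₁ g₀ : Fam (3 + z)
    g₁ s = g (true ∷ s)
    g₀ s = g (false ∷ s)
    lemma : ∀ a b c → a + b + c ≡ b + (a + c)
    lemma = solve-∀

  window-bound : ∀ (g : Fam N) → Uniform (1 + (d + l)) g → UnionsWithin (3 + z) g → ∀ i → binom z κ ≤ mult i g → mult i g ≤ Y → Bounded g
  window-bound g u un i lo hi = subst (λ m → m + X ≤ binom (3 + z) l + Y) (cnt-front i g)
    (head-bound (front i g) (front-Uniform _ i g u) (front-UnionsWithin _ i g un)
      (window (λ s → g (insertAt s i true)) (tail-Uniform (d + l) (front i g) (front-Uniform _ i g u))
        (subst (binom z κ ≤_) (mult-insertAt i g) lo) (subst (_≤ Y) (mult-insertAt i g) hi)))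

  -- By stability, unions within the link of 0 have at most z + 1 points, so Katona's ratio is X / Y
  -- ≥ 1. Applied to more than Y sets, it gives an excess S - c of at least X - Y.
  stable-bound : ∀ (g : Fam N) → Uniform (1 + (d + l)) g → UnionsWithin (3 + z) g → Stable false g → Y < cnt (λ s → g (true ∷ s)) → Bounded g
  stable-bound g u un st big = head-bound g u un (*-cancelʳ-≤ _ _ Y {{>-nonZero Y≥1}} (begin
    (c + X) * Y             ≡⟨ cong (λ m → (m + X) * Y) (sym e-def) ⟩
    (Y + e + X) * Y         ≡⟨ l₁ Y e X ⟩
    X * Y + e * Y + Y * Y   ≤⟨ +-monoˡ-≤ (Y * Y) (+-monoʳ-≤ (X * Y) (*-monoʳ-≤ e increasing₁)) ⟩
    X * Y + e * X + Y * Y   ≡⟨ l₂ Y e X ⟩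
    (Y + e) * X + Y * Y     ≡⟨ cong (λ m → m * X + Y * Y) e-def ⟩
    c * X + Y * Y           ≤⟨ +-monoˡ-≤ (Y * Y) kat ⟩
    S * Y + Y * Y           ≡⟨ *-distribʳ-+ Y S Y ⟨
    (S + Y) * Y             ∎))
    where
    g₁ : Fam (3 + z)
    g₁ s = g (true ∷ s)
    c S e : ℕ
    c = cnt g₁
    S = cnt (shs d g₁)
    e = c ∸ Y
    e-def : Y + e ≡ c
    e-def = m+[n∸m]≡n (<⇒≤ big)
    l₁ : ∀ Y e X → (Y + e + X) * Y ≡ X * Y + e * Y + Y * Y
    l₁ = solve-∀
    l₂ : ∀ Y e X → X * Y + e * X + Y * Y ≡ (Y + e) * X + Y * Y
    l₂ = solve-∀
    eN : d + l + (1 + κ) ≡ suc z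
    eN = trans (+-suc (d + l) κ) (cong suc z-def)
    kat : c * X ≤ S * Y
    kat = subst (λ y → c * X ≤ S * y) sym₂ (subst (λ m → c * binom m l ≤ S * binom m (d + l)) eN
      (katona (3 + z) (1 + κ) d l g₁ (tail-Uniform (d + l) g u)
        (λ A B iA iB → ≤-trans (≤-pred (≤-pred (Stable-unions (3 + z) g st un ≤-refl A B iA iB))) (≤-reflexive (sym eN))) (n≤1+n (1 + κ))))

  -- If a shift makes the diversity jump over the window, then the two mixed links g₁₀ and g₀₁ are both large; being
  -- cross-intersecting, one of them is in the window.
  jump-bound : ∀ (g : Fam N) (j : Fin (3 + z)) → Uniform (1 + (d + l)) g → UnionsWithin (3 + z) g →
    Y < mult zero g → Y < mult (suc j) g → mult zero (shift false j g) < binom z κ → Bounded g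
  jump-bound g j u un big₀ big₁ small = begin
    cnt g + X                              ≡⟨ cong (_+ X) (cnt-at j g) ⟩
    (cnt g₁₁ + cnt g₁₀) + (cnt g₀₁ + cnt g₀₀) + X ≡⟨ l₁ (cnt g₁₁) (cnt g₁₀) (cnt g₀₁) (cnt g₀₀) X ⟩
    -- The quarters are grouped into two cross-intersecting pairs on n - 2 points. Pascal's rule
    -- adds the bounds C(n-2, k-1) and C(n-2, k-2) to C(n-1, k-1).
    (cnt g₁₀ + cnt g₀₁ + X) + (cnt g₀₀ + cnt g₁₁) ≤⟨ +-mono-≤ mixed pure ⟩
    (binom (2 + z) l + Y) + binom (2 + z) (1 + κ) ≡⟨ l₂ (binom (2 + z) l) Y (binom (2 + z) (1 + κ)) ⟩
    binom (3 + z) l + Y                    ∎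
    where
    g₁₁ g₁₀ g₀₁ g₀₀ : Fam (2 + z)
    g₁₁ = g ∘ at j true true
    g₁₀ = g ∘ at j true false
    g₀₁ = g ∘ at j false true
    g₀₀ = g ∘ at j false false
    l₁ : ∀ a b c e x → (a + b) + (c + e) + x ≡ (b + c + x) + (e + a)
    l₁ = solve-∀
    l₂ : ∀ a y b → (a + y) + b ≡ (b + a) + y
    l₂ = solve-∀
    uniform : ∀ x y {s} → g ∋ at j x y s → 𝟙 x + (𝟙 y + ∣ s ∣) ≡ 1 + (d + l)
    uniform x y {s} i = trans (sym (∣at∣ j x y s)) (u _ i)
    u₁₀ : Uniform (d + l) g₁₀
    u₁₀ s i = suc-injective (uniform true false i)
    u₀₁ : Uniform (d + l) g₀₁
    u₀₁ s i = suc-injective (uniform false true i)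
    u₁₁ : Uniform (d + (1 + κ)) g₁₁
    u₁₁ s i = suc-injective (suc-injective (trans (uniform true true i) (cong suc (+-suc d (1 + κ)))))
    cross : ∀ x y x′ y′ → 𝟙 (x ∨ x′) + (𝟙 (y ∨ y′) + 0) ≡ 2 → ∀ A B → g ∋ at j x y A → g ∋ at j x′ y′ B → ∣ A ∪ B ∣ < 2 + z
    cross x y x′ y′ e A B iA iB = ≤-pred (≤-trans (≤-reflexive (sym (trans (∣at∪at∣ j x y A x′ y′ B) (trans (lemma (𝟙 (x ∨ x′)) _ ∣ A ∪ B ∣) (cong (_+ ∣ A ∪ B ∣) e))))) (un _ _ iA iB))
      where
      lemma : ∀ a b c → a + (b + c) ≡ a + (b + 0) + c
      lemma = solve-∀
    -- Sets containing both elements are fixed by the shift and so are counted in the small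
    -- diversity after it.
    few₁₁ : cnt g₁₁ < binom z κ
    few₁₁ = ≤-<-trans (begin
      cnt g₁₁                                           ≡⟨ cnt-cong (λ s → sym (shift-at false j g true true s)) ⟩
      cnt (shift false j g ∘ at j true true)            ≤⟨ m≤m+n _ _ ⟩
      cnt (shift false j g ∘ at j true true) + cnt (shift false j g ∘ at j true false) ≡⟨ sumV-insertAt j (λ s → 𝟙 (shift false j g (true ∷ s))) ⟨
      cnt (λ s → shift false j g (true ∷ s))            ≡⟨ mult-insertAt zero (shift false j g) ⟨
      mult zero (shift false j g)                       ∎) small
    enough : ∀ {m} → Y < cnt g₁₁ + m → binom z κ ≤ m
    enough {m} h = ≤-trans increasing₀ (+-cancelˡ-≤ (binom z κ) _ _ (≤-trans (<⇒≤ h) (+-monoˡ-≤ m (<⇒≤ few₁₁))))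
    many₁₀ : binom z κ ≤ cnt g₁₀
    many₁₀ = enough (subst (Y <_) (trans (mult-insertAt zero g) (sumV-insertAt j (λ s → 𝟙 (g (true ∷ s))))) big₀)
    many₀₁ : binom z κ ≤ cnt g₀₁
    many₀₁ = enough (subst (Y <_) (mult-insertAt (suc j) g) big₁)
    m-split : d + l + l ≡ 2 + z
    m-split = suc-injective N-split
    mixed-from : ∀ (p q : Fam (2 + z)) → Uniform (d + l) p → Uniform (d + l) q → (∀ A B → p ∋ A → q ∋ B → ∣ A ∪ B ∣ < 2 + z) →
      binom z κ ≤ cnt q → cnt q ≤ Y → cnt p + cnt q + X ≤ binom (2 + z) l + Y
    mixed-from p q pu qu c lo hi = begin
      cnt p + cnt q + X               ≡⟨ +-assoc (cnt p) (cnt q) X ⟩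
      cnt p + (cnt q + X)             ≤⟨ +-monoʳ-≤ (cnt p) (window q qu lo hi) ⟩
      cnt p + (cnt (shs d q) + Y)     ≡⟨ +-assoc (cnt p) _ Y ⟨
      cnt p + cnt (shs d q) + Y       ≤⟨ +-monoˡ-≤ Y (cross-bound d l (d + l) p q m-split pu qu c) ⟩
      binom (2 + z) l + Y             ∎
    mixed : cnt g₁₀ + cnt g₀₁ + X ≤ binom (2 + z) l + Y
    mixed with cnt g₀₁ ≤? Y
    ... | yes hi = mixed-from g₁₀ g₀₁ u₁₀ u₀₁ (cross true false false true refl) many₀₁ hi
    ... | no big = subst (λ m → m + X ≤ binom (2 + z) l + Y) (+-comm (cnt g₀₁) (cnt g₁₀))
      (mixed-from g₀₁ g₁₀ u₀₁ u₁₀ (cross false true true false refl) many₁₀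
        (cross-small g₁₀ g₀₁ u₁₀ u₀₁ (cross true false false true refl) (≰⇒> big)))
    -- Since C(z, d + κ + 1) = C(z, κ + 1), the linear bound says that the shadow of `g₁₁` is at
    -- least as large as `g₁₁` itself.
    pure : cnt g₀₀ + cnt g₁₁ ≤ binom (2 + z) (1 + κ)
    pure = ≤-trans (+-monoʳ-≤ (cnt g₀₀) (*-cancelʳ-≤ _ _ (binom z (1 + κ)) {{>-nonZero (≤-trans (binom-pos z κ κ≤z) increasing₀)}}
        (subst (λ m → cnt g₁₁ * binom z (1 + κ) ≤ cnt (shs d g₁₁) * m) sym₁
          (kruskalKatona-linear z d (1 + κ) g₁₁ u₁₁ (≤-trans (<⇒≤ few₁₁) (≤-trans increasing₀ (≤-reflexive (sym sym₁))))))))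
      (cross-bound d (1 + κ) (1 + (d + l)) g₀₀ g₁₁ (suc-injective (trans (lemma d κ) N-split)) (λ s i → uniform false false i) u₁₁
        (cross false false true true refl))
      where
      lemma : ∀ d κ → suc (1 + (d + (2 + κ)) + (1 + κ)) ≡ 1 + (d + (2 + κ)) + (2 + κ)
      lemma = solve-∀

  frankl : ∀ (f : Fam N) → Uniform (1 + (d + l)) f → UnionsWithin (3 + z) f → (∀ i → binom z κ ≤ mult i f) → Bounded f
  frankl f u un lo with mult zero f ≤? Y
  ... | yes hi = window-bound f u un zero (lo zero) hi
  ... | no big = conclude (stabilize false P step f (u , un , refl , ≰⇒> big , λ i → lo (suc i)))
    where
    -- At 0 the diversity is kept above Y; when it would drop to Y or below, the shifting stops
    -- early with the bound proved. At the other elements the lower end of the window is enough.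
    P : Fam N → Set
    P g = Uniform (1 + (d + l)) g × UnionsWithin (3 + z) g × cnt g ≡ cnt f × Y < mult zero g × (∀ i → binom z κ ≤ mult (suc i) g)
    back : ∀ g → cnt g ≡ cnt f → Bounded g → Bounded f
    back g e = subst (λ m → m + X ≤ binom (3 + z) l + Y) e
    step : ∀ g j → P g → Unstable false j g → P (shift false j g) ⊎ Bounded f
    step g j (gu , gn , gc , gb , gl) _ with mult (suc j) g ≤? Y
    ... | yes hi = inj₂ (back g gc (window-bound g gu gn (suc j) (gl j) hi))
    ... | no big₁ with mult zero (shift false j g) ≤? Y
    ...   | no still = inj₁ (shift-Uniform _ false j g gu , shift-UnionsWithin _ false j g gn , trans (cnt-shift false j g) gc , ≰⇒> still ,
                             λ i → ≤-trans (gl i) (mult-shift j i g))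
    ...   | yes hi with binom z κ ≤? mult zero (shift false j g)
    ...     | yes lo′ = inj₂ (back (shift false j g) (trans (cnt-shift false j g) gc)
                 (window-bound (shift false j g) (shift-Uniform _ false j g gu) (shift-UnionsWithin _ false j g gn) zero lo′ hi))
    ...     | no jump = inj₂ (back g gc (jump-bound g j gu gn gb (≰⇒> big₁) (≰⇒> jump)))
    conclude : (∃ λ g → P g × Stable false g) ⊎ Bounded f → Bounded f
    conclude (inj₁ (g , (gu , gn , gc , gb , _) , st)) = back g gc (stable-bound g gu gn st (subst (Y <_) (mult-insertAt zero g) gb))
    conclude (inj₂ b) = b


-- Degrees

level : ∀ {n} → ℕ → Fam n
level t s = ∣ s ∣ ≡ᵇ t

≡ᵇ-sound : ∀ m n → (m ≡ᵇ n) ≡ true → m ≡ n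
≡ᵇ-sound zero    zero    e = refl
≡ᵇ-sound (suc m) (suc n) e = cong suc (≡ᵇ-sound m n e)

≡ᵇ-refl : ∀ m → (m ≡ᵇ m) ≡ true
≡ᵇ-refl zero    = refl
≡ᵇ-refl (suc m) = ≡ᵇ-refl m

deg : ∀ {n} → Fam n → Vec Bool n → ℕ
deg f T = cnt (λ s → f s ∧ sub T s)

cnt-∅ : ∀ {n} (f : Fam n) → (∀ s → f s ≡ false) → cnt f ≡ 0
cnt-∅ {n} f e = trans (cnt-cong e) (sumV-zero n)

∧-falseʳ : ∀ a → a ∧ false ≡ false
∧-falseʳ true  = refl
∧-falseʳ false = refl

cnt-level-sub : ∀ {n} t (s : Vec Bool n) → cnt (λ T → level t T ∧ sub T s) ≡ binom ∣ s ∣ t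
cnt-level-sub zero    []          = refl
cnt-level-sub (suc t) []          = refl
cnt-level-sub zero    (true ∷ s)  = cong₂ _+_ (cnt-∅ (λ T → level 0 (true ∷ T) ∧ sub T s) (λ _ → refl)) (cnt-level-sub zero s)
cnt-level-sub (suc t) (true ∷ s)  = cong₂ _+_ (cnt-level-sub t s) (cnt-level-sub (suc t) s)
cnt-level-sub {suc n} t (false ∷ s) = cong₂ _+_ (cnt-∅ {n} (λ T → level t (true ∷ T) ∧ false) (λ T → ∧-falseʳ _)) (cnt-level-sub t s)

cnt-level : ∀ n t → cnt {n} (level t) ≡ binom n t
cnt-level zero    zero    = refl
cnt-level zero    (suc t) = refl
cnt-level (suc n) zero    = cong₂ _+_ (cnt-∅ {n} (λ T → level 0 (true ∷ T)) (λ _ → refl)) (cnt-level n zero)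
cnt-level (suc n) (suc t) = cong₂ _+_ (cnt-level n t) (cnt-level n (suc t))

-- Double counting of the pairs of a t-set and a member containing it.
sum-deg : ∀ {n} k t (f : Fam n) → Uniform k f → sumV (λ T → 𝟙 (level t T) * deg f T) ≡ cnt f * binom k t
sum-deg k t f u = begin
  sumV (λ T → 𝟙 (level t T) * deg f T)                          ≡⟨ sumV-cong (λ T → sym (sumV-*ˡ (𝟙 (level t T)) (λ s → 𝟙 (f s ∧ sub T s)))) ⟩
  sumV (λ T → sumV (λ s → 𝟙 (level t T) * 𝟙 (f s ∧ sub T s)))   ≡⟨ sumV-swap (λ T s → 𝟙 (level t T) * 𝟙 (f s ∧ sub T s)) ⟩
  sumV (λ s → sumV (λ T → 𝟙 (level t T) * 𝟙 (f s ∧ sub T s)))   ≡⟨ sumV-cong (λ s → trans (sumV-cong (λ T → rearrange (level t T) (f s) (sub T s)))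
                                                                        (sumV-*ˡ (𝟙 (f s)) (λ T → 𝟙 (level t T ∧ sub T s)))) ⟩
  sumV (λ s → 𝟙 (f s) * cnt (λ T → level t T ∧ sub T s))        ≡⟨ sumV-cong (λ s → each s (f s) refl) ⟩
  sumV (λ s → binom k t * 𝟙 (f s))                              ≡⟨ sumV-*ˡ (binom k t) (λ s → 𝟙 (f s)) ⟩
  binom k t * cnt f                                             ≡⟨ *-comm (binom k t) (cnt f) ⟩
  cnt f * binom k t                                             ∎
  where
  open ≡-Reasoning
  rearrange : ∀ a b c → 𝟙 a * 𝟙 (b ∧ c) ≡ 𝟙 b * 𝟙 (a ∧ c)
  rearrange true  true  c = refl
  rearrange true  false c = refl
  rearrange false true  c = refl
  rearrange false false c = refl
  each : ∀ s b → f s ≡ b → 𝟙 b * cnt (λ T → level t T ∧ sub T s) ≡ binom k t * 𝟙 b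
  each s true  e = trans (+-identityʳ _) (trans (cnt-level-sub t s) (trans (cong (λ m → binom m t) (u s e)) (sym (*-identityʳ _))))
  each s false e = sym (*-zeroʳ (binom k t))

average : ∀ {n} (w : Fam n) (g : Vec Bool n → ℕ) B → 1 ≤ cnt w → sumV (λ T → 𝟙 (w T) * g T) ≤ cnt w * B → ∃ λ T → w ∋ T × g T ≤ B
average w g B pos le with search (λ T → w T ∧ (g T ≤ᵇ B))
... | inj₁ (T , i) = T , ∧-projˡ i , ≤ᵇ⇒≤ (g T) B (subst True (sym (∧-projʳ {w T} i)) _)
average w g B pos le | inj₂ none = contradiction (≤-trans lower le) (<⇒≱ increase)
  where
  open ≤-Reasoning
  big : ∀ T → 𝟙 (w T) * suc B ≤ 𝟙 (w T) * g T
  big T with w T in e | g T ≤? B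
  ... | false | _     = z≤n
  ... | true  | yes b = contradiction (∧-intro e (Equivalence.to T-≡ (≤⇒≤ᵇ b))) (none T)
  ... | true  | no ¬b = *-monoʳ-≤ 1 (≰⇒> ¬b)
  lower : cnt w * suc B ≤ sumV (λ T → 𝟙 (w T) * g T)
  lower = begin
    cnt w * suc B                   ≡⟨ *-comm (cnt w) (suc B) ⟩
    suc B * cnt w                   ≡⟨ sumV-*ˡ (suc B) (λ T → 𝟙 (w T)) ⟨
    sumV (λ T → suc B * 𝟙 (w T))    ≡⟨ sumV-cong (λ T → *-comm (suc B) (𝟙 (w T))) ⟩
    sumV (λ T → 𝟙 (w T) * suc B)    ≤⟨ sumV-mono big ⟩
    sumV (λ T → 𝟙 (w T) * g T)      ∎
  increase : cnt w * B < cnt w * suc B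
  increase = *-monoʳ-< (cnt w) {{>-nonZero pos}} ≤-refl

dis : ∀ {n} → Vec Bool n → Vec Bool n → Bool
dis []      []      = true
dis (x ∷ s) (y ∷ t) = not (x ∧ y) ∧ dis s t

-- Outside P and Q there are r free points, of which i are chosen.
cnt-between : ∀ {n} (P Q : Vec Bool n) r i → dis P Q ≡ true → ∣ P ∣ + ∣ Q ∣ + r ≡ n →
  cnt (λ s → level (∣ P ∣ + i) s ∧ (sub P s ∧ dis Q s)) ≡ binom r i
cnt-between [] [] zero zero    d e = refl
cnt-between [] [] zero (suc i) d e = refl
cnt-between {suc n} (true ∷ P) (false ∷ Q) r i d e =
  trans (cong₂ _+_ (cnt-between P Q r i d (suc-injective e)) (cnt-∅ {n} (λ s → level (suc ∣ P ∣ + i) (false ∷ s) ∧ false) (λ s → ∧-falseʳ _))) (+-identityʳ _)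
cnt-between (false ∷ P) (true ∷ Q) r i d e =
  trans (cong₂ _+_ (cnt-∅ (λ s → level (∣ P ∣ + i) (true ∷ s) ∧ (sub P s ∧ false)) (λ s → trans (cong (level (∣ P ∣ + i) (true ∷ s) ∧_) (∧-falseʳ (sub P s))) (∧-falseʳ _)))
                   (cnt-between P Q r i d (suc-injective (trans (cong (_+ r) (sym (+-suc ∣ P ∣ ∣ Q ∣))) e)))) refl
cnt-between {suc n} (false ∷ P) (false ∷ Q) zero i d e =
  contradiction (≤-trans (≤-reflexive (sym e)) (≤-trans (≤-reflexive (+-identityʳ _)) (bound P Q d))) 1+n≰n
  where
  bound : ∀ {n} (P Q : Vec Bool n) → dis P Q ≡ true → ∣ P ∣ + ∣ Q ∣ ≤ n
  bound []          []          d = z≤n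
  bound (true ∷ P)  (false ∷ Q) d = s≤s (bound P Q d)
  bound (false ∷ P) (true ∷ Q)  d = ≤-trans (≤-reflexive (+-suc ∣ P ∣ ∣ Q ∣)) (s≤s (bound P Q d))
  bound (false ∷ P) (false ∷ Q) d = m≤n⇒m≤1+n (bound P Q d)
cnt-between (false ∷ P) (false ∷ Q) (suc r) i d e = trans (cong₂ _+_ (top i) (cnt-between P Q r i d e′)) (pascal i)
  where
  e′ : ∣ P ∣ + ∣ Q ∣ + r ≡ _
  e′ = suc-injective (trans (sym (+-suc _ r)) e)
  below : ℕ → ℕ
  below zero    = 0
  below (suc i) = binom r i
  level-0 : ∀ {n} (P s : Vec Bool n) b → level (∣ P ∣ + 0) (true ∷ s) ∧ (sub P s ∧ b) ≡ false
  level-0 P s b with sub P s in e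
  ... | false = ∧-falseʳ _
  ... | true with level (∣ P ∣ + 0) (true ∷ s) in e′
  ...   | false = refl
  ...   | true  = contradiction (≤-trans (≤-reflexive (≡ᵇ-sound _ _ e′)) (≤-trans (≤-reflexive (+-identityʳ _)) (size P s e))) 1+n≰n
    where
    size : ∀ {n} (P s : Vec Bool n) → sub P s ≡ true → ∣ P ∣ ≤ ∣ s ∣
    size []          []          e = z≤n
    size (true ∷ P)  (true ∷ s)  e = s≤s (size P s e)
    size (false ∷ P) (true ∷ s)  e = m≤n⇒m≤1+n (size P s e)
    size (false ∷ P) (false ∷ s) e = size P s e
  top : ∀ i → cnt (λ s → level (∣ P ∣ + i) (true ∷ s) ∧ (sub P s ∧ dis Q s)) ≡ below i
  top zero    = cnt-∅ _ (λ s → level-0 P s (dis Q s))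
  top (suc i) = trans (cong (λ a → cnt (λ s → level a (true ∷ s) ∧ (sub P s ∧ dis Q s))) (+-suc ∣ P ∣ i)) (cnt-between P Q r i d e′)
  pascal : ∀ i → below i + binom r i ≡ binom (suc r) i
  pascal zero    = refl
  pascal (suc i) = refl

avoid : ∀ {n} t (U : Vec Bool n) → ∣ U ∣ + t ≤ n → ∃ λ T → ∣ T ∣ ≡ t × dis U T ≡ true
avoid zero    []          le = [] , refl , refl
avoid zero    (x ∷ U)     le with avoid zero U (≤-trans (≤-reflexive (+-identityʳ _)) (∣p∣≤n U))
... | T , e , d = false ∷ T , e , trans (cong (λ b → not b ∧ dis U T) (∧-falseʳ x)) d
avoid (suc t) []          ()
avoid (suc t) (true ∷ U)  (s≤s le) with avoid (suc t) U le
... | T , e , d = false ∷ T , e , d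
avoid (suc t) (false ∷ U) le with avoid t U (≤-pred (≤-trans (≤-reflexive (sym (+-suc ∣ U ∣ t))) le))
... | T , e , d = true ∷ T , cong suc e , d

∣∪∣≤ : ∀ {n} (A B : Vec Bool n) → ∣ A ∪ B ∣ ≤ ∣ A ∣ + ∣ B ∣
∣∪∣≤ []          []          = z≤n
∣∪∣≤ (true ∷ A)  (true ∷ B)  = s≤s (≤-trans (∣∪∣≤ A B) (+-monoʳ-≤ ∣ A ∣ (n≤1+n ∣ B ∣)))
∣∪∣≤ (true ∷ A)  (false ∷ B) = s≤s (∣∪∣≤ A B)
∣∪∣≤ (false ∷ A) (true ∷ B)  = ≤-trans (s≤s (∣∪∣≤ A B)) (≤-reflexive (sym (+-suc ∣ A ∣ ∣ B ∣)))
∣∪∣≤ (false ∷ A) (false ∷ B) = ∣∪∣≤ A B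

dis-∪ : ∀ {n} (A B T : Vec Bool n) → dis (A ∪ B) T ≡ true → dis A T ≡ true × dis B T ≡ true
dis-∪ []          []          []          d = refl , refl
dis-∪ (false ∷ A) (false ∷ B) (z ∷ T)     d = dis-∪ A B T d
dis-∪ (true ∷ A)  (true ∷ B)  (false ∷ T) d = dis-∪ A B T d
dis-∪ (true ∷ A)  (false ∷ B) (false ∷ T) d = dis-∪ A B T d
dis-∪ (false ∷ A) (true ∷ B)  (false ∷ T) d = dis-∪ A B T d

dis-comm : ∀ {n} (s t : Vec Bool n) → dis s t ≡ dis t s
dis-comm []          []          = refl
dis-comm (true ∷ s)  (true ∷ t)  = refl
dis-comm (true ∷ s)  (false ∷ t) = dis-comm s t
dis-comm (false ∷ s) (true ∷ t)  = dis-comm s t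
dis-comm (false ∷ s) (false ∷ t) = dis-comm s t

∣∣-sub-dis : ∀ {n} (A T s : Vec Bool n) → sub A s ≡ true → sub T s ≡ true → dis A T ≡ true → ∣ A ∣ + ∣ T ∣ ≤ ∣ s ∣
∣∣-sub-dis []          []          []          p q d = z≤n
∣∣-sub-dis (true ∷ A)  (false ∷ T) (true ∷ s)  p q d = s≤s (∣∣-sub-dis A T s p q d)
∣∣-sub-dis (false ∷ A) (true ∷ T)  (true ∷ s)  p q d = ≤-trans (≤-reflexive (+-suc ∣ A ∣ ∣ T ∣)) (s≤s (∣∣-sub-dis A T s p q d))
∣∣-sub-dis (false ∷ A) (false ∷ T) (true ∷ s)  p q d = m≤n⇒m≤1+n (∣∣-sub-dis A T s p q d)
∣∣-sub-dis (false ∷ A) (false ∷ T) (false ∷ s) p q d = ∣∣-sub-dis A T s p q d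

dis-sub : ∀ {n} (A P s : Vec Bool n) → dis A P ≡ false → sub P s ≡ true → dis A s ≡ false
dis-sub []          []          []          ()
dis-sub (true ∷ A)  (true ∷ P)  (true ∷ s)  d p = refl
dis-sub (true ∷ A)  (false ∷ P) (true ∷ s)  d p = refl
dis-sub (true ∷ A)  (false ∷ P) (false ∷ s) d p = dis-sub A P s d p
dis-sub (false ∷ A) (true ∷ P)  (true ∷ s)  d p = dis-sub A P s d p
dis-sub (false ∷ A) (false ∷ P) (z ∷ s)     d p = dis-sub A P s d p

-- P is T with a point of A outside B added. Every superset of P meets A, so supersets of P missing
-- B are different from the sets missing A.
extend : ∀ {n} (A B T : Vec Bool n) → sub A B ≡ false → dis A T ≡ true → dis B T ≡ true →
  ∃ λ P → ∣ P ∣ ≡ suc ∣ T ∣ × sub T P ≡ true × dis B P ≡ true × dis A P ≡ false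
extend []          []          []          ()
extend (true ∷ A)  (false ∷ B) (false ∷ T) n a b = true ∷ T , refl , sub-refl T , b , refl
extend (true ∷ A)  (true ∷ B)  (false ∷ T) n a b with extend A B T n a b
... | P , e , q , b′ , a′ = false ∷ P , e , q , b′ , a′
extend (false ∷ A) (false ∷ B) (true ∷ T)  n a b with extend A B T n a b
... | P , e , q , b′ , a′ = true ∷ P , cong suc e , q , b′ , a′
extend (false ∷ A) (false ∷ B) (false ∷ T) n a b with extend A B T n a b
... | P , e , q , b′ , a′ = false ∷ P , e , q , b′ , a′
extend (false ∷ A) (true ∷ B)  (false ∷ T) n a b with extend A B T n a b
... | P , e , q , b′ , a′ = false ∷ P , e , q , b′ , a′

Intersects : ∀ {n} → Fam n → Set
Intersects f = ∀ s t → f ∋ s → f ∋ t → dis s t ≡ false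

cnt-level-⊇ : ∀ {n} (P : Vec Bool n) r i → ∣ P ∣ + r ≡ n → cnt (λ s → level (∣ P ∣ + i) s ∧ sub P s) ≡ binom r i
cnt-level-⊇ {n} P r i e = trans (cnt-cong λ s → cong (level (∣ P ∣ + i) s ∧_) (sym (trans (cong (sub P s ∧_) (dis-∅ s)) (∧-true (sub P s)))))
  (cnt-between P (∅ n) r i (trans (dis-comm P (∅ n)) (dis-∅ P)) (trans (cong (λ m → ∣ P ∣ + m + r) (∣∅∣ n)) (trans (cong (_+ r) (+-identityʳ ∣ P ∣)) e)))
  where
  ∅ : ∀ n → Vec Bool n
  ∅ zero    = []
  ∅ (suc n) = false ∷ ∅ n
  dis-∅ : ∀ {n} (s : Vec Bool n) → dis (∅ n) s ≡ true
  dis-∅ []      = refl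
  dis-∅ (x ∷ s) = dis-∅ s
  ∣∅∣ : ∀ n → ∣ ∅ n ∣ ≡ 0
  ∣∅∣ zero    = refl
  ∣∅∣ (suc n) = ∣∅∣ n
  ∧-true : ∀ b → b ∧ true ≡ b
  ∧-true true  = refl
  ∧-true false = refl

-- Bounds for the degree of false ∷ T, where T avoids a set A of the family that does not contain the element 0.
module Avoiding {m} (t i r : ℕ) (f : Fam (suc m)) (em : t + (2 + (t + i)) + suc r ≡ m) (u : Uniform (2 + (t + i)) f) (int : Intersects f)
  (A T : Vec Bool m) (iA : f ∋ false ∷ A) (eT : ∣ T ∣ ≡ t) (dA : dis A T ≡ true) where

  open ≤-Reasoning

  k : ℕ
  k = 2 + (t + i)

  f₁ f₀ avA : Fam m
  f₁ s = f (true ∷ s)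
  f₀ s = f (false ∷ s)
  avA s = level (t + suc i) s ∧ (sub T s ∧ dis A s)

  cnt-avA : cnt avA ≡ binom (suc r) (suc i)
  cnt-avA = subst (λ t → cnt (λ s → level (t + suc i) s ∧ (sub T s ∧ dis A s)) ≡ binom (suc r) (suc i)) eT
    (cnt-between T A (suc r) (suc i) (trans (dis-comm T A) dA) (trans (cong₂ (λ x y → x + y + suc r) eT (u _ iA)) em))

  cnt-⊇T : cnt (λ s → level (t + suc i) s ∧ sub T s) ≡ binom (k + suc r) (suc i)
  cnt-⊇T = subst (λ t′ → cnt (λ s → level (t′ + suc i) s ∧ sub T s) ≡ binom (k + suc r) (suc i)) eT
    (cnt-level-⊇ T (k + suc r) (suc i) (trans (cong (_+ (k + suc r)) eT) (trans (sym (+-assoc t k (suc r))) em)))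

  inLevel : ∀ {s} → f₁ ∋ s → level (t + suc i) s ≡ true
  inLevel {s} p = subst (λ x → (x ≡ᵇ t + suc i) ≡ true) (suc-injective (trans (cong suc (+-suc t i)) (sym (u _ p)))) (≡ᵇ-refl (t + suc i))

  clash : ∀ B → f₀ ∋ B → ∀ {s} → f₁ ∋ s → dis B s ≡ true → ⊥
  clash B iB {s} p q = contradiction (trans (sym q) (int (false ∷ B) (true ∷ s) iB p)) λ ()

  meets : ∀ (P B s : Vec Bool m) → level (t + suc i) s ∧ (sub P s ∧ dis B s) ≡ true → sub P s ≡ true × dis B s ≡ true
  meets P B s q = ∧-projˡ (∧-projʳ {level (t + suc i) s} q) , ∧-projʳ {sub P s} (∧-projʳ {level (t + suc i) s} q)

  -- Three disjoint families of (k-1)-sets containing T: the link of 0, the sets missing A, and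
  -- further sets `avB` excluded from the link for another reason.
  bound-of : ∀ (avB : Fam m) → (∀ s → avB ∋ s → level (t + suc i) s ≡ true × sub T s ≡ true) →
    (∀ s → f₁ ∋ s → avB ∋ s → ⊥) → (∀ s → dis A s ≡ true → avB ∋ s → ⊥) →
    deg f₁ T + binom (suc r) (suc i) + cnt avB ≤ binom (k + suc r) (suc i)
  bound-of avB p q₁ q₂ = begin
    deg f₁ T + binom (suc r) (suc i) + cnt avB     ≡⟨ cong (λ x → deg f₁ T + x + cnt avB) cnt-avA ⟨
    deg f₁ T + cnt avA + cnt avB                   ≤⟨ +-monoˡ-≤ (cnt avB) (cnt-∨ (λ s → f₁ s ∧ sub T s) avA (λ s a b → clash A iA (∧-projˡ {f₁ s} a) (proj₂ (meets T A s b)))) ⟩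
    cnt (λ s → (f₁ s ∧ sub T s) ∨ avA s) + cnt avB ≤⟨ cnt-∨ (λ s → (f₁ s ∧ sub T s) ∨ avA s) avB (λ s → ∨-elim
                                                        (λ a → q₁ s (∧-projˡ a)) (λ a → q₂ s (proj₂ (meets T A s a)))) ⟩
    cnt (λ s → ((f₁ s ∧ sub T s) ∨ avA s) ∨ avB s) ≤⟨ cnt-mono (λ s → ∨-elim (∨-elim
                                                        (λ a → ∧-intro (inLevel (∧-projˡ a)) (∧-projʳ {f₁ s} a))
                                                        (λ a → ∧-intro (∧-projˡ {level (t + suc i) s} a) (proj₁ (meets T A s a))))
                                                        (λ a → ∧-intro (proj₁ (p s a)) (proj₂ (p s a)))) ⟩
    cnt (λ s → level (t + suc i) s ∧ sub T s)      ≡⟨ cnt-⊇T ⟩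
    binom (k + suc r) (suc i)                      ∎

  bound-single : 1 ≤ t → (∀ s → f₀ ∋ s → sub A s ≡ true) → deg f (false ∷ T) + binom (suc r) (suc i) ≤ binom (k + suc r) (suc i)
  bound-single t≥1 contains = begin
    deg f₁ T + deg f₀ T + binom (suc r) (suc i)          ≡⟨ cong (λ x → deg f₁ T + x + binom (suc r) (suc i)) no₀ ⟩
    deg f₁ T + 0 + binom (suc r) (suc i)                 ≡⟨ reorder (deg f₁ T) (binom (suc r) (suc i)) ⟩
    deg f₁ T + binom (suc r) (suc i) + 0                 ≡⟨ cong (deg f₁ T + binom (suc r) (suc i) +_) (sumV-zero m) ⟨
    deg f₁ T + binom (suc r) (suc i) + cnt {m} (λ _ → false) ≤⟨ bound-of (λ _ → false) (λ _ ()) (λ _ _ ()) (λ _ _ ()) ⟩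
    binom (k + suc r) (suc i)                            ∎
    where
    reorder : ∀ a b → a + 0 + b ≡ a + b + 0
    reorder = solve-∀
    no₀ : deg f₀ T ≡ 0
    no₀ = n<1⇒n≡0 (≰⇒> λ pos → let s , i = cnt-∃ (λ s → f₀ s ∧ sub T s) pos in
      contradiction (begin
        suc k           ≡⟨ +-comm 1 k ⟩
        k + 1           ≤⟨ +-monoʳ-≤ k t≥1 ⟩
        k + t           ≡⟨ cong₂ _+_ (u _ iA) eT ⟨
        ∣ A ∣ + ∣ T ∣   ≤⟨ ∣∣-sub-dis A T s (contains s (∧-projˡ i)) (∧-projʳ {f₀ s} i) dA ⟩
        ∣ s ∣           ≡⟨ u _ (∧-projˡ i) ⟩
        k               ∎) 1+n≰n)

  -- The threshold C(r, i) is exactly the number of (k-1)-sets that contain the t + 1 points of P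
  -- and miss B. These nonmembers of the link compensate for all of `f₀`.
  bound-two : ∀ B → f₀ ∋ B → sub A B ≡ false → dis B T ≡ true → cnt f₀ ≤ binom r i →
    deg f (false ∷ T) + binom (suc r) (suc i) ≤ binom (k + suc r) (suc i)
  bound-two B iB A⊈B dB γ-small with extend A B T A⊈B dA dB
  ... | P , eP′ , subTP , dBP , dAP = begin
    deg f₁ T + deg f₀ T + binom (suc r) (suc i)  ≤⟨ +-monoˡ-≤ (binom (suc r) (suc i)) (+-monoʳ-≤ (deg f₁ T) (≤-trans (cnt-mono {f = λ s → f₀ s ∧ sub T s} {g = f₀} (λ s → ∧-projˡ)) γ-small)) ⟩
    deg f₁ T + binom r i + binom (suc r) (suc i) ≡⟨ reorder (deg f₁ T) (binom r i) (binom (suc r) (suc i)) ⟩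
    deg f₁ T + binom (suc r) (suc i) + binom r i ≡⟨ cong (deg f₁ T + binom (suc r) (suc i) +_) cnt-avB ⟨
    deg f₁ T + binom (suc r) (suc i) + cnt avB   ≤⟨ bound-of avB (λ s b → ∧-projˡ {level (t + suc i) s} b , sub-trans T P s subTP (proj₁ (meets P B s b)))
                                                      (λ s a b → clash B iB a (proj₂ (meets P B s b)))
                                                      (λ s a b → contradiction (trans (sym a) (dis-sub A P s dAP (proj₁ (meets P B s b)))) λ ()) ⟩
    binom (k + suc r) (suc i)                    ∎
    where
    reorder : ∀ a b c → a + b + c ≡ a + c + b
    reorder = solve-∀
    eP : ∣ P ∣ ≡ suc t
    eP = trans eP′ (cong suc eT)
    avB : Fam m
    avB s = level (t + suc i) s ∧ (sub P s ∧ dis B s)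
    cnt-avB : cnt avB ≡ binom r i
    cnt-avB = subst (λ a → cnt (λ s → level a s ∧ (sub P s ∧ dis B s)) ≡ binom r i) (trans (cong (_+ i) eP) (sym (+-suc t i)))
      (cnt-between P B r i (trans (dis-comm P B) dBP) (trans (cong₂ (λ x y → x + y + r) eP (u _ iB)) (trans (sym (+-suc (t + k) r)) em)))

few : ∀ {m} t i r (f : Fam (suc m)) → let k = 2 + (t + i) in 1 ≤ t → t + k + suc r ≡ m → k + k + t ≤ m → Uniform k f → Intersects f →
  1 ≤ cnt (λ s → f (false ∷ s)) → cnt (λ s → f (false ∷ s)) ≤ binom r i →
  ∃ λ T → ∣ T ∣ ≡ t × deg f T + binom (suc r) (suc i) ≤ binom (k + suc r) (suc i)
few {m} t i r f t≥1 em room u int pos γ-small with cnt-∃ (λ s → f (false ∷ s)) pos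
... | A , iA with search (λ s → f (false ∷ s) ∧ not (sub A s))
...   | inj₂ none = case (avoid t A (subst (λ a → a + t ≤ m) (sym (u _ iA)) (≤-trans (+-monoˡ-≤ t (m≤m+n k k)) room)))
  where
  k : ℕ
  k = 2 + (t + i)
  contains : ∀ s → f ∋ false ∷ s → sub A s ≡ true
  contains s p with sub A s in e
  ... | true  = refl
  ... | false = ⊥-elim (none s (∧-intro p (cong not e)))
  case : (∃ λ T → ∣ T ∣ ≡ t × dis A T ≡ true) → ∃ λ T → ∣ T ∣ ≡ t × deg f T + binom (suc r) (suc i) ≤ binom (k + suc r) (suc i)
  case (T , eT , d) = false ∷ T , eT , Avoiding.bound-single t i r f em u int A T iA eT d t≥1 contains
...   | inj₁ (B , iB) = case (avoid t (A ∪ B) (≤-trans (+-monoˡ-≤ t (≤-trans (∣∪∣≤ A B) (≤-reflexive (cong₂ _+_ (u _ iA) (u _ (∧-projˡ iB)))))) room))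
  where
  case : (∃ λ T → ∣ T ∣ ≡ t × dis (A ∪ B) T ≡ true) → ∃ λ T → ∣ T ∣ ≡ t × deg f T + binom (suc r) (suc i) ≤ binom (2 + (t + i) + suc r) (suc i)
  case (T , eT , d) = false ∷ T , eT , Avoiding.bound-two t i r f em u int A T iA eT (proj₁ (dis-∪ A B T d))
    B (∧-projˡ iB) (not-true (∧-projʳ {f (false ∷ B)} iB)) (proj₂ (dis-∪ A B T d)) γ-small


-- Numerical estimates

≤-by : ∀ {x y} r → x + r ≡ y → x ≤ y
≤-by {x} r e = ≤-trans (m≤m+n x r) (≤-reflexive e)

-- The inequalities down to `averaging-many₄` are written in slack variables (here i = t + b and d =
-- 2 t + c) for which the difference of the sides has nonnegative coefficients. That difference is
-- the remainder spelled out in `identity`.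
diversity-inequality : ∀ t b c → (1 + (t + (t + b))) * (t + (t + b)) * (2 + (t + (t + b)) + (2 * t + c)) ≤ (2 + (t + b)) * ((1 + (t + (t + b)) + (2 * t + c)) * ((t + (t + b)) + (2 * t + c)))
diversity-inequality t b c = ≤-by _ (identity t b c)
  where
  identity : ∀ t b c → (1 + (t + (t + b))) * (t + (t + b)) * (2 + (t + (t + b)) + (2 * t + c)) + (c * (2 + c * 2) + b * (c * (4 + c) + b * c) + t * (4 + c * (15 + c) + b * (7 + c * 6 + b) + t * (20 + c * 4 + b * 4))) ≡ (2 + (t + b)) * ((1 + (t + (t + b)) + (2 * t + c)) * ((t + (t + b)) + (2 * t + c)))
  identity = solve-∀

base-inequality : ∀ q d → (10 + d + 2 * q) * ((2 + d) * ((3 + d) * (4 + d))) ≤ (1 + d) * (5 + d + q) * ((7 + d + q) * (8 + d + q))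
base-inequality q d = ≤-by _ (identity q d)
  where
  identity : ∀ q d → (10 + d + 2 * q) * ((2 + d) * ((3 + d) * (4 + d))) + (40 + d * (127 + d * (35 + d * 2)) + q * (83 + d * (119 + d * (25 + d)) + q * (20 + d * (23 + d * 3) + q * (1 + d)))) ≡ (1 + d) * (5 + d + q) * ((7 + d + q) * (8 + d + q))
  identity = solve-∀

step-inequality : ∀ t b d → (d + 5 * suc t + 3 + 2 * b) * ((d + 2 * suc t + 3) * (d + 2 * suc t + 2)) ≤ (d + 2 * suc t + 1 + b) * ((d + 5 * suc t + 4 + b) * (d + 5 * suc t + 3 + b))
step-inequality t b d = ≤-by _ (identity t b d)
  where
  identity : ∀ t b d → (d + 5 * suc t + 3 + 2 * b) * ((d + 2 * suc t + 3) * (d + 2 * suc t + 2)) + (56 + d * (31 + d * 3) + b * (83 + d * (22 + d) + b * (20 + d * 3 + b)) + t * (155 + d * (54 + d * 3) + b * (113 + d * 16 + b * 12) + t * (123 + d * 21 + b * 37 + t * 30))) ≡ (d + 2 * suc t + 1 + b) * ((d + 5 * suc t + 4 + b) * (d + 5 * suc t + 3 + b))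
  identity = solve-∀

-- With t = 1, k = 30 + a and d = 5 + b this reads n (n-k-1) ≤ (d-2) (n-k-1 + (k-1) (k-2)). For
-- large k and fixed d the sides grow like 2 k² and (d-2) k², so d = 5 leaves room.
averaging-one : ∀ a b → (65 + 2 * a + b) * (34 + a + b) ≤ (3 + b) * (34 + a + b + (29 + a) * (28 + a))
averaging-one a b = ≤-by _ (identity a b)
  where
  identity : ∀ a b → (65 + 2 * a + b) * (34 + a + b) + (328 + b * 750 + a * (41 + b * 55 + a * (1 + b))) ≡ (3 + b) * (34 + a + b + (29 + a) * (28 + a))
  identity = solve-∀

averaging-many₁ : ∀ a y → (7 * (2 + a) + 7 + y + (2 + a) + 1 + 2 * (2 + a)) * (7 * (2 + a) + 7 + y + (2 + a) + 1) ≤ (7 * (2 + a) + 7 + y + (2 + a) + 1 + 4 * (2 + a)) * (7 * (2 + a) + 7 + y)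
averaging-many₁ a y = ≤-by _ (identity a y)
  where
  identity : ∀ a y → (7 * (2 + a) + 7 + y + (2 + a) + 1 + 2 * (2 + a)) * (7 * (2 + a) + 7 + y + (2 + a) + 1) + (y + a * (12 + y + a * 4)) ≡ (7 * (2 + a) + 7 + y + (2 + a) + 1 + 4 * (2 + a)) * (7 * (2 + a) + 7 + y)
  identity = solve-∀

averaging-many₂ : ∀ τ y → (τ + y + suc τ) * (τ + y + τ) ≤ (1 + (τ + y)) * (1 + (τ + y) + 3 * suc τ)
averaging-many₂ τ y = ≤-by _ (identity τ y)
  where
  identity : ∀ τ y → (τ + y + suc τ) * (τ + y + τ) + (4 + y * 4 + τ * (6 + y)) ≡ (1 + (τ + y)) * (1 + (τ + y) + 3 * suc τ)
  identity = solve-∀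

averaging-many₃ : ∀ τ b c → (12 + 12 * τ + c + 2 * (10 + τ + b) + 6 * suc τ) * (10 + τ + b + τ + (12 + 12 * τ + c)) ≤ (8 + 8 * τ + c) * (10 + τ + b + τ + (12 + 12 * τ + c) + (10 + τ + b + τ) * (9 + τ + b))
averaging-many₃ τ b c = ≤-by _ (identity τ b c)
  where
  identity : ∀ τ b c → (12 + 12 * τ + c + 2 * (10 + τ + b) + 6 * suc τ) * (10 + τ + b + τ + (12 + 12 * τ + c)) + (60 + c * 60 + b * (78 + c * 17 + b * (6 + c)) + τ * (260 + c * 16 + b * (136 + c * 3 + b * 8) + τ * (72 + c * 2 + b * 24 + τ * 16))) ≡ (8 + 8 * τ + c) * (10 + τ + b + τ + (12 + 12 * τ + c) + (10 + τ + b + τ) * (9 + τ + b))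
  identity = solve-∀

averaging-many₄ : ∀ τ y e → (2 * suc τ + y) * e + suc τ * (2 * (2 * suc τ + y + suc τ) + (e + 4 * suc τ) + 2 * suc τ) ≤ (2 * suc τ + y + suc τ) * (e + 4 * suc τ)
averaging-many₄ τ y e = ≤-by _ (identity τ y e)
  where
  identity : ∀ τ y e → (2 * suc τ + y) * e + suc τ * (2 * (2 * suc τ + y + suc τ) + (e + 4 * suc τ) + 2 * suc τ) + (y * 2 + τ * y * 2) ≡ (2 * suc τ + y + suc τ) * (e + 4 * suc τ)
  identity = solve-∀


-- Throughout, the parameters n, k, t are encoded by τ, i, d as t = τ + 1, k = t + 2 + i and n = 2 k + d. This is
--   n (n−1) (n−2) (k−t) (n−k−1) + t (n−1) (n−2) W ≤ k (n−t) d W,  W = (n−t−1) (n−k−1 + (k−1) (k−t−1)).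
record AveragingInequality (τ i d : ℕ) : Set where
  constructor avg
  field
    holds : (6 + 2 * (τ + i) + d) * ((5 + 2 * (τ + i) + d) * (4 + 2 * (τ + i) + d)) * ((2 + i) * (2 + (τ + i) + d))
            + suc τ * ((5 + 2 * (τ + i) + d) * (4 + 2 * (τ + i) + d)) * ((4 + τ + 2 * i + d) * (2 + (τ + i) + d + (2 + (τ + i)) * (1 + i)))
            ≤ (3 + (τ + i)) * (5 + τ + 2 * i + d) * d * ((4 + τ + 2 * i + d) * (2 + (τ + i) + d + (2 + (τ + i)) * (1 + i)))

averaging-assemble : ∀ n E I m v x p q w e t k d → E ≤ v * p → p * n ≤ q * x → q * m ≤ e * w → I * e + t * p ≤ k * d →
  n * E * (I * m) + t * E * (x * w) ≤ k * v * d * (x * w)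
averaging-assemble n E I m v x p q w e t k d h₁ h₂ h₃ h₄ = begin
  n * E * (I * m) + t * E * (x * w)              ≤⟨ +-mono-≤ (*-monoˡ-≤ (I * m) (*-monoʳ-≤ n h₁)) (*-monoˡ-≤ (x * w) (*-monoʳ-≤ t h₁)) ⟩
  n * (v * p) * (I * m) + t * (v * p) * (x * w)  ≡⟨ cong (_+ t * (v * p) * (x * w)) (l₁ n v p I m) ⟩
  v * I * m * (p * n) + t * (v * p) * (x * w)    ≤⟨ +-monoˡ-≤ _ (*-monoʳ-≤ (v * I * m) h₂) ⟩
  v * I * m * (q * x) + t * (v * p) * (x * w)    ≡⟨ cong (_+ t * (v * p) * (x * w)) (l₂ v I m q x) ⟩
  v * I * x * (q * m) + t * (v * p) * (x * w)    ≤⟨ +-monoˡ-≤ _ (*-monoʳ-≤ (v * I * x) h₃) ⟩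
  v * I * x * (e * w) + t * (v * p) * (x * w)    ≡⟨ l₃ v I x e w t p ⟩
  v * (x * w) * (I * e + t * p)                  ≤⟨ *-monoʳ-≤ (v * (x * w)) h₄ ⟩
  v * (x * w) * (k * d)                          ≡⟨ l₄ v (x * w) k d ⟩
  k * v * d * (x * w)                            ∎
  where
  open ≤-Reasoning
  l₁ : ∀ n v p I m → n * (v * p) * (I * m) ≡ v * I * m * (p * n)
  l₁ = solve-∀
  l₂ : ∀ v I m q x → v * I * m * (q * x) ≡ v * I * x * (q * m)
  l₂ = solve-∀
  l₃ : ∀ v I x e w t p → v * I * x * (e * w) + t * (v * p) * (x * w) ≡ v * (x * w) * (I * e + t * p)
  l₃ = solve-∀
  l₄ : ∀ v y k d → v * y * (k * d) ≡ k * v * d * y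
  l₄ = solve-∀

-- For t = 1 common factors cancel, and k d = (k-1) (d-2) + (n-2) reduces the rest to the first
-- hypothesis.
averaging-assemble-one : ∀ n y x j c m w k d → n * m ≤ c * w → j * c + y ≡ k * d →
  n * (x * y) * (j * m) + 1 * (x * y) * (y * w) ≤ k * x * d * (y * w)
averaging-assemble-one n y x j c m w k d h e = begin
  n * (x * y) * (j * m) + 1 * (x * y) * (y * w) ≡⟨ r₁ n x y j m w ⟩
  x * y * (j * (n * m) + y * w)                 ≤⟨ *-monoʳ-≤ (x * y) (+-monoˡ-≤ (y * w) (*-monoʳ-≤ j h)) ⟩
  x * y * (j * (c * w) + y * w)                 ≡⟨ r₂ x y j c w ⟩
  x * y * w * (j * c + y)                       ≡⟨ cong (x * y * w *_) e ⟩
  x * y * w * (k * d)                           ≡⟨ r₃ x y w k d ⟩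
  k * x * d * (y * w)                           ∎
  where
  open ≤-Reasoning
  r₁ : ∀ n x y j m w → n * (x * y) * (j * m) + 1 * (x * y) * (y * w) ≡ x * y * (j * (n * m) + y * w)
  r₁ = solve-∀
  r₂ : ∀ x y j c w → x * y * (j * (c * w) + y * w) ≡ x * y * w * (j * c + y)
  r₂ = solve-∀
  r₃ : ∀ x y w k d → x * y * w * (k * d) ≡ k * x * d * (y * w)
  r₃ = solve-∀

averaging-inequality-one : ∀ i d a b → 27 + a ≡ i → 5 + b ≡ d → AveragingInequality 0 i d
averaging-inequality-one i d a b ei ed = avg (averaging-assemble-one (6 + 2 * (0 + i) + d) (4 + 2 * (0 + i) + d) (5 + 2 * (0 + i) + d) (2 + i) (3 + b)
  (2 + (0 + i) + d) (2 + (0 + i) + d + (2 + (0 + i)) * (1 + i)) (3 + (0 + i)) d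
  (subst₂ _≤_ (cong₂ _*_ (trans (l₁ a b) (cong₂ (λ i d → 6 + 2 * (0 + i) + d) ei ed)) (trans (l₂ a b) (cong₂ (λ i d → 2 + (0 + i) + d) ei ed)))
    (cong ((3 + b) *_) (cong₂ _+_ (trans (l₂ a b) (cong₂ (λ i d → 2 + (0 + i) + d) ei ed)) (cong₂ _*_ (cong (λ i → 2 + (0 + i)) ei) (cong suc ei)))) (averaging-one a b))
  (trans (l₄ i b d ed) (cong ((3 + (0 + i)) *_) ed)))
  where
  l₁ : ∀ a b → 65 + 2 * a + b ≡ 6 + 2 * (0 + (27 + a)) + (5 + b)
  l₁ = solve-∀
  l₂ : ∀ a b → 34 + a + b ≡ 2 + (0 + (27 + a)) + (5 + b)
  l₂ = solve-∀
  l₅ : ∀ i b → (2 + i) * (3 + b) + (4 + 2 * (0 + i) + (5 + b)) ≡ (3 + (0 + i)) * (5 + b)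
  l₅ = solve-∀
  l₄ : ∀ i b d → 5 + b ≡ d → (2 + i) * (3 + b) + (4 + 2 * (0 + i) + d) ≡ (3 + (0 + i)) * (5 + b)
  l₄ i b d ed = trans (cong (λ d → (2 + i) * (3 + b) + (4 + 2 * (0 + i) + d)) (sym ed)) (l₅ i b)

-- Intermediate factors n + 2 t and n + 4 t separate the estimate into (n-1) (n-2) ≤ (n-t) (n+2t),
-- (n+2t) n ≤ (n+4t) (n-t-1), (n+4t) (n-k-1) ≤ (d-4t) (n-k-1 + (k-1) (k-t-1)) and (k-t) (d-4t) + t
-- (n+2t) ≤ k d. The last one amounts to 3 t ≤ k.
averaging-inequality-many : ∀ τ i d a b c y → suc a ≡ τ → 8 + τ + b ≡ i → 2 * suc τ + y ≡ 2 + i → 12 + 12 * τ + c ≡ d → AveragingInequality τ i d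
averaging-inequality-many τ i d a b c y ea ei ey ed = avg (averaging-assemble (6 + 2 * (τ + i) + d) ((5 + 2 * (τ + i) + d) * (4 + 2 * (τ + i) + d)) (2 + i) (2 + (τ + i) + d) (5 + τ + 2 * i + d) (4 + τ + 2 * i + d)
    (6 + 2 * (τ + i) + d + 2 * suc τ) (6 + 2 * (τ + i) + d + 4 * suc τ) (2 + (τ + i) + d + (2 + (τ + i)) * (1 + i)) (8 + 8 * τ + c) (suc τ) (3 + (τ + i)) d
    (subst₂ _≤_ (e₁ τ i d) (e₂ τ i d) (averaging-many₂ τ (4 + 2 * i + d)))
    (subst₂ _≤_ (cong (λ n → (n + 2 * suc τ) * n) (e₃ τ i d)) (cong (λ n → (n + 4 * suc τ) * (4 + τ + 2 * i + d)) (e₃ τ i d))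
      (second a τ (4 + τ + 2 * i + d) ea big))
    (subst₂ _≤_ (trans (cong₂ (λ i d → (d + 2 * (2 + i) + 6 * suc τ) * ((2 + i) + τ + d)) ei ed) (e₅ τ i d))
                (trans (cong₂ (λ i d → (8 + 8 * τ + c) * (2 + i + τ + d + (2 + i + τ) * (1 + i))) ei ed) (cong ((8 + 8 * τ + c) *_) (e₆ τ i d)))
      (averaging-many₃ τ b c))
    (subst₂ _≤_ (cong₂ (λ I x → I * (8 + 8 * τ + c) + suc τ * x) ey (trans (cong₂ (λ I d → 2 * (I + suc τ) + d + 2 * suc τ) ey e-def) (e₇ τ i d)))
                (cong₂ _*_ (trans (cong (_+ suc τ) ey) (e₈ τ i)) e-def)
      (averaging-many₄ τ y (8 + 8 * τ + c))))
  where
  e-def : (8 + 8 * τ + c) + 4 * suc τ ≡ d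
  e-def = trans (lemma τ c) ed
    where
    lemma : ∀ τ c → 8 + 8 * τ + c + 4 * suc τ ≡ 12 + 12 * τ + c
    lemma = solve-∀
  e₁ : ∀ τ i d → (τ + (4 + 2 * i + d) + suc τ) * (τ + (4 + 2 * i + d) + τ) ≡ (5 + 2 * (τ + i) + d) * (4 + 2 * (τ + i) + d)
  e₁ = solve-∀
  e₂ : ∀ τ i d → (1 + (τ + (4 + 2 * i + d))) * (1 + (τ + (4 + 2 * i + d)) + 3 * suc τ) ≡ (5 + τ + 2 * i + d) * (6 + 2 * (τ + i) + d + 2 * suc τ)
  e₂ = solve-∀
  e₃ : ∀ τ i d → 4 + τ + 2 * i + d + suc τ + 1 ≡ 6 + 2 * (τ + i) + d
  e₃ = solve-∀
  e₅ : ∀ τ i d → (d + 2 * (2 + i) + 6 * suc τ) * ((2 + i) + τ + d) ≡ (6 + 2 * (τ + i) + d + 4 * suc τ) * (2 + (τ + i) + d)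
  e₅ = solve-∀
  e₆ : ∀ τ i d → 2 + i + τ + d + (2 + i + τ) * (1 + i) ≡ 2 + (τ + i) + d + (2 + (τ + i)) * (1 + i)
  e₆ = solve-∀
  e₇ : ∀ τ i d → 2 * (2 + i + suc τ) + d + 2 * suc τ ≡ 6 + 2 * (τ + i) + d + 2 * suc τ
  e₇ = solve-∀
  e₈ : ∀ τ i → 2 + i + suc τ ≡ 3 + (τ + i)
  e₈ = solve-∀
  big : 7 * suc τ + 7 ≤ (4 + τ + 2 * i + d)
  big = ≤-trans (≤-trans (≤-by (5 * τ) (lemma τ)) (m≤n+m _ 2)) (≤-trans (+-monoʳ-≤ 4 (≤-trans (m≤m+n (12 + 12 * τ) c) (≤-reflexive ed))) (≤-by (τ + 2 * i) (lemma₂ τ i d)))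
    where
    lemma : ∀ τ → 7 * suc τ + 7 + 5 * τ ≡ 14 + 12 * τ
    lemma = solve-∀
    lemma₂ : ∀ τ i d → 4 + d + (τ + 2 * i) ≡ 4 + τ + 2 * i + d
    lemma₂ = solve-∀
  second : ∀ a τ x → suc a ≡ τ → 7 * suc τ + 7 ≤ x → (x + suc τ + 1 + 2 * suc τ) * (x + suc τ + 1) ≤ (x + suc τ + 1 + 4 * suc τ) * x
  second a .(suc a) x refl le with m≤n⇒∃[o]m+o≡n le
  ... | o , refl = averaging-many₁ a o

-- The hypotheses in terms of i = k - t - 2 and d = n - 2 k: k ≥ 30 with t = 1 becomes i ≥ 27, and t
-- ≤ k/4 - 2 becomes i ≥ 3 t + 6.
Range : ℕ → ℕ → ℕ → Set
Range τ i d = (τ ≡ 0 × 27 ≤ i × 5 ≤ d) ⊎ (1 ≤ τ × 3 * suc τ + 6 ≤ i × 14 * suc τ ≤ d)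

averaging-inequality : ∀ τ i d → Range τ i d → AveragingInequality τ i d
averaging-inequality τ i d (inj₁ (refl , hi , hd)) =
  averaging-inequality-one i d (i ∸ 27) (d ∸ 5) (m+[n∸m]≡n hi) (m+[n∸m]≡n hd)
averaging-inequality τ i d (inj₂ (hτ , hi , hd)) = averaging-inequality-many τ i d (τ ∸ 1) (i ∸ (8 + τ)) (d ∸ (12 + 12 * τ)) (2 + i ∸ 2 * suc τ)
  (m+[n∸m]≡n hτ) (m+[n∸m]≡n {8 + τ} (≤-trans (≤-by (1 + 2 * τ) (l₁ τ)) hi))
  (m+[n∸m]≡n {2 * suc τ} (≤-trans (≤-by (7 + τ) (l₂ τ)) (≤-trans hi (m≤n+m i 2)))) (m+[n∸m]≡n {12 + 12 * τ} (≤-trans (≤-by (2 + 2 * τ) (l₃ τ)) hd))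
  where
  l₁ : ∀ τ → 8 + τ + (1 + 2 * τ) ≡ 3 * suc τ + 6
  l₁ = solve-∀
  l₂ : ∀ τ → 2 * suc τ + (7 + τ) ≡ 3 * suc τ + 6
  l₂ = solve-∀
  l₃ : ∀ τ → 12 + 12 * τ + (2 + 2 * τ) ≡ 14 * suc τ
  l₃ = solve-∀


-- Comparisons between binomial coefficients

binom-step′ : ∀ {n} e k → e + k ≡ n → suc k * binom n (suc k) ≡ e * binom n k
binom-step′ e k refl = binom-step e k

binom-sucˡ′ : ∀ {n} e k → e + k ≡ n → suc e * binom (suc n) k ≡ suc n * binom n k
binom-sucˡ′ e k refl = binom-sucˡ e k

binom-sucˡ-twice : ∀ {n} e k → e + k ≡ n → (2 + e) * (1 + e) * binom (2 + n) k ≡ (2 + n) * (1 + n) * binom n k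
binom-sucˡ-twice {n} e k eq = begin
  (2 + e) * (1 + e) * binom (2 + n) k   ≡⟨ lemma (2 + e) (1 + e) (binom (2 + n) k) ⟩
  (1 + e) * ((2 + e) * binom (2 + n) k) ≡⟨ cong ((1 + e) *_) (binom-sucˡ′ (1 + e) k (cong suc eq)) ⟩
  (1 + e) * ((2 + n) * binom (1 + n) k) ≡⟨ lemma (2 + n) (1 + e) (binom (1 + n) k) ⟨
  (2 + n) * (1 + e) * binom (1 + n) k   ≡⟨ *-assoc (2 + n) (1 + e) _ ⟩
  (2 + n) * ((1 + e) * binom (1 + n) k) ≡⟨ cong ((2 + n) *_) (binom-sucˡ′ e k eq) ⟩
  (2 + n) * ((1 + n) * binom n k)       ≡⟨ *-assoc (2 + n) (1 + n) _ ⟨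
  (2 + n) * (1 + n) * binom n k         ∎
  where
  open ≡-Reasoning
  lemma : ∀ x y z → x * y * z ≡ y * (x * z)
  lemma = solve-∀

binom-trinomial : ∀ t m j → binom (t + m) (t + j) * binom (t + j) t ≡ binom (t + m) t * binom m j
binom-trinomial zero    m j = trans (*-identityʳ (binom m j)) (sym (*-identityˡ (binom m j)))
binom-trinomial (suc t) m j = *-cancelˡ-≡ _ _ (suc t) (begin
  suc t * (M′ * binom (suc (t + j)) (suc t))               ≡⟨ l₁ (suc t) M′ (binom (suc (t + j)) (suc t)) ⟩
  M′ * (suc t * binom (suc (t + j)) (suc t))               ≡⟨ cong (M′ *_) (binom-absorb (t + j) t) ⟩
  M′ * (suc (t + j) * binom (t + j) t)                     ≡⟨ l₂ M′ (suc (t + j)) (binom (t + j) t) ⟩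
  suc (t + j) * M′ * binom (t + j) t                       ≡⟨ cong (_* binom (t + j) t) (binom-absorb (t + m) (t + j)) ⟩
  suc (t + m) * binom (t + m) (t + j) * binom (t + j) t    ≡⟨ *-assoc (suc (t + m)) (binom (t + m) (t + j)) (binom (t + j) t) ⟩
  suc (t + m) * (binom (t + m) (t + j) * binom (t + j) t)  ≡⟨ cong (suc (t + m) *_) (binom-trinomial t m j) ⟩
  suc (t + m) * (binom (t + m) t * binom m j)              ≡⟨ *-assoc (suc (t + m)) (binom (t + m) t) (binom m j) ⟨
  suc (t + m) * binom (t + m) t * binom m j                ≡⟨ cong (_* binom m j) (binom-absorb (t + m) t) ⟨
  suc t * binom (suc (t + m)) (suc t) * binom m j          ≡⟨ *-assoc (suc t) (binom (suc (t + m)) (suc t)) (binom m j) ⟩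
  suc t * (binom (suc (t + m)) (suc t) * binom m j)        ∎)
  where
  open ≡-Reasoning
  M′ : ℕ
  M′ = binom (suc (t + m)) (suc (t + j))
  l₁ : ∀ x y z → x * (y * z) ≡ y * (x * z)
  l₁ = solve-∀
  l₂ : ∀ x y z → x * (y * z) ≡ y * x * z
  l₂ = solve-∀

-- Bernoulli's inequality for the quotient C(A + j − i, j) / C(A + j, j) of i factors, each at most A / (A + j).
binom-bernoulli : ∀ j A i e → e + i ≡ A → binom (e + j) j * (A + i * j) ≤ binom (A + j) j * A
binom-bernoulli j A zero    e eq rewrite trans (sym (+-identityʳ e)) eq = ≤-reflexive (cong (binom (A + j) j *_) (+-identityʳ A))
binom-bernoulli j A (suc i) e eq = *-cancelˡ-≤ (suc (e + j)) (begin
  suc (e + j) * (binom (e + j) j * (A + suc i * j))     ≡⟨ *-assoc (suc (e + j)) (binom (e + j) j) (A + suc i * j) ⟨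
  suc (e + j) * binom (e + j) j * (A + suc i * j)       ≡⟨ cong (_* (A + suc i * j)) (binom-sucˡ e j) ⟨
  suc e * B * (A + (j + i * j))                         ≡⟨ l₁ (suc e) B A j (i * j) ⟩
  B * (suc e * (A + i * j) + suc e * j)                 ≤⟨ *-monoʳ-≤ B (+-monoʳ-≤ (suc e * (A + i * j)) (*-monoˡ-≤ j (≤-trans (≤-trans (m≤m+n (suc e) i) (≤-reflexive eq′)) (m≤m+n A (i * j))))) ⟩
  B * (suc e * (A + i * j) + (A + i * j) * j)           ≡⟨ l₂ B e (A + i * j) j ⟩
  suc (e + j) * (B * (A + i * j))                       ≤⟨ *-monoʳ-≤ (suc (e + j)) (binom-bernoulli j A i (suc e) eq′) ⟩
  suc (e + j) * (binom (A + j) j * A)                   ∎)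
  where
  open ≤-Reasoning
  B : ℕ
  B = binom (suc (e + j)) j
  eq′ : suc e + i ≡ A
  eq′ = trans (sym (+-suc e i)) eq
  l₁ : ∀ x B A j y → x * B * (A + (j + y)) ≡ B * (x * (A + y) + x * j)
  l₁ = solve-∀
  l₂ : ∀ B e y j → B * (suc e * y + y * j) ≡ suc (e + j) * (B * y)
  l₂ = solve-∀

binom-suc-≤ : ∀ e j → 4 * j ≤ suc e → 4 * binom (suc (e + j)) j ≤ 5 * binom (e + j) j
binom-suc-≤ e j le = *-cancelˡ-≤ (suc e) (begin
  suc e * (4 * binom (suc (e + j)) j)   ≡⟨ l₁ (suc e) 4 (binom (suc (e + j)) j) ⟩
  4 * (suc e * binom (suc (e + j)) j)   ≡⟨ cong (4 *_) (binom-sucˡ e j) ⟩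
  4 * (suc (e + j) * binom (e + j) j)   ≡⟨ l₂ e j (binom (e + j) j) ⟩
  (4 * suc e + 4 * j) * binom (e + j) j ≤⟨ *-monoˡ-≤ (binom (e + j) j) (+-monoʳ-≤ (4 * suc e) le) ⟩
  (4 * suc e + suc e) * binom (e + j) j ≡⟨ l₃ (suc e) (binom (e + j) j) ⟩
  suc e * (5 * binom (e + j) j)         ∎)
  where
  open ≤-Reasoning
  l₁ : ∀ x y z → x * (y * z) ≡ y * (x * z)
  l₁ = solve-∀
  l₂ : ∀ e j b → 4 * (suc (e + j) * b) ≡ (4 * suc e + 4 * j) * b
  l₂ = solve-∀
  l₃ : ∀ x b → (4 * x + x) * b ≡ x * (5 * b)
  l₃ = solve-∀

-- Each of three points added above costs a factor of at most 5/4, raising the lower index gains a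
-- factor of at least 4, and (5/4)³ = 125/64 is less than 4.
binom-diagonal : ∀ W j → 5 * suc j ≤ W → binom (3 + W) j ≤ binom W (suc j)
binom-diagonal W j le = *-cancelˡ-≤ 64 (begin
  64 * B₃                  ≡⟨ *-assoc 16 4 B₃ ⟩
  16 * (4 * B₃)            ≤⟨ *-monoʳ-≤ 16 (up 2) ⟩
  16 * (5 * B₂)            ≡⟨ swap₁ B₂ ⟩
  20 * (4 * B₂)            ≤⟨ *-monoʳ-≤ 20 (up 1) ⟩
  20 * (5 * B₁)            ≡⟨ swap₂ B₁ ⟩
  25 * (4 * B₁)            ≤⟨ *-monoʳ-≤ 25 (up 0) ⟩
  25 * (5 * B₀)            ≡⟨ *-assoc 25 5 B₀ ⟨
  125 * B₀                 ≤⟨ *-monoˡ-≤ B₀ (m≤m+n 125 131) ⟩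
  256 * B₀                 ≡⟨ *-assoc 64 4 B₀ ⟩
  64 * (4 * B₀)            ≤⟨ *-monoʳ-≤ 64 last ⟩
  64 * binom W (suc j)     ∎)
  where
  open ≤-Reasoning
  B₀ B₁ B₂ B₃ e : ℕ
  B₀ = binom W j
  B₁ = binom (1 + W) j
  B₂ = binom (2 + W) j
  B₃ = binom (3 + W) j
  e = W ∸ j
  j≤W : j ≤ W
  j≤W = ≤-trans (≤-trans (n≤1+n j) (m≤m+n (suc j) (4 * suc j))) le
  e+j : e + j ≡ W
  e+j = m∸n+n≡m j≤W
  4j≤e : 4 * suc j ≤ e
  4j≤e = +-cancelʳ-≤ (suc j) _ _ (begin
    4 * suc j + suc j ≡⟨ +-comm (4 * suc j) (suc j) ⟩
    5 * suc j         ≤⟨ le ⟩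
    W                 ≡⟨ e+j ⟨
    e + j             ≤⟨ +-monoʳ-≤ e (n≤1+n j) ⟩
    e + suc j         ∎)
  up : ∀ x → 4 * binom (suc (x + W)) j ≤ 5 * binom (x + W) j
  up x = subst (λ w → 4 * binom (suc w) j ≤ 5 * binom w j) (trans (+-assoc x e j) (cong (x +_) e+j))
    (binom-suc-≤ (x + e) j (≤-trans (*-monoʳ-≤ 4 (n≤1+n j)) (≤-trans 4j≤e (m≤n⇒m≤1+n (m≤n+m e x)))))
  last : 4 * B₀ ≤ binom W (suc j)
  last = *-cancelˡ-≤ (suc j) (begin
    suc j * (4 * B₀)        ≡⟨ *-assoc (suc j) 4 B₀ ⟨
    suc j * 4 * B₀          ≡⟨ cong (_* B₀) (*-comm (suc j) 4) ⟩
    4 * suc j * B₀          ≤⟨ *-monoˡ-≤ B₀ 4j≤e ⟩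
    e * B₀                  ≡⟨ binom-step′ e j e+j ⟨
    suc j * binom W (suc j) ∎)
  swap₁ : ∀ b → 16 * (5 * b) ≡ 20 * (4 * b)
  swap₁ b = trans (sym (*-assoc 16 5 b)) (*-assoc 20 4 b)
  swap₂ : ∀ b → 20 * (5 * b) ≡ 25 * (4 * b)
  swap₂ b = trans (sym (*-assoc 20 5 b)) (*-assoc 25 4 b)

binom-diagonals : ∀ s W j → 5 * (s + j) ≤ W → binom (3 * s + W) j ≤ binom W (s + j)
binom-diagonals zero    W j le = ≤-refl
binom-diagonals (suc s) W j le = begin
  binom (3 * suc s + W) j      ≡⟨ cong (λ m → binom m j) (lemma s W) ⟩
  binom (3 + (3 * s + W)) j    ≤⟨ binom-diagonal (3 * s + W) j (≤-trans (*-monoʳ-≤ 5 (s≤s (m≤n+m j s))) (≤-trans le (m≤n+m W _))) ⟩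
  binom (3 * s + W) (suc j)    ≤⟨ binom-diagonals s W (suc j) (≤-trans (≤-reflexive (cong (5 *_) (+-suc s j))) le) ⟩
  binom W (s + suc j)          ≡⟨ cong (binom W) (+-suc s j) ⟩
  binom W (suc s + j)          ∎
  where
  open ≤-Reasoning
  lemma : ∀ s W → 3 * suc s + W ≡ 3 + (3 * s + W)
  lemma = solve-∀

binom-unimodal-half : ∀ n x y → x ≤ y → y + y ≤ n → binom n x ≤ binom n y
binom-unimodal-half n x y x≤y le with m≤n⇒m<n∨m≡n x≤y
... | inj₂ refl = ≤-refl
binom-unimodal-half n x (suc y) x≤y le | inj₁ (s≤s x≤y′) = ≤-trans (binom-unimodal-half n x y x≤y′ (≤-trans (+-mono-≤ (n≤1+n y) (n≤1+n y)) le))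
  (*-cancelˡ-≤ (suc y) (≤-trans (*-monoˡ-≤ (binom n y) bound) (≤-reflexive (sym (binom-step′ (n ∸ y) y (m∸n+n≡m y≤n))))))
  where
  y≤n : y ≤ n
  y≤n = ≤-trans (n≤1+n y) (≤-trans (m≤m+n (suc y) (suc y)) le)
  bound : suc y ≤ n ∸ y
  bound = +-cancelʳ-≤ y _ _ (≤-trans (+-monoʳ-≤ (suc y) (n≤1+n y)) (≤-trans le (≤-reflexive (sym (m∸n+n≡m y≤n)))))

binom-unimodal : ∀ d i c → c ≤ i → c ≤ d → binom (d + i) c ≤ binom (d + i) i
binom-unimodal d i c c≤i c≤d with ≤-total i d
... | inj₁ i≤d = binom-unimodal-half (d + i) c i c≤i (+-monoˡ-≤ i i≤d)
... | inj₂ d≤i = ≤-trans (binom-unimodal-half (d + i) c d c≤d (+-monoʳ-≤ d d≤i)) (≤-reflexive (binom-sym (d + i) d i refl))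

-- Each of t + 1 diagonal moves trades three points above for one below, which leads from 2 t + 1 to
-- 3 t + 2; unimodality then reaches i.
threshold : ∀ t r i d → d + i ≡ r → 3 * t + 2 ≤ i → 3 * t + 2 ≤ d → 5 * (3 * t + 2) ≤ r → binom (3 * t + 2 + r) (1 + 2 * t) ≤ binom r i
threshold t _ i d refl hi hd hr = begin
  binom (3 * t + 2 + r) (1 + 2 * t)   ≤⟨ binom-mono (1 + 2 * t) (+-monoˡ-≤ r (≤-by 1 (l₁ t))) ⟩
  binom (3 * suc t + r) (1 + 2 * t)   ≤⟨ binom-diagonals (suc t) r (1 + 2 * t) (≤-trans (≤-reflexive (cong (5 *_) (l₂ t))) hr) ⟩
  binom r (suc t + (1 + 2 * t))       ≡⟨ cong (binom r) (l₂ t) ⟩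
  binom r (3 * t + 2)                 ≤⟨ binom-unimodal d i (3 * t + 2) hi hd ⟩
  binom r i                           ∎
  where
  open ≤-Reasoning
  r : ℕ
  r = d + i
  l₁ : ∀ t → 3 * t + 2 + 1 ≡ 3 * suc t
  l₁ = solve-∀
  l₂ : ∀ t → suc t + (1 + 2 * t) ≡ 3 * t + 2
  l₂ = solve-∀

binom-1 : ∀ n → binom n 1 ≡ n
binom-1 zero    = refl
binom-1 (suc n) = cong suc (binom-1 n)

shadow-ratio-base : ∀ q d → 4 ≤ q → 1 ≤ d →
  suc (d + q) * binom (1 + d + 2 * q) 1 * binom (d + q) q ≤ d * binom (d + q) 1 * binom (3 + (d + q)) q
shadow-ratio-base q d hq hd = subst₂ (λ x y → suc (d + q) * x * G ≤ d * y * G₃) (sym (binom-1 (1 + d + 2 * q))) (sym (binom-1 (d + q)))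
  (*-cancelʳ-≤ _ _ ((1 + d) * ((2 + d) * (3 + d))) (begin
  suc (d + q) * (1 + d + 2 * q) * G * ((1 + d) * ((2 + d) * (3 + d)))   ≡⟨ l₁ (suc (d + q)) (1 + d + 2 * q) G ((1 + d) * ((2 + d) * (3 + d))) ⟩
  suc (d + q) * G * ((1 + d + 2 * q) * ((1 + d) * ((2 + d) * (3 + d)))) ≤⟨ *-monoʳ-≤ (suc (d + q) * G) (numeric (m≤n⇒∃[o]m+o≡n hq) (m≤n⇒∃[o]m+o≡n hd)) ⟩
  suc (d + q) * G * (d * (d + q) * ((2 + (d + q)) * (3 + (d + q))))     ≡⟨ cong (_* (d * (d + q) * ((2 + (d + q)) * (3 + (d + q))))) (binom-sucˡ d q) ⟨
  suc d * G₁ * (d * (d + q) * ((2 + (d + q)) * (3 + (d + q))))          ≡⟨ l₂ (suc d) G₁ (d * (d + q)) (2 + (d + q)) (3 + (d + q)) ⟩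
  d * (d + q) * (suc d * ((3 + (d + q)) * (2 + (d + q)) * G₁))          ≡⟨ cong (λ x → d * (d + q) * (suc d * x)) (binom-sucˡ-twice (suc d) q refl) ⟨
  d * (d + q) * (suc d * ((3 + d) * (2 + d) * G₃))                      ≡⟨ l₃ (d * (d + q)) (suc d) (3 + d) (2 + d) G₃ ⟩
  d * (d + q) * G₃ * ((1 + d) * ((2 + d) * (3 + d)))                    ∎))
  where
  open ≤-Reasoning
  G G₁ G₃ : ℕ
  G = binom (d + q) q
  G₁ = binom (1 + (d + q)) q
  G₃ = binom (3 + (d + q)) q
  l₁ : ∀ s n g x → s * n * g * x ≡ s * g * (n * x)
  l₁ = solve-∀
  l₂ : ∀ s g x y z → s * g * (x * (y * z)) ≡ x * (s * (z * y * g))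
  l₂ = solve-∀
  l₃ : ∀ x s z y g → x * (s * (z * y * g)) ≡ x * g * (s * (y * z))
  l₃ = solve-∀
  e₁ : ∀ q d → 10 + d + 2 * q ≡ 1 + (1 + d) + 2 * (4 + q)
  e₁ = solve-∀
  numeric : (∃ λ o → 4 + o ≡ q) → (∃ λ o → 1 + o ≡ d) → (1 + d + 2 * q) * ((1 + d) * ((2 + d) * (3 + d))) ≤ d * (d + q) * ((2 + (d + q)) * (3 + (d + q)))
  numeric (q′ , eq) (d′ , ed) = subst₂ _≤_
    (cong₂ _*_ (trans (e₁ q′ d′) (cong₂ (λ q d → 1 + d + 2 * q) eq ed)) (cong (λ d → (1 + d) * ((2 + d) * (3 + d))) ed))
    (cong₂ _*_ (cong₂ _*_ ed (sum 0)) (cong₂ _*_ (sum 2) (sum 3))) (base-inequality q′ d′)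
    where
    sum : ∀ x → x + 5 + d′ + q′ ≡ x + (d + q)
    sum x = trans (lemma x q′ d′) (cong₂ (λ q d → x + (d + q)) eq ed)
      where
      lemma : ∀ x q d → x + 5 + d + q ≡ x + (1 + d + (4 + q))
      lemma = solve-∀

-- Raising t by one multiplies the left side by (n-1-t) / (t+1) and the coefficient of t on the
-- right by (n-k-1-t) / (t+1). The two extra points in the last coefficient make up for the
-- difference, by `step-inequality`.
shadow-ratio : ∀ q d τ → 4 ≤ q → 1 ≤ d → 3 * τ + 1 ≤ q →
  suc (d + q) * binom (1 + d + 2 * q) (suc τ) * binom (d + q) q ≤ d * binom (d + q) (suc τ) * binom (2 * suc τ + suc (d + q)) q
shadow-ratio q d zero    hq hd hτ = shadow-ratio-base q d hq hd
shadow-ratio q d (suc τ) hq hd hτ = *-cancelʳ-≤ _ _ (suc t * ((2 + e) * (1 + e))) (begin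
  suc (d + q) * c₁′ * G * (suc t * ((2 + e) * (1 + e)))        ≡⟨ l₁ (suc (d + q)) c₁′ G (suc t) ((2 + e) * (1 + e)) ⟩
  suc (d + q) * (suc t * c₁′) * G * ((2 + e) * (1 + e))        ≡⟨ cong (λ x → suc (d + q) * x * G * ((2 + e) * (1 + e))) (binom-step′ u t u-def) ⟩
  suc (d + q) * (u * c₁) * G * ((2 + e) * (1 + e))             ≡⟨ l₂ (suc (d + q)) u c₁ G ((2 + e) * (1 + e)) ⟩
  suc (d + q) * c₁ * G * (u * ((2 + e) * (1 + e)))             ≤⟨ *-mono-≤ (shadow-ratio q d τ hq hd (≤-trans (+-monoˡ-≤ 1 (*-monoʳ-≤ 3 (n≤1+n τ))) hτ)) numeric ⟩
  d * c₂ * C₀ * (v * ((2 + n) * (1 + n)))                      ≡⟨ l₃ d c₂ C₀ v ((2 + n) * (1 + n)) ⟩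
  d * (v * c₂) * ((2 + n) * (1 + n) * C₀)                      ≡⟨ cong₂ (λ x y → d * x * y) (binom-step′ v t v-def) (binom-sucˡ-twice e q e-def) ⟨
  d * (suc t * c₂′) * ((2 + e) * (1 + e) * binom (2 + n) q)    ≡⟨ l₄ d (suc t) c₂′ ((2 + e) * (1 + e)) (binom (2 + n) q) ⟩
  d * c₂′ * binom (2 + n) q * (suc t * ((2 + e) * (1 + e)))    ≡⟨ cong (λ m → d * c₂′ * binom m q * (suc t * ((2 + e) * (1 + e)))) (l₅ t (suc (d + q))) ⟩
  d * c₂′ * binom (2 * suc t + suc (d + q)) q * (suc t * ((2 + e) * (1 + e))) ∎)
  where
  open ≤-Reasoning
  t b e n u v G c₁ c₁′ c₂ c₂′ C₀ : ℕ
  t = suc τ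
  b = q ∸ (3 * t + 1)
  e = d + 2 * t + 1
  n = 2 * t + suc (d + q)
  u = d + 5 * t + 3 + 2 * b
  v = d + 2 * t + 1 + b
  G = binom (d + q) q
  c₁ = binom (1 + d + 2 * q) t
  c₁′ = binom (1 + d + 2 * q) (suc t)
  c₂ = binom (d + q) t
  c₂′ = binom (d + q) (suc t)
  C₀ = binom n q
  q-def : 3 * t + 1 + b ≡ q
  q-def = m+[n∸m]≡n hτ
  u-def : u + t ≡ 1 + d + 2 * q
  u-def = trans (lemma t b d) (cong (λ q → 1 + d + 2 * q) q-def)
    where
    lemma : ∀ t b d → d + 5 * t + 3 + 2 * b + t ≡ 1 + d + 2 * (3 * t + 1 + b)
    lemma = solve-∀
  v-def : v + t ≡ d + q
  v-def = trans (lemma t b d) (cong (d +_) q-def)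
    where
    lemma : ∀ t b d → d + 2 * t + 1 + b + t ≡ d + (3 * t + 1 + b)
    lemma = solve-∀
  e-def : e + q ≡ n
  e-def = lemma t d q
    where
    lemma : ∀ t d q → d + 2 * t + 1 + q ≡ 2 * t + suc (d + q)
    lemma = solve-∀
  numeric : u * ((2 + e) * (1 + e)) ≤ v * ((2 + n) * (1 + n))
  numeric = subst₂ _≤_ (cong (u *_) (cong₂ _*_ (m₁ (d + 2 * t) 2) (m₁ (d + 2 * t) 1)))
    (cong (v *_) (cong₂ _*_ (trans (m₂ t b d 2) (cong (λ q → 2 + (2 * t + suc (d + q))) q-def)) (trans (m₂ t b d 1) (cong (λ q → 1 + (2 * t + suc (d + q))) q-def))))
    (step-inequality τ b d)
    where
    m₁ : ∀ x y → x + suc y ≡ y + (x + 1)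
    m₁ = solve-∀
    m₂ : ∀ t b d y → d + 5 * t + suc (suc y) + b ≡ y + (2 * t + suc (d + (3 * t + 1 + b)))
    m₂ = solve-∀
  l₁ : ∀ s c g t x → s * c * g * (t * x) ≡ s * (t * c) * g * x
  l₁ = solve-∀
  l₂ : ∀ s u c g x → s * (u * c) * g * x ≡ s * c * g * (u * x)
  l₂ = solve-∀
  l₃ : ∀ d c C v x → d * c * C * (v * x) ≡ d * (v * c) * (x * C)
  l₃ = solve-∀
  l₄ : ∀ d t c x C → d * (t * c) * (x * C) ≡ d * c * C * (t * x)
  l₄ = solve-∀
  l₅ : ∀ t x → 2 + (2 * t + x) ≡ 2 * suc t + x
  l₅ = solve-∀


-- The two averaging computations with binomials as free variables

-- In quotients: P Ck / Cn equals b₁ (1 + t s / (n K)), the family loses at least the fraction s d /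
-- E of P, and b₂ / b₁ ≤ s m / W. So (1 + t s / (n K)) (1 - s d / E) ≤ 1 - s m / W is enough, and
-- `h₈` is this with denominators cleared.
mean-abstract : ∀ α P X Y s d m n E K V k t Ck C′ Cn c b₁ b₂ W →
  α + X ≤ P + Y → X * E ≡ Y * E + P * (s * d) → Ck * K ≡ C′ * k → Cn * V ≡ c * n → P * C′ ≡ c * b₁ → W * b₂ ≤ s * m * b₁ →
  k * V ≡ n * K + t * s → n * E * (K * m) + t * E * W ≤ k * V * d * W → 1 ≤ K * V * (E * W) →
  α * Ck + Cn * b₂ ≤ Cn * b₁
mean-abstract α P X Y s d m n E K V k t Ck C′ Cn c b₁ b₂ W h₁ h₂ h₃ h₄ h₅ h₆ h₇ h₈ pos =
  *-cancelʳ-≤ _ _ (K * V * (E * W)) {{>-nonZero pos}} (+-cancelʳ-≤ (P * (s * d) * Q) _ _ (begin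
    (α * Ck + Cn * b₂) * (K * V * (E * W)) + P * (s * d) * Q                  ≡⟨ cong (_+ P * (s * d) * Q) (r₁ α Ck Cn b₂ K V E W) ⟩
    α * (Ck * K) * (V * (E * W)) + Cn * V * (K * E) * (W * b₂) + P * (s * d) * Q ≡⟨ cong₂ (λ x y → α * x * (V * (E * W)) + y * (K * E) * (W * b₂) + P * (s * d) * Q) h₃ h₄ ⟩
    α * (C′ * k) * (V * (E * W)) + c * n * (K * E) * (W * b₂) + P * (s * d) * Q ≤⟨ +-monoˡ-≤ (P * (s * d) * Q) (+-monoʳ-≤ (α * (C′ * k) * (V * (E * W))) (*-monoʳ-≤ (c * n * (K * E)) h₆)) ⟩
    α * (C′ * k) * (V * (E * W)) + c * n * (K * E) * (s * m * b₁) + P * (s * d) * Q ≡⟨ r₂ α C′ k V E W (c * n * (K * E) * (s * m * b₁)) P (s * d) ⟩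
    (α * E + P * (s * d)) * Q + c * n * (K * E) * (s * m * b₁)                ≤⟨ +-monoˡ-≤ _ (*-monoˡ-≤ Q first) ⟩
    P * E * Q + c * n * (K * E) * (s * m * b₁)                                ≡⟨ cong₂ _+_ (r₃ P E C′ k V W) (r₄ c n K E s m b₁) ⟩
    P * C′ * (E * W * (k * V)) + c * b₁ * (s * (n * E * (K * m)))             ≡⟨ cong₂ (λ x y → x * (E * W * y) + c * b₁ * (s * (n * E * (K * m)))) h₅ h₇ ⟩
    c * b₁ * (E * W * (n * K + t * s)) + c * b₁ * (s * (n * E * (K * m)))     ≡⟨ r₅ (c * b₁) E W n K t s m ⟩
    c * b₁ * (n * (K * (E * W)) + s * (n * E * (K * m) + t * E * W))          ≤⟨ *-monoʳ-≤ (c * b₁) (+-monoʳ-≤ (n * (K * (E * W))) (*-monoʳ-≤ s h₈)) ⟩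
    c * b₁ * (n * (K * (E * W)) + s * (k * V * d * W))                        ≡⟨ *-distribˡ-+ (c * b₁) (n * (K * (E * W))) (s * (k * V * d * W)) ⟩
    c * b₁ * (n * (K * (E * W))) + c * b₁ * (s * (k * V * d * W))             ≡⟨ cong (λ x → c * b₁ * (n * (K * (E * W))) + x * (s * (k * V * d * W))) h₅ ⟨
    c * b₁ * (n * (K * (E * W))) + P * C′ * (s * (k * V * d * W))             ≡⟨ cong₂ _+_ (r₆ c b₁ n (K * (E * W))) (r₇ P C′ s k V d W) ⟩
    c * n * (b₁ * (K * (E * W))) + P * (s * d) * Q                            ≡⟨ cong (λ x → x * (b₁ * (K * (E * W))) + P * (s * d) * Q) h₄ ⟨
    Cn * V * (b₁ * (K * (E * W))) + P * (s * d) * Q                           ≡⟨ cong (_+ P * (s * d) * Q) (r₈ Cn V b₁ K (E * W)) ⟩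
    Cn * b₁ * (K * V * (E * W)) + P * (s * d) * Q                             ∎))
  where
  open ≤-Reasoning
  Q : ℕ
  Q = C′ * k * (V * W)
  first : α * E + P * (s * d) ≤ P * E
  first = +-cancelʳ-≤ (Y * E) _ _ (begin
    α * E + P * (s * d) + Y * E   ≡⟨ +-assoc (α * E) (P * (s * d)) (Y * E) ⟩
    α * E + (P * (s * d) + Y * E) ≡⟨ cong (α * E +_) (trans (+-comm (P * (s * d)) (Y * E)) (sym h₂)) ⟩
    α * E + X * E                 ≡⟨ *-distribʳ-+ E α X ⟨
    (α + X) * E                   ≤⟨ *-monoˡ-≤ E h₁ ⟩
    (P + Y) * E                   ≡⟨ *-distribʳ-+ E P Y ⟩
    P * E + Y * E                 ∎)
  r₁ : ∀ α Ck Cn b K V E W → (α * Ck + Cn * b) * (K * V * (E * W)) ≡ α * (Ck * K) * (V * (E * W)) + Cn * V * (K * E) * (W * b)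
  r₁ = solve-∀
  r₂ : ∀ α C k V E W y P x → α * (C * k) * (V * (E * W)) + y + P * x * (C * k * (V * W)) ≡ (α * E + P * x) * (C * k * (V * W)) + y
  r₂ = solve-∀
  r₃ : ∀ P E C k V W → P * E * (C * k * (V * W)) ≡ P * C * (E * W * (k * V))
  r₃ = solve-∀
  r₄ : ∀ c n K E s m b → c * n * (K * E) * (s * m * b) ≡ c * b * (s * (n * E * (K * m)))
  r₄ = solve-∀
  r₅ : ∀ R E W n K t s m → R * (E * W * (n * K + t * s)) + R * (s * (n * E * (K * m))) ≡ R * (n * (K * (E * W)) + s * (n * E * (K * m) + t * E * W))
  r₅ = solve-∀
  r₆ : ∀ c b n y → c * b * (n * y) ≡ c * n * (b * y)
  r₆ = solve-∀
  r₇ : ∀ P C s k V d W → P * C * (s * (k * V * d * W)) ≡ P * (s * d) * (C * k * (V * W))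
  r₇ = solve-∀
  r₈ : ∀ C V b K y → C * V * (b * (K * y)) ≡ C * b * (K * V * y)
  r₈ = solve-∀

-- The S missing sets, each worth C′, are divided in the proportion k : d, where k + d = s. The
-- first share pays for the γ sets, the second for `c * b₂`.
diversity-abstract : ∀ α γ S P Ck C′ k K c b₁ b₂ s d →
  α + S ≤ P → γ * s ≤ S * K → Ck * K ≡ C′ * k → P * C′ ≡ c * b₁ → s * (c * b₂) ≤ d * (S * C′) → k + d ≡ s → 1 ≤ s → 1 ≤ K →
  α * C′ + γ * Ck + c * b₂ ≤ c * b₁
diversity-abstract α γ S P Ck C′ k K c b₁ b₂ s d h₁ h₂ h₃ h₄ h₅ h₆ s≥1 K≥1 = begin
  α * C′ + γ * Ck + c * b₂   ≡⟨ +-assoc (α * C′) (γ * Ck) (c * b₂) ⟩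
  α * C′ + (γ * Ck + c * b₂) ≤⟨ +-monoʳ-≤ (α * C′) absorbed ⟩
  α * C′ + S * C′            ≡⟨ *-distribʳ-+ C′ α S ⟨
  (α + S) * C′               ≤⟨ *-monoˡ-≤ C′ h₁ ⟩
  P * C′                     ≡⟨ h₄ ⟩
  c * b₁                     ∎
  where
  open ≤-Reasoning
  large : s * (γ * Ck) ≤ k * (S * C′)
  large = *-cancelʳ-≤ _ _ K {{>-nonZero K≥1}} (begin
    s * (γ * Ck) * K     ≡⟨ l₁ s γ Ck K ⟩
    γ * s * (Ck * K)     ≤⟨ *-monoˡ-≤ (Ck * K) h₂ ⟩
    S * K * (Ck * K)     ≡⟨ cong (S * K *_) h₃ ⟩
    S * K * (C′ * k)     ≡⟨ l₂ S K C′ k ⟩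
    k * (S * C′) * K     ∎)
    where
    l₁ : ∀ s γ C K → s * (γ * C) * K ≡ γ * s * (C * K)
    l₁ = solve-∀
    l₂ : ∀ S K C k → S * K * (C * k) ≡ k * (S * C) * K
    l₂ = solve-∀
  absorbed : γ * Ck + c * b₂ ≤ S * C′
  absorbed = *-cancelˡ-≤ s {{>-nonZero s≥1}} (begin
    s * (γ * Ck + c * b₂)          ≡⟨ *-distribˡ-+ s (γ * Ck) (c * b₂) ⟩
    s * (γ * Ck) + s * (c * b₂)    ≤⟨ +-mono-≤ large h₅ ⟩
    k * (S * C′) + d * (S * C′)    ≡⟨ *-distribʳ-+ (S * C′) k d ⟨
    (k + d) * (S * C′)             ≡⟨ cong (_* (S * C′)) h₆ ⟩
    s * (S * C′)                   ∎)

Range-i : ∀ {τ i d} → Range τ i d → 3 * suc τ + 2 ≤ i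
Range-i (inj₁ (refl , hi , hd))    = ≤-trans (m≤n+m 5 22) hi
Range-i {τ} (inj₂ (hτ , hi , hd)) = ≤-trans (+-monoʳ-≤ (3 * suc τ) (m≤n+m 2 4)) hi

Range-d : ∀ {τ i d} → Range τ i d → 3 * suc τ + 2 ≤ d
Range-d (inj₁ (refl , hi , hd))    = hd
Range-d {τ} (inj₂ (hτ , hi , hd)) = ≤-trans (≤-by (9 + 11 * τ) (lemma τ)) hd
  where
  lemma : ∀ τ → 3 * suc τ + 2 + (9 + 11 * τ) ≡ 14 * suc τ
  lemma = solve-∀

Range-d+i : ∀ {τ i d} → Range τ i d → 5 * (3 * suc τ + 2) ≤ d + i
Range-d+i (inj₁ (refl , hi , hd))    = ≤-trans (m≤n+m 25 7) (+-mono-≤ hd hi)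
Range-d+i {τ} (inj₂ (hτ , hi , hd)) = ≤-trans (≤-reflexive (lemma₁ τ))
  (≤-trans (+-monoʳ-≤ (23 + 15 * τ) (*-monoʳ-≤ 2 hτ)) (≤-trans (≤-reflexive (lemma₂ τ)) (+-mono-≤ hd hi)))
  where
  lemma₁ : ∀ τ → 5 * (3 * suc τ + 2) ≡ 23 + 15 * τ + 2 * 1
  lemma₁ = solve-∀
  lemma₂ : ∀ τ → 23 + 15 * τ + 2 * τ ≡ 14 * suc τ + (3 * suc τ + 6)
  lemma₂ = solve-∀

-- Dictionary: κ = k-3, z = n-4, r = n-k-t-2, b₁ = C(n-t-1, k-t-1), b₂ = C(n-t-k-1, k-t-1), P =
-- C(n-1, k-1), c = C(n-1, t), C′ = C(k-1, t).
module Numbers (τ i d : ℕ) (range : Range τ i d) where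

  open ≤-Reasoning

  t κ k z r b₁ b₂ : ℕ
  t = suc τ
  κ = τ + i
  k = 3 + κ
  z = d + (2 + κ) + κ
  r = d + i
  b₁ = binom (k + suc r) (suc i)
  b₂ = binom (suc r) (suc i)

  X Y P c C′ : ℕ
  X = binom (suc z) (2 + κ)
  Y = binom (suc z) (1 + κ)
  P = binom (3 + z) (2 + κ)
  c = binom (3 + z) t
  C′ = binom (2 + κ) t

  C-k : binom k t * (2 + i) ≡ C′ * k
  C-k = trans (*-comm (binom k t) (2 + i)) (trans (binom-sucˡ′ (suc i) t (lemma τ i)) (*-comm k C′))
    where
    lemma : ∀ τ i → suc i + suc τ ≡ 2 + (τ + i)
    lemma = solve-∀

  C-trinomial : P * C′ ≡ c * b₁
  C-trinomial = subst₂ (λ x y → binom x y * binom y t ≡ binom x t * b₁) (l₁ τ i d) (cong suc (+-suc τ i)) (binom-trinomial t (k + suc r) (suc i))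
    where
    l₁ : ∀ τ i d → suc τ + (3 + (τ + i) + suc (d + i)) ≡ 3 + (d + (2 + (τ + i)) + (τ + i))
    l₁ = solve-∀

  mean-bound : ∀ α → α + X ≤ P + Y → α * binom k t + binom (4 + z) t * b₂ ≤ binom (4 + z) t * b₁
  mean-bound α h = mean-abstract α P X Y (3 + (τ + i) + d) d (2 + (τ + i) + d) (6 + 2 * (τ + i) + d) ((5 + 2 * (τ + i) + d) * (4 + 2 * (τ + i) + d))
    (2 + i) (5 + τ + 2 * i + d) (3 + (τ + i)) (suc τ) (binom k t) C′ (binom (4 + z) t) c b₁ b₂
    ((4 + τ + 2 * i + d) * (2 + (τ + i) + d + (2 + (τ + i)) * (1 + i)))
    h loss C-k C-n C-trinomial bernoulli (l₃ τ i d) (AveragingInequality.holds (averaging-inequality τ i d range)) (s≤s z≤n)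
    where
    l₃ : ∀ τ i d → (3 + (τ + i)) * (5 + τ + 2 * i + d) ≡ (6 + 2 * (τ + i) + d) * (2 + i) + suc τ * (3 + (τ + i) + d)
    l₃ = solve-∀
    C-n : binom (4 + z) t * (5 + τ + 2 * i + d) ≡ c * (6 + 2 * (τ + i) + d)
    C-n = trans (*-comm (binom (4 + z) t) _) (trans (binom-sucˡ′ (4 + τ + 2 * i + d) t (l₁ τ i d)) (trans (*-comm (4 + z) c) (cong (c *_) (l₂ τ i d))))
      where
      l₁ : ∀ τ i d → 4 + τ + 2 * i + d + suc τ ≡ 3 + (d + (2 + (τ + i)) + (τ + i))
      l₁ = solve-∀
      l₂ : ∀ τ i d → 4 + (d + (2 + (τ + i)) + (τ + i)) ≡ 6 + 2 * (τ + i) + d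
      l₂ = solve-∀
    E : ℕ
    E = (5 + 2 * (τ + i) + d) * (4 + 2 * (τ + i) + d)
    s m : ℕ
    s = 3 + (τ + i) + d
    m = 2 + (τ + i) + d
    X-P : s * m * P ≡ E * X
    X-P = trans (binom-sucˡ-twice (1 + (τ + i) + d) (2 + κ) (l₁ (τ + i) d)) (cong (_* X) (cong₂ _*_ (l₂ (τ + i) d) (l₂′ (τ + i) d)))
      where
      l₁ : ∀ κ d → 1 + κ + d + (2 + κ) ≡ suc (d + (2 + κ) + κ)
      l₁ = solve-∀
      l₂ : ∀ κ d → 3 + (d + (2 + κ) + κ) ≡ 5 + 2 * κ + d
      l₂ = solve-∀
      l₂′ : ∀ κ d → 2 + (d + (2 + κ) + κ) ≡ 4 + 2 * κ + d
      l₂′ = solve-∀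
    X-Y : (2 + κ) * X ≡ m * Y
    X-Y = binom-step′ m (1 + κ) (l₁ (τ + i) d)
      where
      l₁ : ∀ κ d → 2 + κ + d + (1 + κ) ≡ suc (d + (2 + κ) + κ)
      l₁ = solve-∀
    Y-P : Y * E ≡ (2 + κ) * (s * P)
    Y-P = *-cancelˡ-≡ _ _ m (begin-equality
      m * (Y * E)             ≡⟨ *-assoc m Y E ⟨
      m * Y * E               ≡⟨ cong (_* E) X-Y ⟨
      (2 + κ) * X * E         ≡⟨ l₁ (2 + κ) X E ⟩
      (2 + κ) * (E * X)       ≡⟨ cong ((2 + κ) *_) X-P ⟨
      (2 + κ) * (s * m * P)   ≡⟨ l₂ (2 + κ) s m P ⟩
      m * ((2 + κ) * (s * P)) ∎)
      where
      l₁ : ∀ q x e → q * x * e ≡ q * (e * x)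
      l₁ = solve-∀
      l₂ : ∀ q s m p → q * (s * m * p) ≡ m * (q * (s * p))
      l₂ = solve-∀
    -- X and Y are s m P / E and s (κ+2) P / E, and m - (κ+2) = d.
    loss : X * E ≡ Y * E + P * (s * d)
    loss = begin-equality
      X * E                           ≡⟨ *-comm X E ⟩
      E * X                           ≡⟨ X-P ⟨
      s * m * P                       ≡⟨ l₁ s (2 + (τ + i)) d P ⟩
      (2 + κ) * (s * P) + P * (s * d) ≡⟨ cong (_+ P * (s * d)) Y-P ⟨
      Y * E + P * (s * d)             ∎
      where
      l₁ : ∀ s q d p → s * (q + d) * p ≡ q * (s * p) + p * (s * d)
      l₁ = solve-∀
    -- Of the k factors of b₂ / b₁, the first one, s / (n-t-1), is kept exact, and Bernoulli's
    -- inequality bounds the other k - 1.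
    bernoulli : (4 + τ + 2 * i + d) * (m + (2 + (τ + i)) * (1 + i)) * b₂ ≤ s * m * b₁
    bernoulli = begin
      (4 + τ + 2 * i + d) * (m + (2 + κ) * (1 + i)) * b₂      ≡⟨ l₁ (4 + τ + 2 * i + d) (m + (2 + κ) * (1 + i)) b₂ ⟩
      (4 + τ + 2 * i + d) * (b₂ * (m + (2 + κ) * (1 + i)))    ≡⟨ cong (λ x → (4 + τ + 2 * i + d) * (binom x (suc i) * (m + (2 + κ) * (1 + i)))) (+-suc d i) ⟨
      (4 + τ + 2 * i + d) * (binom (d + suc i) (suc i) * (m + (2 + κ) * suc i)) ≤⟨ *-monoʳ-≤ (4 + τ + 2 * i + d) (binom-bernoulli (suc i) m (2 + κ) d (l₂ (τ + i) d)) ⟩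
      (4 + τ + 2 * i + d) * (B * m)                           ≡⟨ l₁′ (4 + τ + 2 * i + d) B m ⟩
      (4 + τ + 2 * i + d) * B * m                             ≡⟨ cong (λ x → x * B * m) (l₃′ τ i d) ⟩
      suc (m + suc i) * B * m                                 ≡⟨ cong (_* m) (binom-sucˡ m (suc i)) ⟨
      s * binom (suc (m + suc i)) (suc i) * m                 ≡⟨ cong (λ x → s * binom x (suc i) * m) (l₄ τ i d) ⟩
      s * b₁ * m                                              ≡⟨ l₁″ s b₁ m ⟩
      s * m * b₁                                              ∎
      where
      B : ℕ
      B = binom (m + suc i) (suc i)
      l₁ : ∀ x y z → x * y * z ≡ x * (z * y)
      l₁ = solve-∀
      l₁′ : ∀ x y z → x * (y * z) ≡ x * y * z
      l₁′ = solve-∀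
      l₁″ : ∀ x y z → x * y * z ≡ x * z * y
      l₁″ = solve-∀
      l₂ : ∀ κ d → d + (2 + κ) ≡ 2 + κ + d
      l₂ = solve-∀
      l₃′ : ∀ τ i d → 4 + τ + 2 * i + d ≡ suc (2 + (τ + i) + d + suc i)
      l₃′ = solve-∀
      l₄ : ∀ τ i d → suc (2 + (τ + i) + d + suc i) ≡ 3 + (τ + i) + suc (d + i)
      l₄ = solve-∀

  q Z : ℕ
  q = 2 + κ
  Z = 2 * t + suc (d + q)

  Z-r : 3 * t + 2 + r ≡ Z
  Z-r = lemma τ i d
    where
    lemma : ∀ τ i d → 3 * suc τ + 2 + (d + i) ≡ 2 * suc τ + suc (d + (2 + (τ + i)))
    lemma = solve-∀

  -- Z = n - k + 2 t is chosen so that a diversity above C(r, i) is at least C(Z, d + q) = C(Z, 2 t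
  -- + 1); Kruskal-Katona then gives a shadow of at least C(Z, k-1) sets.
  low-diversity : binom Z (d + q) ≤ binom r i
  low-diversity = begin
    binom Z (d + q)                   ≡⟨ binom-sym Z (d + q) (1 + 2 * t) (lemma (d + q) t) ⟩
    binom Z (1 + 2 * t)               ≡⟨ cong (λ m → binom m (1 + 2 * t)) Z-r ⟨
    binom (3 * t + 2 + r) (1 + 2 * t) ≤⟨ threshold t r i d refl (Range-i range) (Range-d range) (Range-d+i range) ⟩
    binom r i                         ∎
    where
    lemma : ∀ x t → x + (1 + 2 * t) ≡ 2 * t + suc x
    lemma = solve-∀

  t≤i : t ≤ i
  t≤i = ≤-trans (≤-by (2 * t + 2) (lemma t)) (Range-i range)
    where
    lemma : ∀ t → t + (2 * t + 2) ≡ 3 * t + 2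
    lemma = solve-∀

  2t≤d : 2 * t ≤ d
  2t≤d = ≤-trans (≤-by (t + 2) (lemma t)) (Range-d range)
    where
    lemma : ∀ t → 2 * t + (t + 2) ≡ 3 * t + 2
    lemma = solve-∀

  -- Here C(z, κ) / C(z, κ+2) equals N / M, and `diversity-inequality` bounds this by (k-t) / (n-k),
  -- the ratio that the proportional division of S requires.
  diversity-shadow : ∀ γ S → γ * binom z (2 + κ) ≤ S * binom z κ → γ * (3 + κ + d) ≤ S * (2 + i)
  diversity-shadow γ S h = *-cancelʳ-≤ _ _ M (begin
    γ * (3 + κ + d) * M     ≡⟨ l₁ γ (3 + κ + d) M ⟩
    γ * M * (3 + κ + d)     ≤⟨ *-monoˡ-≤ (3 + κ + d) ratio ⟩
    S * N * (3 + κ + d)     ≡⟨ *-assoc S N (3 + κ + d) ⟩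
    S * (N * (3 + κ + d))   ≤⟨ *-monoʳ-≤ S numeric ⟩
    S * ((2 + i) * M)       ≡⟨ *-assoc S (2 + i) M ⟨
    S * (2 + i) * M         ∎)
    where
    M N U V₀ : ℕ
    M = (2 + κ + d) * (1 + κ + d)
    N = (2 + κ) * (1 + κ)
    U = binom z (2 + κ)
    V₀ = binom z κ
    l₁ : ∀ x y z → x * y * z ≡ x * z * y
    l₁ = solve-∀
    numeric : N * (3 + κ + d) ≤ (2 + i) * M
    numeric = subst₂ (λ i d → (1 + (t + i)) * (t + i) * (2 + (t + i) + d) ≤ (2 + i) * ((1 + (t + i) + d) * (t + i + d)))
      (m+[n∸m]≡n t≤i) (m+[n∸m]≡n {2 * t} 2t≤d) (diversity-inequality t (i ∸ t) (d ∸ 2 * t))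
    up : N * U ≡ M * V₀
    up = begin-equality
      N * U                                   ≡⟨ l₂ (2 + κ) (1 + κ) U ⟩
      (1 + κ) * ((2 + κ) * U)                 ≡⟨ cong ((1 + κ) *_) (binom-step′ (1 + κ + d) (1 + κ) (l₃ κ d)) ⟩
      (1 + κ) * ((1 + κ + d) * binom z (1 + κ)) ≡⟨ l₄ (1 + κ) (1 + κ + d) (binom z (1 + κ)) ⟩
      (1 + κ + d) * ((1 + κ) * binom z (1 + κ)) ≡⟨ cong ((1 + κ + d) *_) (binom-step′ (2 + κ + d) κ (l₅ κ d)) ⟩
      (1 + κ + d) * ((2 + κ + d) * V₀)        ≡⟨ l₂ (2 + κ + d) (1 + κ + d) V₀ ⟨
      M * V₀                                  ∎
      where
      l₂ : ∀ x y z → x * y * z ≡ y * (x * z)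
      l₂ = solve-∀
      l₃ : ∀ κ d → 1 + κ + d + (1 + κ) ≡ d + (2 + κ) + κ
      l₃ = solve-∀
      l₄ : ∀ x y z → x * (y * z) ≡ y * (x * z)
      l₄ = solve-∀
      l₅ : ∀ κ d → 2 + κ + d + κ ≡ d + (2 + κ) + κ
      l₅ = solve-∀
    ratio : γ * M ≤ S * N
    ratio = *-cancelʳ-≤ _ _ V₀ {{>-nonZero (binom-pos z κ (m≤n+m κ (d + (2 + κ))))}} (begin
      γ * M * V₀    ≡⟨ *-assoc γ M V₀ ⟩
      γ * (M * V₀)  ≡⟨ cong (γ *_) up ⟨
      γ * (N * U)   ≡⟨ l₂ γ N U ⟩
      N * (γ * U)   ≤⟨ *-monoʳ-≤ N h ⟩
      N * (S * V₀)  ≡⟨ l₃ N S V₀ ⟩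
      S * N * V₀    ∎)
      where
      l₂ : ∀ x y z → x * (y * z) ≡ y * (x * z)
      l₂ = solve-∀
      l₃ : ∀ x y z → x * (y * z) ≡ y * x * z
      l₃ = solve-∀

  -- After multiplication by C(n-k-1, t), the trinomial identity trades b₂ for C(n-k-1, k-1) C′, and
  -- `shadow-ratio` remains.
  removed-bound : ∀ S → binom Z q ≤ S → (3 + κ + d) * (c * b₂) ≤ d * (S * C′)
  removed-bound S h = *-cancelʳ-≤ _ _ CT {{>-nonZero (binom-pos (d + q) t (≤-trans (s≤s (≤-trans (m≤m+n τ i) (n≤1+n (τ + i)))) (m≤n+m q d)))}} (begin
    (3 + κ + d) * (c * b₂) * CT     ≡⟨ l₁ (3 + κ + d) c b₂ CT ⟩
    (3 + κ + d) * c * (CT * b₂)     ≡⟨ cong ((3 + κ + d) * c *_) trinomial ⟨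
    (3 + κ + d) * c * (G * C′)      ≡⟨ *-assoc ((3 + κ + d) * c) G C′ ⟨
    (3 + κ + d) * c * G * C′        ≡⟨ cong₂ (λ x y → x * binom y t * G * C′) (l₂ κ d) (l₃ κ d) ⟩
    suc (d + q) * binom (1 + d + 2 * q) t * G * C′ ≤⟨ *-monoˡ-≤ C′ (shadow-ratio q d τ q≥4 d≥1 q-large) ⟩
    d * CT * binom Z q * C′         ≤⟨ *-monoˡ-≤ C′ (*-monoʳ-≤ (d * CT) h) ⟩
    d * CT * S * C′                 ≡⟨ l₄ d CT S C′ ⟩
    d * (S * C′) * CT               ∎)
    where
    CT G : ℕ
    CT = binom (d + q) t
    G = binom (d + q) q
    trinomial : G * C′ ≡ CT * b₂
    trinomial = subst₂ (λ x y → binom x y * binom y t ≡ binom x t * b₂) (lemma τ i d) (cong suc (+-suc τ i)) (binom-trinomial t (suc r) (suc i))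
      where
      lemma : ∀ τ i d → suc τ + suc (d + i) ≡ d + (2 + (τ + i))
      lemma = solve-∀
    q≥4 : 4 ≤ q
    q≥4 = ≤-trans (≤-trans (≤-by (1 + 3 * τ) (lemma τ)) (Range-i range)) (≤-trans (m≤n+m i τ) (m≤n+m κ 2))
      where
      lemma : ∀ τ → 4 + (1 + 3 * τ) ≡ 3 * suc τ + 2
      lemma = solve-∀
    d≥1 : 1 ≤ d
    d≥1 = ≤-trans (s≤s z≤n) (Range-d range)
    q-large : 3 * τ + 1 ≤ q
    q-large = ≤-trans (≤-trans (≤-by 4 (lemma τ)) (Range-i range)) (≤-trans (m≤n+m i τ) (m≤n+m κ 2))
      where
      lemma : ∀ τ → 3 * τ + 1 + 4 ≡ 3 * suc τ + 2
      lemma = solve-∀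
    l₁ : ∀ s c b x → s * (c * b) * x ≡ s * c * (x * b)
    l₁ = solve-∀
    l₂ : ∀ κ d → 3 + κ + d ≡ suc (d + (2 + κ))
    l₂ = solve-∀
    l₃ : ∀ κ d → 3 + (d + (2 + κ) + κ) ≡ 1 + d + 2 * (2 + κ)
    l₃ = solve-∀
    l₄ : ∀ d x S C → d * x * S * C ≡ d * (S * C) * x
    l₄ = solve-∀

  diversity-bound : ∀ α γ S → α + S ≤ P → γ * binom z (2 + κ) ≤ S * binom z κ → binom Z q ≤ S →
    α * C′ + γ * binom k t + c * b₂ ≤ c * b₁
  diversity-bound α γ S h₁ h₂ h₃ = diversity-abstract α γ S P (binom k t) C′ k (2 + i) c b₁ b₂ (3 + κ + d) d h₁ (diversity-shadow γ S h₂)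
    C-k C-trinomial (removed-bound S h₃) refl (s≤s z≤n) (s≤s z≤n)


-- The minimum degree

∁-insertAt : ∀ {n} (s : Vec Bool n) x b → ∁ (insertAt s x b) ≡ insertAt (∁ s) x (not b)
∁-insertAt s x b = map-insertAt not b s x

∧-swap : ∀ a b c → a ∧ (b ∧ c) ≡ b ∧ (a ∧ c)
∧-swap true  b     c = refl
∧-swap false true  c = refl
∧-swap false false c = refl

dis-insertAt : ∀ {n} (s t : Vec Bool n) x b c → dis (insertAt s x b) (insertAt t x c) ≡ dis (b ∷ s) (c ∷ t)
dis-insertAt s       t       zero    b c = refl
dis-insertAt (u ∷ s) (v ∷ t) (suc x) b c = trans (cong (not (u ∧ v) ∧_) (dis-insertAt s t x b c)) (∧-swap (not (u ∧ v)) (not (b ∧ c)) (dis s t))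

sub-insertAt : ∀ {n} (s t : Vec Bool n) x b c → sub (insertAt s x b) (insertAt t x c) ≡ sub (b ∷ s) (c ∷ t)
sub-insertAt s       t       zero    b c = refl
sub-insertAt (u ∷ s) (v ∷ t) (suc x) b c = trans (cong ((not u ∨ v) ∧_) (sub-insertAt s t x b c)) (∧-swap (not u ∨ v) (not b ∨ c) (sub s t))

front-Intersects : ∀ {n} (x : Fin (suc n)) f → Intersects f → Intersects (front x f)
front-Intersects x f int (b ∷ s) (c ∷ t) i j = trans (sym (dis-insertAt s t x b c)) (int _ _ i j)

deg-front : ∀ {n} (x : Fin (suc n)) (f : Fam (suc n)) b T → deg f (insertAt T x b) ≡ deg (front x f) (b ∷ T)
deg-front x f b T = trans (sumV-insertAt x (λ s → 𝟙 (f s ∧ sub (insertAt T x b) s))) (cong₂ _+_ (half true) (half false))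
  where
  half : ∀ c → cnt (λ s → f (insertAt s x c) ∧ sub (insertAt T x b) (insertAt s x c)) ≡ cnt (λ s → f (insertAt s x c) ∧ sub (b ∷ T) (c ∷ s))
  half c = cnt-cong (λ s → cong (f (insertAt s x c) ∧_) (sub-insertAt T s x b c))

dis-∁ : ∀ {n} (A B : Vec Bool n) → dis (∁ A) (∁ B) ≡ false → ∣ A ∪ B ∣ < n
dis-∁ []          []          ()
dis-∁ (true ∷ A)  (b ∷ B)     e = s≤s (dis-∁ A B e)
dis-∁ (false ∷ A) (true ∷ B)  e = s≤s (dis-∁ A B e)
dis-∁ (false ∷ A) (false ∷ B) e = s≤s (∣p∣≤n (A ∪ B))

∁-Uniform : ∀ {n} a k (f : Fam n) → a + k ≡ n → Uniform k f → Uniform a (λ s → f (∁ s))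
∁-Uniform a k f e u s i = +-cancelˡ-≡ k _ _ (trans (cong (_+ ∣ s ∣) (sym (u _ i))) (trans (∣∁∣ s) (trans (sym e) (+-comm a k))))

MinDegree : ∀ {n} → ℕ → ℕ → Fam n → Set
MinDegree t B f = ∃ λ T → ∣ T ∣ ≡ t × deg f T ≤ B

average-level : ∀ {n} t B (g : Vec Bool n → ℕ) → t ≤ n → sumV (λ T → 𝟙 (level t T) * g T) ≤ binom n t * B → ∃ λ T → ∣ T ∣ ≡ t × g T ≤ B
average-level {n} t B g t≤n le with average (level t) g B (≤-trans (binom-pos n t t≤n) (≤-reflexive (sym (cnt-level n t))))
  (≤-trans le (≤-reflexive (cong (_* B) (sym (cnt-level n t)))))
... | T , l , b = T , ≡ᵇ-sound _ t l , b

truncate : ∀ {a} c b₁ b₂ → a + c * b₂ ≤ c * b₁ → a ≤ c * (b₁ ∸ b₂)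
truncate {a} c b₁ b₂ le = ≤-trans (m+n≤o⇒m≤o∸n a le) (≤-reflexive (sym (*-distribˡ-∸ c b₁ b₂)))

module Degrees (τ i d : ℕ) (range : Range τ i d) where

  open Numbers τ i d range

  N : ℕ
  N = 4 + z

  size-split : 1 + (d + q) + k ≡ N
  size-split = lemma d (τ + i)
    where
    lemma : ∀ d κ → 1 + (d + (2 + κ)) + (3 + κ) ≡ 4 + (d + (2 + κ) + κ)
    lemma = solve-∀

  module F = Frankl κ d z refl

  all-diverse : ∀ (f : Fam N) → Uniform k f → Intersects f → (∀ x → binom z κ ≤ mult x (λ s → f (∁ s))) → MinDegree t (b₁ ∸ b₂) f
  all-diverse f u int h = average-level t (b₁ ∸ b₂) (deg f) (≤-trans (≤-trans t≤i (m≤n+m i τ)) (≤-trans (m≤n+m κ (d + q)) (m≤n+m z 4)))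
    (≤-trans (≤-reflexive (sum-deg k t f u)) (truncate (binom N t) b₁ b₂ (mean-bound (cnt f)
      (subst (λ m → m + X ≤ P + Y) (cnt-∁ f)
        (F.frankl (λ s → f (∁ s)) (∁-Uniform (1 + (d + q)) k f size-split u) (λ A B iA iB → ≤-pred (dis-∁ A B (int _ _ iA iB))) h)))))

  -- The average runs over the t-sets avoiding 0: a member through 0 contains C(k-1, t) of them, any
  -- other member C(k, t).
  head-diverse : ∀ (f : Fam N) → Uniform k f → Intersects f → cnt (λ s → f (false ∷ s)) < binom z κ → binom r i < cnt (λ s → f (false ∷ s)) →
    MinDegree t (b₁ ∸ b₂) f
  head-diverse f u int small large = conclude (average-level t (b₁ ∸ b₂) (λ T → deg f (false ∷ T)) (≤-trans (≤-trans t≤i (m≤n+m i τ)) (≤-trans (m≤n+m κ (d + q)) (m≤n+m z 3)))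
    (≤-trans (≤-reflexive total) (truncate c b₁ b₂ (diversity-bound (cnt f₁) (cnt f₀) S cross linear shadow))))
    where
    f₁ f₀ g₁ g₀ : Fam (3 + z)
    f₁ s = f (true ∷ s)
    f₀ s = f (false ∷ s)
    g₁ s = f₀ (∁ s)
    g₀ s = f₁ (∁ s)
    S : ℕ
    S = cnt (shs d g₁)
    u₁ : Uniform q f₁
    u₁ = tail-Uniform q f u
    u₀ : Uniform k f₀
    u₀ s = u (false ∷ s)
    ug₁ : Uniform (d + q) g₁
    ug₁ = ∁-Uniform (d + q) k f₀ (suc-injective size-split) u₀
    ug₀ : Uniform (1 + (d + q)) g₀
    ug₀ = ∁-Uniform (1 + (d + q)) q f₁ (suc-injective (trans (sym (+-suc (1 + (d + q)) q)) size-split)) u₁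
    conclude : (∃ λ T → ∣ T ∣ ≡ t × deg f (false ∷ T) ≤ b₁ ∸ b₂) → MinDegree t (b₁ ∸ b₂) f
    conclude (T , e , b) = false ∷ T , e , b
    total : sumV (λ T → 𝟙 (level t T) * deg f (false ∷ T)) ≡ cnt f₁ * C′ + cnt f₀ * binom k t
    total = trans (sumV-cong (λ T → *-distribˡ-+ (𝟙 (level t T)) (deg f₁ T) (deg f₀ T)))
      (trans (sumV-+ (λ T → 𝟙 (level t T) * deg f₁ T) (λ T → 𝟙 (level t T) * deg f₀ T)) (cong₂ _+_ (sum-deg q t f₁ u₁) (sum-deg k t f₀ u₀)))
    cross : cnt f₁ + S ≤ P
    cross = subst (λ m → m + S ≤ P) (cnt-∁ f₁) (cross-bound d q (1 + (d + q)) g₀ g₁ F.N-split ug₀ ug₁ (λ A B iA iB → dis-∁ A B (int _ _ iA iB)))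
    linear : cnt f₀ * binom z (2 + κ) ≤ S * binom z κ
    linear = subst₂ (λ m x → m * binom z (2 + κ) ≤ S * x) (cnt-∁ f₀) F.sym₀
      (kruskalKatona-linear z d q g₁ ug₁ (≤-trans (≤-reflexive (cnt-∁ f₀)) (≤-trans (<⇒≤ small) (≤-reflexive (sym F.sym₀)))))
    shadow : binom Z q ≤ S
    shadow = kruskalKatona-binom Z d q g₁ ug₁ (≤-trans (n≤1+n (d + q)) (≤-trans (m≤n+m (suc (d + q)) (2 * t)) (n≤1+n Z)))
      (≤-trans (s≤s z≤n) large′) (≤-trans low-diversity (<⇒≤ large′))
      where
      large′ : binom r i < cnt g₁
      large′ = subst (binom r i <_) (sym (cnt-∁ f₀)) large

  head-small : ∀ (f : Fam N) → Uniform k f → Intersects f → 1 ≤ cnt (λ s → f (false ∷ s)) → cnt (λ s → f (false ∷ s)) < binom z κ → MinDegree t (b₁ ∸ b₂) f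
  head-small f u int pos small with cnt (λ s → f (false ∷ s)) ≤? binom r i
  ... | no large = head-diverse f u int small (≰⇒> large)
  ... | yes γ-small = conclude (few t i r f (s≤s z≤n) (l₁ τ i d) room u int pos γ-small)
    where
    l₁ : ∀ τ i d → suc τ + (2 + (suc τ + i)) + suc (d + i) ≡ 3 + (d + (2 + (τ + i)) + (τ + i))
    l₁ = solve-∀
    room : k + k + t ≤ 3 + z
    room = ≤-trans (+-monoʳ-≤ (k + k) t≤d-1) (≤-reflexive (trans (lemma (τ + i) (d ∸ 1)) (cong (λ d → 3 + (d + (2 + κ) + κ)) d-def)))
      where
      d-def : 1 + (d ∸ 1) ≡ d
      d-def = m+[n∸m]≡n (≤-trans (s≤s z≤n) 2t≤d)
      t≤d-1 : t ≤ d ∸ 1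
      t≤d-1 = ≤-pred (≤-trans (≤-trans (≤-by τ (two τ)) 2t≤d) (≤-reflexive (sym d-def)))
        where
        two : ∀ τ → 2 + τ + τ ≡ 2 * suc τ
        two = solve-∀
      lemma : ∀ κ e → 3 + κ + (3 + κ) + e ≡ 3 + (1 + e + (2 + κ) + κ)
      lemma = solve-∀
    conclude : (∃ λ T → ∣ T ∣ ≡ t × deg f T + b₂ ≤ b₁) → MinDegree t (b₁ ∸ b₂) f
    conclude (T , e , b) = T , e , m+n≤o⇒m≤o∸n _ b

  some-diverse : ∀ (f : Fam N) → Uniform k f → Intersects f → (∀ x → 1 ≤ cnt (λ s → f (insertAt s x false))) →
    ∀ x → mult x (λ s → f (∁ s)) < binom z κ → MinDegree t (b₁ ∸ b₂) f
  some-diverse f u int nontrivial x small = conclude (head-small (front x f) (front-Uniform k x f u) (front-Intersects x f int) (nontrivial x) (subst (_< binom z κ) diversity small))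
    where
    diversity : mult x (λ s → f (∁ s)) ≡ cnt (λ s → f (insertAt s x false))
    diversity = trans (mult-insertAt x (λ s → f (∁ s))) (trans (cnt-cong (λ s → cong f (∁-insertAt s x true))) (cnt-∁ (λ s → f (insertAt s x false))))
    conclude : MinDegree t (b₁ ∸ b₂) (front x f) → MinDegree t (b₁ ∸ b₂) f
    conclude (b ∷ T , e , le) = insertAt T x b , trans (∣insertAt∣ T x b) (trans (sym (∣∷∣ b T)) e) , subst (_≤ b₁ ∸ b₂) (sym (deg-front x f b T)) le

  min-degree : ∀ (f : Fam N) → Uniform k f → Intersects f → (∀ x → 1 ≤ cnt (λ s → f (insertAt s x false))) → MinDegree t (b₁ ∸ b₂) f
  min-degree f u int nontrivial with Fin-search {A = λ x → mult x (λ s → f (∁ s)) < binom z κ} {B = λ x → binom z κ ≤ mult x (λ s → f (∁ s))} decide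
    where
    decide : ∀ x → mult x (λ s → f (∁ s)) < binom z κ ⊎ binom z κ ≤ mult x (λ s → f (∁ s))
    decide x with binom z κ ≤? mult x (λ s → f (∁ s))
    ... | yes p = inj₂ p
    ... | no ¬p = inj₁ (≰⇒> ¬p)
  ... | inj₁ (x , small) = some-diverse f u int nontrivial x small
  ... | inj₂ h           = all-diverse f u int h


-- From lists of subsets to Boolean families, and back to n, k, t

binom≡C : ∀ n k → binom n k ≡ n C k
binom≡C n       zero    = refl
binom≡C zero    (suc k) = refl
binom≡C (suc n) (suc k) = trans (cong₂ _+_ (binom≡C n k) (binom≡C n (suc k))) (nCk+nC[k+1]≡[n+1]C[k+1] n k)

_≟ⱽ_ : ∀ {n} (s t : Vec Bool n) → Dec (s ≡ t)
_≟ⱽ_ = ≡-dec Bool._≟_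

does-sound : ∀ {A : Set} (a? : Dec A) → does a? ≡ true → A
does-sound (yes a) e = a

-- Deleting the head from the predicate keeps the tail, which does not repeat it, and strictly
-- lowers the count. An upper bound on `deg` thus passes to `degree`.
length≤cnt : ∀ {n} (xs : List (Vec Bool n)) (h : Fam n) → Unique xs → (∀ {s} → s ∈ₗ xs → h ∋ s) → length xs ≤ cnt h
length≤cnt []       h u       m = z≤n
length≤cnt (x ∷ xs) h (x∉ ∷ u) m = ≤-trans (s≤s (length≤cnt xs h′ u keep)) (sumV-mono-< (λ s → 𝟙-mono (∧-projˡ {h s})) x drops)
  where
  h′ : Fam _
  h′ s = h s ∧ not (does (x ≟ⱽ s))
  keep : ∀ {s} → s ∈ₗ xs → h′ ∋ s
  keep {s} i = ∧-intro (m (there i)) (cong not (dec-false (x ≟ⱽ s) (All.lookup x∉ i)))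
  drops : 𝟙 (h′ x) < 𝟙 (h x)
  drops rewrite dec-true (x ≟ⱽ x) refl | m (here refl) = s≤s z≤n

members : ∀ {n} → Family n → Fam n
members 𝓕 s = does (s ∈ₗ? 𝓕)
  where open DecMembership _≟ⱽ_ using () renaming (_∈?_ to _∈ₗ?_)

members-sound : ∀ {n} (𝓕 : Family n) s → members 𝓕 ∋ s → s ∈ₗ 𝓕
members-sound 𝓕 s = does-sound (DecMembership._∈?_ _≟ⱽ_ s 𝓕)

members-complete : ∀ {n} (𝓕 : Family n) s → s ∈ₗ 𝓕 → members 𝓕 ∋ s
members-complete 𝓕 s = dec-true (DecMembership._∈?_ _≟ⱽ_ s 𝓕)

⊆⇒sub : ∀ {n} (T s : Vec Bool n) → T ⊆ s → sub T s ≡ true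
⊆⇒sub []          []          p = refl
⊆⇒sub (true ∷ T)  (true ∷ s)  p = ⊆⇒sub T s (drop-∷-⊆ p)
⊆⇒sub (true ∷ T)  (false ∷ s) p with p Vec.here
... | ()
⊆⇒sub (false ∷ T) (y ∷ s)     p = ⊆⇒sub T s (drop-∷-⊆ p)

degree≤deg : ∀ {n} (𝓕 : Family n) T → Unique 𝓕 → degree 𝓕 T ≤ deg (members 𝓕) T
degree≤deg 𝓕 T u = length≤cnt (filter (T ⊆?_) 𝓕) (λ s → members 𝓕 s ∧ sub T s) (Unique.filter⁺ (T ⊆?_) u)
  λ {s} i → let m , p = ∈-filter⁻ (T ⊆?_) {xs = 𝓕} i in ∧-intro (members-complete 𝓕 s m) (⊆⇒sub T s p)

dis-disjoint : ∀ {n} (s t : Vec Bool n) → dis s t ≡ true → ¬ Nonempty (s ∩ t)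
dis-disjoint (true ∷ s)  (false ∷ t) d (suc x , Vec.there i) = dis-disjoint s t d (x , i)
dis-disjoint (false ∷ s) (true ∷ t)  d (suc x , Vec.there i) = dis-disjoint s t d (x , i)
dis-disjoint (false ∷ s) (false ∷ t) d (suc x , Vec.there i) = dis-disjoint s t d (x , i)

members-Intersects : ∀ {n} (𝓕 : Family n) → Intersecting 𝓕 → Intersects (members 𝓕)
members-Intersects 𝓕 int s t i j with dis s t in e
... | false = refl
... | true  = ⊥-elim (dis-disjoint s t e (int s t (members-sound 𝓕 s i) (members-sound 𝓕 t j)))

members-nontrivial : ∀ {n} (𝓕 : Family (suc n)) → NonTrivial 𝓕 → ∀ x → 1 ≤ cnt (λ s → members 𝓕 (insertAt s x false))
members-nontrivial 𝓕 nt x with nt x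
... | F , m , x∉F = cnt-pos (λ s → members 𝓕 (insertAt s x false)) (removeAt F x) (subst (members 𝓕 ∋_) whole (members-complete 𝓕 F m))
  where
  out : lookup F x ≡ false
  out with lookup F x in e
  ... | false = refl
  ... | true  = contradiction (lookup⇒[]= x F e) x∉F
  whole : F ≡ insertAt (removeAt F x) x false
  whole = trans (sym (insertAt-removeAt F x)) (cong (insertAt (removeAt F x) x) out)

theorem5-shifted : ∀ τ i d → Range τ i d → (𝓕 : Family (4 + (d + (2 + (τ + i)) + (τ + i)))) → IsKUniform (3 + (τ + i)) 𝓕 → Intersecting 𝓕 → NonTrivial 𝓕 →
  MinDegreeAtMost (suc τ) 𝓕 (binom (3 + (τ + i) + suc (d + i)) (suc i) ∸ binom (suc (d + i)) (suc i))
theorem5-shifted τ i d range 𝓕 (unique , uniform) int nt with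
  Degrees.min-degree τ i d range (members 𝓕) (λ s m → uniform s (members-sound 𝓕 s m)) (members-Intersects 𝓕 int) (members-nontrivial 𝓕 nt)
... | T , e , le = T , e , ≤-trans (degree≤deg 𝓕 T unique) le

∸∸-unique : ∀ {n} a b x → a + (b + x) ≡ n → x ≡ n ∸ a ∸ b
∸∸-unique a b x refl = sym (trans (cong (_∸ b) (m+n∸m≡n a (b + x))) (m+n∸m≡n b x))

theorem5-reparametrized : ∀ τ i d n k → 3 + (τ + i) ≡ k → 4 + (d + (2 + (τ + i)) + (τ + i)) ≡ n → Range τ i d →
  (𝓕 : Family n) → IsKUniform k 𝓕 → Intersecting 𝓕 → NonTrivial 𝓕 →
  MinDegreeAtMost (suc τ) 𝓕 (((n ∸ suc τ ∸ 1) C (k ∸ suc τ ∸ 1)) ∸ ((n ∸ suc τ ∸ k ∸ 1) C (k ∸ suc τ ∸ 1)))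
theorem5-reparametrized τ i d n k refl refl range 𝓕 uniform int nt =
  let T , e , le = theorem5-shifted τ i d range 𝓕 uniform int nt in T , e , ≤-trans le (≤-reflexive bound)
  where
  z : ℕ
  z = d + (2 + (τ + i)) + (τ + i)
  top₁ : 3 + (τ + i) + suc (d + i) ≡ 4 + z ∸ suc τ ∸ 1
  top₁ = ∸∸-unique (suc τ) 1 (3 + (τ + i) + suc (d + i)) (lemma τ i d)
    where
    lemma : ∀ τ i d → suc τ + (1 + (3 + (τ + i) + suc (d + i))) ≡ 4 + (d + (2 + (τ + i)) + (τ + i))
    lemma = solve-∀
  top₂ : suc (d + i) ≡ 4 + z ∸ suc τ ∸ (3 + (τ + i)) ∸ 1
  top₂ = ∸∸-unique (3 + (τ + i)) 1 (suc (d + i))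
    -- Three numbers are subtracted but the lemma handles two, so the inner use removes only t and
    -- takes 0 as the second.
    (∸∸-unique (suc τ) 0 (3 + (τ + i) + (1 + suc (d + i))) (lemma τ i d))
    where
    lemma : ∀ τ i d → suc τ + (0 + (3 + (τ + i) + (1 + suc (d + i)))) ≡ 4 + (d + (2 + (τ + i)) + (τ + i))
    lemma = solve-∀
  bottom : suc i ≡ 3 + (τ + i) ∸ suc τ ∸ 1
  bottom = ∸∸-unique (suc τ) 1 (suc i) (lemma τ i)
    where
    lemma : ∀ τ i → suc τ + (1 + suc i) ≡ 3 + (τ + i)
    lemma = solve-∀
  bound : binom (3 + (τ + i) + suc (d + i)) (suc i) ∸ binom (suc (d + i)) (suc i)
    ≡ ((4 + z ∸ suc τ ∸ 1) C (3 + (τ + i) ∸ suc τ ∸ 1)) ∸ ((4 + z ∸ suc τ ∸ (3 + (τ + i)) ∸ 1) C (3 + (τ + i) ∸ suc τ ∸ 1))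
  bound = cong₂ _∸_ (trans (binom≡C (3 + (τ + i) + suc (d + i)) (suc i)) (cong₂ _C_ top₁ bottom)) (trans (binom≡C (suc (d + i)) (suc i)) (cong₂ _C_ top₂ bottom))

n≥2k : ∀ {n k t} → ((t ≡ 1 × 2 * k + 5 ≤ n × 30 ≤ k) ⊎ (1 < t × 4 * (t + 2) ≤ k × 2 * k + 14 * t ≤ n)) → 2 * k ≤ n
n≥2k {k = k}         (inj₁ (_ , hn , _)) = ≤-trans (m≤m+n (2 * k) 5) hn
n≥2k {k = k} {t = t} (inj₂ (_ , _ , hn)) = ≤-trans (m≤m+n (2 * k) (14 * t)) hn

k≥t+2 : ∀ {n k τ} → ((suc τ ≡ 1 × 2 * k + 5 ≤ n × 30 ≤ k) ⊎ (1 < suc τ × 4 * (suc τ + 2) ≤ k × 2 * k + 14 * suc τ ≤ n)) → 3 + τ ≤ k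
k≥t+2         (inj₁ (refl , _ , hk)) = ≤-trans (m≤m+n 3 27) hk
k≥t+2 {τ = τ} (inj₂ (_ , hk , _))    = ≤-trans (≤-by (9 + 3 * τ) (lemma τ)) hk
  where
  lemma : ∀ τ → 3 + τ + (9 + 3 * τ) ≡ 4 * (suc τ + 2)
  lemma = solve-∀

hypothesis⇒Range : ∀ {n k τ} → ((suc τ ≡ 1 × 2 * k + 5 ≤ n × 30 ≤ k) ⊎ (1 < suc τ × 4 * (suc τ + 2) ≤ k × 2 * k + 14 * suc τ ≤ n)) →
  Range τ (k ∸ (3 + τ)) (n ∸ 2 * k)
hypothesis⇒Range {k = k} (inj₁ (refl , hn , hk)) = inj₁ (refl , m+n≤o⇒m≤o∸n 27 hk , m+n≤o⇒m≤o∸n 5 (≤-trans (≤-reflexive (+-comm 5 (2 * k))) hn))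
hypothesis⇒Range {k = k} {τ} (inj₂ (s≤s hτ , hk , hn)) =
  inj₂ (hτ , m+n≤o⇒m≤o∸n (3 * suc τ + 6) (≤-trans (≤-reflexive (lemma τ)) hk) , m+n≤o⇒m≤o∸n (14 * suc τ) (≤-trans (≤-reflexive (+-comm (14 * suc τ) (2 * k))) hn))
  where
  lemma : ∀ τ → 3 * suc τ + 6 + (3 + τ) ≡ 4 * (suc τ + 2)
  lemma = solve-∀

theorem5 : (n k t : ℕ) → 1 ≤ n → 1 ≤ k → 1 ≤ t
    → ((t ≡ 1 × 2 * k + 5 ≤ n × 30 ≤ k) ⊎ (1 < t × 4 * (t + 2) ≤ k × 2 * k + 14 * t ≤ n))
    → (𝓕 : Family n) → IsKUniform k 𝓕 → Intersecting 𝓕 → NonTrivial 𝓕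
    → MinDegreeAtMost t 𝓕 (((n ∸ t ∸ 1) C (k ∸ t ∸ 1)) ∸ ((n ∸ t ∸ k ∸ 1) C (k ∸ t ∸ 1)))
theorem5 n k (suc τ) _ _ _ range = theorem5-reparametrized τ (k ∸ (3 + τ)) (n ∸ 2 * k) n k k-def
  (trans (lemma (τ + (k ∸ (3 + τ))) (n ∸ 2 * k)) (trans (cong (λ k′ → 2 * k′ + (n ∸ 2 * k)) k-def) (m+[n∸m]≡n (n≥2k range)))) (hypothesis⇒Range range)
  where
  k-def : 3 + τ + (k ∸ (3 + τ)) ≡ k
  k-def = m+[n∸m]≡n (k≥t+2 range)
  lemma : ∀ κ d → 4 + (d + (2 + κ) + κ) ≡ 2 * (3 + κ) + d
  lemma = solve-∀
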